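{- Let $K$ be a PAC field of characteristic $\neq 2$, and let $n\geq 1$ be an integer. A non-degenerate quadratic form of dimension $n$ over $K$ is isomorphic (over $K$) to a scaled trace form over $K$ if and only if $K$ has a separable field extension of degree $n$.
   Context: A field $K$ is PAC (pseudo algebraically closed) if every (absolutely irreducible) variety defined over $K$ has a $K$-rational point; equivalently, every absolutely irreducible polynomial $f(X,Y)$ in two variables with coefficients in $K$ has infinitely many roots $(x,y)\in K^2$. A scaled trace form over $K$ is a quadratic form of the shape $x\mapsto \mathrm{Tr}_{F/K}(\alpha x^2)$, $x\in F$, where $F/K$ is a finite separable field extension and $\alpha\in F$ is nonzero; it is a quadratic form over $K$ of dimension $[F:K]$. -}

module Defs where

open import Level using (Level; _⊔_) renaming (suc to lsuc)
open import Data.Nat.Base as ℕ using (ℕ; zero; suc)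
open import Data.Fin.Base using (Fin; zero; suc)
open import Data.List.Base as List using (List; []; _∷_)
open import Data.Product.Base using (Σ; Σ-syntax; ∃; ∃-syntax; _×_; _,_)
open import Data.Sum.Base using (_⊎_)
open import Data.Vec.Functional using (Vector)
open import Relation.Nullary.Negation.Core using (¬_)
open import Relation.Binary.Structures using (IsEquivalence)
open import Algebra.Bundles using (CommutativeRing)
open import Algebra.Module.Bundles using (LeftModule)
open import Algebra.Module.Morphism.Structures using (module LeftModuleMorphisms)
open import Algebra.Morphism.Structures using (module RingMorphisms)
import Algebra.Definitions.RawMagma as RawMagmaDefinitions
import Algebra.Definitions.RawMonoid as RawMonoidDefinitions
import Algebra.Properties.CommutativeMonoid.Sum as Sum
import Algebra.Properties.Group as GroupProperties
import Algebra.Solver.Ring.NaturalCoefficients.Default as SemiringSolver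
import Relation.Binary.Reasoning.Setoid as SetoidReasoning

private
  variable
    c ℓ m ℓm m′ ℓm′ : Level

-- Univariate polynomials: coefficient lists, lowest degree first.  Lists
-- which differ by trailing zeros are identified by _≋_.

module Polynomial (R : CommutativeRing c ℓ) where
  open CommutativeRing R

  Poly : Set c
  Poly = List Carrier

  coeff : Poly → ℕ → Carrier
  coeff []      i       = 0#
  coeff (a ∷ p) zero    = a
  coeff (a ∷ p) (suc i) = coeff p i

  infix 4 _≋_

  record _≋_ (p q : Poly) : Set ℓ where
    constructor mk≋
    field at : ∀ i → coeff p i ≈ coeff q i

  open _≋_ public

  infixl 6 _⊕_
  infixl 7 _⊛_ _·_

  _⊕_ : Poly → Poly → Poly
  []      ⊕ q       = q
  (a ∷ p) ⊕ []      = a ∷ p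
  (a ∷ p) ⊕ (b ∷ q) = (a + b) ∷ (p ⊕ q)

  ⊖_ : Poly → Poly
  ⊖_ = List.map (-_)

  _·_ : Carrier → Poly → Poly
  a · p = List.map (a *_) p

  -- Multiplication by X.
  shift : Poly → Poly
  shift p = 0# ∷ p

  _⊛_ : Poly → Poly → Poly
  []      ⊛ q = []
  (a ∷ p) ⊛ q = (a · q) ⊕ shift (p ⊛ q)

  -- (a + X p)′ = p + X p′
  derivative : Poly → Poly
  derivative []      = []
  derivative (a ∷ p) = p ⊕ shift (derivative p)

  Monic : Poly → Set ℓ
  Monic p = ∃[ d ] (coeff p d ≈ 1# × (∀ i → d ℕ.< i → coeff p i ≈ 0#))

  NonConstant : Poly → Set ℓ
  NonConstant p = ∃[ d ] ¬ (coeff p (suc d) ≈ 0#)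

  open GroupProperties +-group using (ε⁻¹≈ε)

  coeff-⊕ : ∀ p q i → coeff (p ⊕ q) i ≈ coeff p i + coeff q i
  coeff-⊕ []      q       i       = sym (+-identityˡ _)
  coeff-⊕ (a ∷ p) []      i       = sym (+-identityʳ _)
  coeff-⊕ (a ∷ p) (b ∷ q) zero    = refl
  coeff-⊕ (a ∷ p) (b ∷ q) (suc i) = coeff-⊕ p q i

  coeff-⊖ : ∀ p i → coeff (⊖ p) i ≈ - coeff p i
  coeff-⊖ []      i       = sym ε⁻¹≈ε
  coeff-⊖ (a ∷ p) zero    = refl
  coeff-⊖ (a ∷ p) (suc i) = coeff-⊖ p i

  coeff-· : ∀ a p i → coeff (a · p) i ≈ a * coeff p i
  coeff-· a []      i       = sym (zeroʳ a)
  coeff-· a (b ∷ p) zero    = refl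
  coeff-· a (b ∷ p) (suc i) = coeff-· a p i

  ≋-isEquivalence : IsEquivalence _≋_
  ≋-isEquivalence = record
    { refl  = mk≋ λ i → refl
    ; sym   = λ e → mk≋ λ i → sym (at e i)
    ; trans = λ e f → mk≋ λ i → trans (at e i) (at f i)
    }

  open IsEquivalence ≋-isEquivalence using ()
    renaming (refl to ≋-refl; sym to ≋-sym; trans to ≋-trans)

  ⊕-cong : ∀ {p p′ q q′} → p ≋ p′ → q ≋ q′ → p ⊕ q ≋ p′ ⊕ q′
  ⊕-cong {p} {p′} {q} {q′} e f = mk≋ λ i →
    trans (coeff-⊕ p q i)
      (trans (+-cong (at e i) (at f i)) (sym (coeff-⊕ p′ q′ i)))

  ⊕-assoc : ∀ p q r → (p ⊕ q) ⊕ r ≋ p ⊕ (q ⊕ r)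
  ⊕-assoc p q r = mk≋ λ i → begin
    coeff ((p ⊕ q) ⊕ r) i               ≈⟨ coeff-⊕ (p ⊕ q) r i ⟩
    coeff (p ⊕ q) i + coeff r i         ≈⟨ +-congʳ (coeff-⊕ p q i) ⟩
    coeff p i + coeff q i + coeff r i   ≈⟨ +-assoc _ _ _ ⟩
    coeff p i + (coeff q i + coeff r i) ≈⟨ +-congˡ (coeff-⊕ q r i) ⟨
    coeff p i + coeff (q ⊕ r) i         ≈⟨ coeff-⊕ p (q ⊕ r) i ⟨
    coeff (p ⊕ (q ⊕ r)) i               ∎
    where open SetoidReasoning setoid

  ⊕-comm : ∀ p q → p ⊕ q ≋ q ⊕ p
  ⊕-comm p q = mk≋ λ i →
    trans (coeff-⊕ p q i) (trans (+-comm _ _) (sym (coeff-⊕ q p i)))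

  ⊕-identityʳ : ∀ p → p ⊕ [] ≋ p
  ⊕-identityʳ p = mk≋ λ i → trans (coeff-⊕ p [] i) (+-identityʳ _)

  ⊖-cong : ∀ {p q} → p ≋ q → ⊖ p ≋ ⊖ q
  ⊖-cong {p} {q} e = mk≋ λ i →
    trans (coeff-⊖ p i) (trans (-‿cong (at e i)) (sym (coeff-⊖ q i)))

  ⊖-inverseʳ : ∀ p → p ⊕ (⊖ p) ≋ []
  ⊖-inverseʳ p = mk≋ λ i →
    trans (coeff-⊕ p (⊖ p) i)
      (trans (+-congˡ (coeff-⊖ p i)) (-‿inverseʳ _))

  ⊖-inverseˡ : ∀ p → (⊖ p) ⊕ p ≋ []
  ⊖-inverseˡ p = ≋-trans (⊕-comm (⊖ p) p) (⊖-inverseʳ p)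

  ∷-cong : ∀ {a b p q} → a ≈ b → p ≋ q → (a ∷ p) ≋ (b ∷ q)
  ∷-cong e f = mk≋ λ { zero → e ; (suc i) → at f i }

  shift-cong : ∀ {p q} → p ≋ q → shift p ≋ shift q
  shift-cong = ∷-cong refl

  shift-[] : shift [] ≋ []
  shift-[] = mk≋ λ { zero → refl ; (suc i) → refl }

  shift-⊕ : ∀ p q → shift (p ⊕ q) ≋ shift p ⊕ shift q
  shift-⊕ p q = ∷-cong (sym (+-identityˡ 0#)) ≋-refl

  ·-cong : ∀ {a b p q} → a ≈ b → p ≋ q → a · p ≋ b · q
  ·-cong {a} {b} {p} {q} e f = mk≋ λ i →
    trans (coeff-· a p i) (trans (*-cong e (at f i)) (sym (coeff-· b q i)))

  ·-distribˡ : ∀ a p q → a · (p ⊕ q) ≋ a · p ⊕ a · q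
  ·-distribˡ a p q = mk≋ λ i → begin
    coeff (a · (p ⊕ q)) i             ≈⟨ coeff-· a (p ⊕ q) i ⟩
    a * coeff (p ⊕ q) i               ≈⟨ *-congˡ (coeff-⊕ p q i) ⟩
    a * (coeff p i + coeff q i)       ≈⟨ distribˡ _ _ _ ⟩
    a * coeff p i + a * coeff q i     ≈⟨ +-cong (coeff-· a p i) (coeff-· a q i) ⟨
    coeff (a · p) i + coeff (a · q) i ≈⟨ coeff-⊕ (a · p) (a · q) i ⟨
    coeff (a · p ⊕ a · q) i           ∎
    where open SetoidReasoning setoid

  ·-assoc : ∀ a b p → (a * b) · p ≋ a · (b · p)
  ·-assoc a b p = mk≋ λ i →
    trans (coeff-· (a * b) p i) (trans (*-assoc _ _ _)
      (trans (*-congˡ (sym (coeff-· b p i))) (sym (coeff-· a (b · p) i))))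

  ·-zeroˡ : ∀ p → 0# · p ≋ []
  ·-zeroˡ p = mk≋ λ i → trans (coeff-· 0# p i) (zeroˡ _)

  ·-identityˡ : ∀ p → 1# · p ≋ p
  ·-identityˡ p = mk≋ λ i → trans (coeff-· 1# p i) (*-identityˡ _)

  shift-· : ∀ a p → a · shift p ≋ shift (a · p)
  shift-· a p = ∷-cong (zeroʳ a) ≋-refl

  ⊛-congˡ : ∀ p {q q′} → q ≋ q′ → p ⊛ q ≋ p ⊛ q′
  ⊛-congˡ []      e = ≋-refl
  ⊛-congˡ (a ∷ p) e = ⊕-cong (·-cong refl e) (shift-cong (⊛-congˡ p e))

  ⊛-zeroʳ : ∀ p → p ⊛ [] ≋ []
  ⊛-zeroʳ []      = ≋-refl
  ⊛-zeroʳ (a ∷ p) = ≋-trans (shift-cong (⊛-zeroʳ p)) shift-[]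

  ⊕-xchg : ∀ p q r → p ⊕ (q ⊕ r) ≋ q ⊕ (p ⊕ r)
  ⊕-xchg p q r = ≋-trans (≋-sym (⊕-assoc p q r))
    (≋-trans (⊕-cong (⊕-comm p q) ≋-refl) (⊕-assoc q p r))

  ⊛-∷ʳ : ∀ p b q → p ⊛ (b ∷ q) ≋ b · p ⊕ shift (p ⊛ q)
  ⊛-∷ʳ []      b q = ≋-sym shift-[]
  ⊛-∷ʳ (a ∷ p) b q = ∷-cong (+-congʳ (*-comm a b))
    (≋-trans (⊕-cong {a · q} ≋-refl (⊛-∷ʳ p b q))
             (⊕-xchg (a · q) (b · p) (shift (p ⊛ q))))

  ⊛-comm : ∀ p q → p ⊛ q ≋ q ⊛ p
  ⊛-comm []      q = ≋-sym (⊛-zeroʳ q)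
  ⊛-comm (a ∷ p) q =
    ≋-trans (⊕-cong {a · q} ≋-refl (shift-cong (⊛-comm p q)))
            (≋-sym (⊛-∷ʳ q a p))

  ⊛-cong : ∀ {p p′ q q′} → p ≋ p′ → q ≋ q′ → p ⊛ q ≋ p′ ⊛ q′
  ⊛-cong {p} {p′} {q} {q′} e f = ≋-trans (⊛-congˡ p f)
    (≋-trans (⊛-comm p q′) (≋-trans (⊛-congˡ q′ e) (⊛-comm q′ p′)))

  ⊕-interchange : ∀ p q r s → (p ⊕ q) ⊕ (r ⊕ s) ≋ (p ⊕ r) ⊕ (q ⊕ s)
  ⊕-interchange p q r s = ≋-trans (⊕-assoc p q (r ⊕ s))
    (≋-trans (⊕-cong {p} ≋-refl (⊕-xchg q r s))
             (≋-sym (⊕-assoc p r (q ⊕ s))))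

  ⊛-distribˡ : ∀ p q r → p ⊛ (q ⊕ r) ≋ p ⊛ q ⊕ p ⊛ r
  ⊛-distribˡ []      q r = ≋-refl
  ⊛-distribˡ (a ∷ p) q r =
    ≋-trans (⊕-cong (·-distribˡ a q r)
               (≋-trans (shift-cong (⊛-distribˡ p q r))
                        (shift-⊕ (p ⊛ q) (p ⊛ r))))
            (⊕-interchange (a · q) (a · r) (shift (p ⊛ q)) (shift (p ⊛ r)))

  ⊛-distribʳ : ∀ p q r → (q ⊕ r) ⊛ p ≋ q ⊛ p ⊕ r ⊛ p
  ⊛-distribʳ p q r = ≋-trans (⊛-comm (q ⊕ r) p)
    (≋-trans (⊛-distribˡ p q r) (⊕-cong (⊛-comm p q) (⊛-comm p r)))

  ·-⊛ : ∀ a p q → (a · p) ⊛ q ≋ a · (p ⊛ q)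
  ·-⊛ a []      q = ≋-refl
  ·-⊛ a (b ∷ p) q =
    ≋-trans (⊕-cong (·-assoc a b q)
               (≋-trans (shift-cong (·-⊛ a p q)) (≋-sym (shift-· a (p ⊛ q)))))
            (≋-sym (·-distribˡ a (b · q) (shift (p ⊛ q))))

  shift-⊛ : ∀ p q → shift p ⊛ q ≋ shift (p ⊛ q)
  shift-⊛ p q = ⊕-cong (·-zeroˡ q) ≋-refl

  ⊛-assoc : ∀ p q r → (p ⊛ q) ⊛ r ≋ p ⊛ (q ⊛ r)
  ⊛-assoc []      q r = ≋-refl
  ⊛-assoc (a ∷ p) q r =
    ≋-trans (⊛-distribʳ r (a · q) (shift (p ⊛ q)))
            (⊕-cong (·-⊛ a q r)
              (≋-trans (shift-⊛ (p ⊛ q) r) (shift-cong (⊛-assoc p q r))))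

  ⊛-identityˡ : ∀ p → (1# ∷ []) ⊛ p ≋ p
  ⊛-identityˡ p =
    ≋-trans (⊕-cong (·-identityˡ p) shift-[]) (⊕-identityʳ p)

  ⊛-identityʳ : ∀ p → p ⊛ (1# ∷ []) ≋ p
  ⊛-identityʳ p = ≋-trans (⊛-comm p (1# ∷ [])) (⊛-identityˡ p)

  polynomialRing : CommutativeRing c ℓ
  polynomialRing = record
    { Carrier = Poly
    ; _≈_ = _≋_
    ; _+_ = _⊕_
    ; _*_ = _⊛_
    ; -_  = ⊖_
    ; 0#  = []
    ; 1#  = 1# ∷ []
    ; isCommutativeRing = record
      { isRing = record
        { +-isAbelianGroup = record
          { isGroup = record
            { isMonoid = record
              { isSemigroup = record
                { isMagma = record
                  { isEquivalence = ≋-isEquivalence ; ∙-cong = ⊕-cong }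
                ; assoc = ⊕-assoc
                }
              ; identity = (λ p → ≋-refl) , ⊕-identityʳ
              }
            ; inverse = ⊖-inverseˡ , ⊖-inverseʳ
            ; ⁻¹-cong = ⊖-cong
            }
          ; comm = ⊕-comm
          }
        ; *-cong = ⊛-cong
        ; *-assoc = ⊛-assoc
        ; *-identity = ⊛-identityˡ , ⊛-identityʳ
        ; distrib = ⊛-distribˡ , ⊛-distribʳ
        }
      ; *-comm = ⊛-comm
      }
    }

  -- p(x) for x in S, with coefficients sent to S by φ.
  eval₂ : ∀ {c′ ℓ′} (S : CommutativeRing c′ ℓ′) →
          (Carrier → CommutativeRing.Carrier S) →
          CommutativeRing.Carrier S → Poly → CommutativeRing.Carrier S
  eval₂ S φ x []      = CommutativeRing.0# S
  eval₂ S φ x (a ∷ p) = φ a S.+ x S.* eval₂ S φ x p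
    where module S = CommutativeRing S

  eval : Carrier → Poly → Carrier
  eval = eval₂ R (λ a → a)

  -- Separable polynomials: p is coprime to p′, in Bézout form.
  SeparablePolynomial : Poly → Set (c ⊔ ℓ)
  SeparablePolynomial p =
    ∃[ u ] ∃[ v ] (u ⊛ p ⊕ v ⊛ derivative p ≋ 1# ∷ [])

-- Multivariate polynomials: R[X₀,…,Xᵣ] = R[X₁,…,Xᵣ][X₀]

module _ (R : CommutativeRing c ℓ) where
  open CommutativeRing R using (Carrier)

  MvPolyRing : ℕ → CommutativeRing c ℓ
  MvPolyRing zero    = R
  MvPolyRing (suc r) = Polynomial.polynomialRing (MvPolyRing r)

  MvPoly : ℕ → Set c
  MvPoly r = CommutativeRing.Carrier (MvPolyRing r)

  evalMv : ∀ r → Vector Carrier r → MvPoly r → Carrier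
  evalMv zero    x p = p
  evalMv (suc r) x p =
    Polynomial.eval₂ (MvPolyRing r) R (evalMv r (λ i → x (suc i))) (x zero) p

mapMv : (R S : CommutativeRing c ℓ) →
        (CommutativeRing.Carrier R → CommutativeRing.Carrier S) →
        ∀ r → MvPoly R r → MvPoly S r
mapMv R S φ zero    a = φ a
mapMv R S φ (suc r) p = List.map (mapMv R S φ r) p

module _ (R : CommutativeRing c ℓ) where
  open CommutativeRing R
  open RawMonoidDefinitions +-rawMonoid using (sum)

  _∈⟨_⟩ : Carrier → ∀ {n} → Vector Carrier n → Set (c ⊔ ℓ)
  _∈⟨_⟩ x {n} g = Σ[ a ∈ Vector Carrier n ] x ≈ sum (λ i → a i * g i)

  IsPrimeIdeal⟨_⟩ : ∀ {n} → Vector Carrier n → Set (c ⊔ ℓ)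
  IsPrimeIdeal⟨ g ⟩ =
    ¬ (1# ∈⟨ g ⟩) × (∀ x y → (x * y) ∈⟨ g ⟩ → x ∈⟨ g ⟩ ⊎ y ∈⟨ g ⟩)

record Field c ℓ : Set (lsuc (c ⊔ ℓ)) where
  field
    commutativeRing : CommutativeRing c ℓ

  open CommutativeRing commutativeRing public

  field
    1≉0     : ¬ (1# ≈ 0#)
    inverse : ∀ x → ¬ (x ≈ 0#) → ∃[ y ] x * y ≈ 1#

Characteristic≢2 : Field c ℓ → Set ℓ
Characteristic≢2 K = ¬ (1# + 1# ≈ 0#)
  where open Field K

record Extension {c ℓ} (K : Field c ℓ) : Set (lsuc (c ⊔ ℓ)) where
  private module K = Field K
  field
    top : Field c ℓ

  open Field top public

  open RingMorphisms K.rawRing rawRing using (IsRingHomomorphism)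

  field
    ι     : K.Carrier → Carrier
    ι-hom : IsRingHomomorphism ι

  open RingMorphisms.IsRingHomomorphism ι-hom public
    using (⟦⟧-cong; +-homo; *-homo; 0#-homo; 1#-homo; -‿homo)

  open Polynomial K.commutativeRing using (Poly; eval₂)

  evalAt : Carrier → Poly → Carrier
  evalAt = eval₂ commutativeRing ι

  vectorSpace : LeftModule K.ring c ℓ
  vectorSpace = record
    { Carrierᴹ = Carrier
    ; _≈ᴹ_ = _≈_
    ; _+ᴹ_ = _+_
    ; _*ₗ_ = λ a x → ι a * x
    ; 0ᴹ   = 0#
    ; -ᴹ_  = -_
    ; isLeftModule = record
      { isLeftSemimodule = record
        { +ᴹ-isCommutativeMonoid = +-isCommutativeMonoid
        ; isPreleftSemimodule = record
          { *ₗ-cong = λ e f → *-cong (⟦⟧-cong e) f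
          ; *ₗ-zeroˡ = λ x → trans (*-congʳ 0#-homo) (zeroˡ x)
          ; *ₗ-distribʳ = λ x a b →
              trans (*-congʳ (+-homo a b)) (distribʳ x (ι a) (ι b))
          ; *ₗ-identityˡ = λ x → trans (*-congʳ 1#-homo) (*-identityˡ x)
          ; *ₗ-assoc = λ a b x →
              trans (*-congʳ (*-homo a b)) (*-assoc (ι a) (ι b) x)
          ; *ₗ-zeroʳ = λ a → zeroʳ (ι a)
          ; *ₗ-distribˡ = λ a x y → distribˡ (ι a) x y
          }
        }
      ; -ᴹ‿cong = -‿cong
      ; -ᴹ‿inverse = -‿inverse
      }
    }

module _ {K : Field c ℓ} (L : Extension K) where
  private
    module K = Field K
    module L = Extension L
    module K[X] = Polynomial K.commutativeRing
    module L[X] = Polynomial L.commutativeRing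

  open RawMagmaDefinitions
    (CommutativeRing.*-rawMagma K[X].polynomialRing) using (_∣_)

  record IsMinimalPolynomial (x : L.Carrier) (p : K[X].Poly) : Set (c ⊔ ℓ) where
    field
      monic   : K[X].Monic p
      root    : L.evalAt x p L.≈ L.0#
      minimal : ∀ q → L.evalAt x q L.≈ L.0# → p ∣ q

  IsSeparable : Set (c ⊔ ℓ)
  IsSeparable =
    ∀ x → ∃[ p ] (IsMinimalPolynomial x p × K[X].SeparablePolynomial p)

  record IsAlgebraicClosure : Set (c ⊔ ℓ) where
    field
      algebraicallyClosed :
        ∀ p → L[X].NonConstant p → ∃[ x ] L[X].eval x p L.≈ L.0#
      algebraic :
        ∀ x → ∃[ p ] (¬ (p K[X].≋ []) × L.evalAt x p L.≈ L.0#)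

module _ (K : Field c ℓ) where
  open Field K

  -- The affine scheme defined by f₀ = … = fₘ₋₁ = 0 over K is an absolutely
  -- irreducible variety: over an algebraic closure L of K, the ideal
  -- generated by f in L[X₀,…,Xᵣ₋₁] is prime.  (Algebraic closures are
  -- isomorphic over K, so the choice of L is immaterial.)
  AbsolutelyIrreducible :
    ∀ {r m} → Vector (MvPoly commutativeRing r) m → Set (lsuc (c ⊔ ℓ))
  AbsolutelyIrreducible {r} f =
    (L : Extension K) → IsAlgebraicClosure L →
    let open Extension L using (ι) renaming (commutativeRing to Lring) in
    IsPrimeIdeal⟨_⟩ (MvPolyRing Lring r)
      (λ i → mapMv commutativeRing Lring ι r (f i))

  PAC : Set (lsuc (c ⊔ ℓ))
  PAC = ∀ {r m} (f : Vector (MvPoly commutativeRing r) m) →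
        AbsolutelyIrreducible {r} f →
        Σ[ x ∈ Vector Carrier r ] (∀ i → evalMv commutativeRing r x (f i) ≈ 0#)

module _ {K : Field c ℓ} (V : LeftModule (Field.ring K) m ℓm) where
  private module K = Field K
  open LeftModule V
  open RawMonoidDefinitions +ᴹ-rawMonoid using (sum)

  record Basis (n : ℕ) : Set (c ⊔ ℓ ⊔ m ⊔ ℓm) where
    field
      vec         : Vector Carrierᴹ n
      coord       : Carrierᴹ → Vector K.Carrier n
      spanning    : ∀ x → x ≈ᴹ sum (λ i → coord x i *ₗ vec i)
      independent : ∀ (a : Vector K.Carrier n) →
                    sum (λ i → a i *ₗ vec i) ≈ᴹ 0ᴹ → ∀ i → a i K.≈ K.0#

    trace : (Carrierᴹ → Carrierᴹ) → K.Carrier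
    trace f = RawMonoidDefinitions.sum K.+-rawMonoid (λ i → coord (f (vec i)) i)

module _ {K : Field c ℓ} {V : LeftModule (Field.ring K) m ℓm}
         {n : ℕ} (b : Basis {K = K} V n) where
  private
    module K = Field K
    module S = Sum (LeftModule.+ᴹ-commutativeMonoid V)
    module KS = Sum K.+-commutativeMonoid
  open LeftModule V
  open Basis b

  private
    comb : Vector K.Carrier n → Carrierᴹ
    comb a = S.sum (λ i → a i *ₗ vec i)

    comb-+ : ∀ a a′ → comb (λ i → a i K.+ a′ i) ≈ᴹ comb a +ᴹ comb a′
    comb-+ a a′ = ≈ᴹ-trans
      (S.sum-cong-≋ {n} (λ i → *ₗ-distribʳ (vec i) (a i) (a′ i)))
      (S.∑-distrib-+ (λ i → a i *ₗ vec i) (λ i → a′ i *ₗ vec i))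

    sum-*ₗ : ∀ k {j} (v : Vector Carrierᴹ j) →
             S.sum (λ i → k *ₗ v i) ≈ᴹ k *ₗ S.sum v
    sum-*ₗ k {zero}  v = ≈ᴹ-sym (*ₗ-zeroʳ k)
    sum-*ₗ k {suc j} v = ≈ᴹ-trans (+ᴹ-congˡ (sum-*ₗ k (λ i → v (suc i))))
      (≈ᴹ-sym (*ₗ-distribˡ k (v zero) (S.sum (λ i → v (suc i)))))

    comb-* : ∀ k a → comb (λ i → k K.* a i) ≈ᴹ k *ₗ comb a
    comb-* k a = ≈ᴹ-trans
      (S.sum-cong-≋ {n} (λ i → *ₗ-assoc k (a i) (vec i)))
      (sum-*ₗ k (λ i → a i *ₗ vec i))

    comb-injective : ∀ a a′ → comb a ≈ᴹ comb a′ → ∀ i → a i K.≈ a′ i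
    comb-injective a a′ e i = begin
      a i                            ≈⟨ K.+-identityʳ _ ⟨
      a i K.+ K.0#                   ≈⟨ K.+-congˡ (K.-‿inverseˡ _) ⟨
      a i K.+ (K.- a′ i K.+ a′ i)    ≈⟨ K.+-assoc _ _ _ ⟨
      (a i K.+ K.- a′ i) K.+ a′ i    ≈⟨ K.+-congʳ (independent d d≈0 i) ⟩
      K.0# K.+ a′ i                  ≈⟨ K.+-identityˡ _ ⟩
      a′ i                           ∎
      where
      open SetoidReasoning K.setoid
      d : Vector K.Carrier n
      d i = a i K.+ K.- a′ i
      d≈0 : comb d ≈ᴹ 0ᴹ
      d≈0 = ≈ᴹ-trans (comb-+ a (λ i → K.- a′ i))
        (≈ᴹ-trans (+ᴹ-congʳ e)
        (≈ᴹ-trans (≈ᴹ-sym (comb-+ a′ (λ i → K.- a′ i)))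
        (≈ᴹ-trans (S.sum-cong-≋ {n} (λ i →
           ≈ᴹ-trans (*ₗ-congʳ (K.-‿inverseʳ (a′ i))) (*ₗ-zeroˡ (vec i))))
        (S.sum-replicate-zero n))))

  coord-cong : ∀ {x y} → x ≈ᴹ y → ∀ i → coord x i K.≈ coord y i
  coord-cong {x} {y} e = comb-injective (coord x) (coord y)
    (≈ᴹ-trans (≈ᴹ-sym (spanning x)) (≈ᴹ-trans e (spanning y)))

  coord-+ : ∀ x y i → coord (x +ᴹ y) i K.≈ coord x i K.+ coord y i
  coord-+ x y = comb-injective (coord (x +ᴹ y)) (λ i → coord x i K.+ coord y i)
    (≈ᴹ-trans (≈ᴹ-sym (spanning (x +ᴹ y)))
    (≈ᴹ-trans (+ᴹ-cong (spanning x) (spanning y))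
              (≈ᴹ-sym (comb-+ (coord x) (coord y)))))

  coord-* : ∀ k x i → coord (k *ₗ x) i K.≈ k K.* coord x i
  coord-* k x = comb-injective (coord (k *ₗ x)) (λ i → k K.* coord x i)
    (≈ᴹ-trans (≈ᴹ-sym (spanning (k *ₗ x)))
    (≈ᴹ-trans (*ₗ-congˡ (spanning x)) (≈ᴹ-sym (comb-* k (coord x)))))

  trace-cong : ∀ {f g} → (∀ x → f x ≈ᴹ g x) → trace f K.≈ trace g
  trace-cong e = KS.sum-cong-≋ {n} (λ i → coord-cong (e (vec i)) i)

  trace-+ : ∀ f g → trace (λ x → f x +ᴹ g x) K.≈ trace f K.+ trace g
  trace-+ f g = K.trans
    (KS.sum-cong-≋ {n} (λ i → coord-+ (f (vec i)) (g (vec i)) i))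
    (KS.∑-distrib-+ (λ i → coord (f (vec i)) i) (λ i → coord (g (vec i)) i))

  trace-* : ∀ k f → trace (λ x → k *ₗ f x) K.≈ k K.* trace f
  trace-* k f = K.trans
    (KS.sum-cong-≋ {n} (λ i → coord-* k (f (vec i)) i))
    (sum-* (λ i → coord (f (vec i)) i))
    where
    sum-* : ∀ {j} (v : Vector K.Carrier j) →
            KS.sum (λ i → k K.* v i) K.≈ k K.* KS.sum v
    sum-* {zero}  v = K.sym (K.zeroʳ k)
    sum-* {suc j} v = K.trans (K.+-congˡ (sum-* (λ i → v (suc i))))
                              (K.sym (K.distribˡ k _ _))

module _ {K : Field c ℓ} (F : Extension K)
         {n : ℕ} (b : Basis {K = K} (Extension.vectorSpace F) n) where
  open Extension F

  -- Tr_{F/K}(a) is the trace of the K-linear map x ↦ a x.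
  Tr : Carrier → Field.Carrier K
  Tr a = Basis.trace b (a *_)

record QuadraticForm {K : Field c ℓ} (V : LeftModule (Field.ring K) m ℓm)
                     : Set (c ⊔ ℓ ⊔ m ⊔ ℓm) where
  open Field K
  open LeftModule V
  field
    Q : Carrierᴹ → Carrier

  polar : Carrierᴹ → Carrierᴹ → Carrier
  polar x y = Q (x +ᴹ y) - Q x - Q y

  field
    Q-cong  : ∀ {x y} → x ≈ᴹ y → Q x ≈ Q y
    Q-*ₗ    : ∀ a x → Q (a *ₗ x) ≈ a * a * Q x
    -- As polar is symmetric, linearity in one argument is bilinearity.
    polar-+ : ∀ x y z → polar (x +ᴹ y) z ≈ polar x z + polar y z
    polar-* : ∀ a x y → polar (a *ₗ x) y ≈ a * polar x y

  NonDegenerate : Set (ℓ ⊔ m ⊔ ℓm)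
  NonDegenerate = ∀ x → (∀ y → polar x y ≈ 0#) → x ≈ᴹ 0ᴹ

Isomorphic : {K : Field c ℓ}
             {V : LeftModule (Field.ring K) m ℓm}
             {W : LeftModule (Field.ring K) m′ ℓm′} →
             QuadraticForm {K = K} V → QuadraticForm {K = K} W →
             Set (c ⊔ ℓ ⊔ m ⊔ ℓm ⊔ m′ ⊔ ℓm′)
Isomorphic {K = K} {V} {W} q q′ =
  Σ[ φ ∈ (LeftModule.Carrierᴹ V → LeftModule.Carrierᴹ W) ]
    (IsLeftModuleIsomorphism φ ×
      (∀ x → QuadraticForm.Q q′ (φ x) ≈ QuadraticForm.Q q x))
  where
  open Field K using (_≈_)
  open LeftModuleMorphisms
    (LeftModule.rawLeftModule V) (LeftModule.rawLeftModule W)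
    using (IsLeftModuleIsomorphism)

module _ {K : Field c ℓ} (F : Extension K)
         {n : ℕ} (b : Basis {K = K} (Extension.vectorSpace F) n) where
  private
    module K = Field K
    open Extension F
    open SetoidReasoning K.setoid
    T : Carrier → K.Carrier
    T = Tr F b

    T-cong : ∀ {x y} → x ≈ y → T x K.≈ T y
    T-cong {x} {y} e = trace-cong b {x *_} {y *_} (λ _ → *-congʳ e)

    T-+ : ∀ x y → T (x + y) K.≈ T x K.+ T y
    T-+ x y = K.trans (trace-cong b (λ z → distribʳ z x y))
                      (trace-+ b (x *_) (y *_))

    T-* : ∀ k x → T (ι k * x) K.≈ k K.* T x
    T-* k x = K.trans (trace-cong b (λ z → *-assoc (ι k) x z))
                      (trace-* b k (x *_))

    module FS = SemiringSolver commutativeSemiring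
    module KS = SemiringSolver K.commutativeSemiring

    cancel : ∀ u v w → (u K.+ v K.+ w) K.- u K.- w K.≈ v
    cancel u v w = begin
      (u K.+ v K.+ w) K.+ K.- u K.+ K.- w
        ≈⟨ KS.solve 5 (λ u v w u′ w′ → u KS.:+ v KS.:+ w KS.:+ u′ KS.:+ w′
             KS.:= v KS.:+ ((u KS.:+ u′) KS.:+ (w KS.:+ w′)))
             K.refl u v w (K.- u) (K.- w) ⟩
      v K.+ ((u K.+ K.- u) K.+ (w K.+ K.- w))
        ≈⟨ K.+-congˡ (K.+-cong (K.-‿inverseʳ u) (K.-‿inverseʳ w)) ⟩
      v K.+ (K.0# K.+ K.0#)
        ≈⟨ K.trans (K.+-congˡ (K.+-identityˡ K.0#)) (K.+-identityʳ v) ⟩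
      v ∎

  scaledTraceForm : Extension.Carrier F →
                    QuadraticForm {K = K} (Extension.vectorSpace F)
  scaledTraceForm α = record
    { Q = Q
    ; Q-cong = λ e → T-cong (*-congˡ (*-cong e e))
    ; Q-*ₗ = Q-*ₗ
    ; polar-+ = polar-+
    ; polar-* = polar-*
    }
    where
    Q : Carrier → K.Carrier
    Q x = T (α * (x * x))

    polar : Carrier → Carrier → K.Carrier
    polar x y = Q (x + y) K.- Q x K.- Q y

    B : Carrier → Carrier → K.Carrier
    B x y = T (α * (x * y) + α * (x * y))

    polar≈B : ∀ x y → polar x y K.≈ B x y
    polar≈B x y = begin
      Q (x + y) K.- Q x K.- Q y
        ≈⟨ K.+-congʳ (K.+-congʳ (T-cong (FS.solve 3 (λ α x y →
             α FS.:* ((x FS.:+ y) FS.:* (x FS.:+ y)) FS.:=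
             α FS.:* (x FS.:* x)
               FS.:+ (α FS.:* (x FS.:* y) FS.:+ α FS.:* (x FS.:* y))
               FS.:+ α FS.:* (y FS.:* y)) refl α x y))) ⟩
      T (α * (x * x) + (α * (x * y) + α * (x * y)) + α * (y * y))
        K.- Q x K.- Q y
        ≈⟨ K.+-congʳ (K.+-congʳ (K.trans (T-+ _ _) (K.+-congʳ (T-+ _ _)))) ⟩
      (Q x K.+ B x y K.+ Q y) K.- Q x K.- Q y
        ≈⟨ cancel (Q x) (B x y) (Q y) ⟩
      B x y ∎

    Q-*ₗ : ∀ a x → Q (ι a * x) K.≈ a K.* a K.* Q x
    Q-*ₗ a x = begin
      T (α * ((ι a * x) * (ι a * x)))
        ≈⟨ T-cong (FS.solve 3 (λ α a x →
             α FS.:* ((a FS.:* x) FS.:* (a FS.:* x)) FS.:=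
             a FS.:* a FS.:* (α FS.:* (x FS.:* x))) refl α (ι a) x) ⟩
      T (ι a * ι a * (α * (x * x)))   ≈⟨ T-cong (*-congʳ (*-homo a a)) ⟨
      T (ι (a K.* a) * (α * (x * x))) ≈⟨ T-* (a K.* a) _ ⟩
      a K.* a K.* Q x                 ∎

    polar-+ : ∀ x y z → polar (x + y) z K.≈ polar x z K.+ polar y z
    polar-+ x y z = begin
      polar (x + y) z             ≈⟨ polar≈B (x + y) z ⟩
      B (x + y) z
        ≈⟨ T-cong (FS.solve 4 (λ α x y z →
             α FS.:* ((x FS.:+ y) FS.:* z) FS.:+ α FS.:* ((x FS.:+ y) FS.:* z)
             FS.:= (α FS.:* (x FS.:* z) FS.:+ α FS.:* (x FS.:* z))
               FS.:+ (α FS.:* (y FS.:* z) FS.:+ α FS.:* (y FS.:* z)))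
             refl α x y z) ⟩
      T ((α * (x * z) + α * (x * z)) + (α * (y * z) + α * (y * z)))
                                  ≈⟨ T-+ _ _ ⟩
      B x z K.+ B y z             ≈⟨ K.+-cong (polar≈B x z) (polar≈B y z) ⟨
      polar x z K.+ polar y z     ∎

    polar-* : ∀ a x y → polar (ι a * x) y K.≈ a K.* polar x y
    polar-* a x y = begin
      polar (ι a * x) y ≈⟨ polar≈B (ι a * x) y ⟩
      B (ι a * x) y
        ≈⟨ T-cong (FS.solve 4 (λ α a x y →
             α FS.:* ((a FS.:* x) FS.:* y) FS.:+ α FS.:* ((a FS.:* x) FS.:* y)
             FS.:= a FS.:* (α FS.:* (x FS.:* y) FS.:+ α FS.:* (x FS.:* y)))
             refl α (ι a) x y) ⟩
      T (ι a * (α * (x * y) + α * (x * y))) ≈⟨ T-* a _ ⟩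
      a K.* B x y                           ≈⟨ K.*-congˡ (polar≈B x y) ⟨
      a K.* polar x y                       ∎

-- q is isomorphic to a scaled trace form.  The degree d of F/K is not
-- required to be the dimension of q.
IsScaledTraceForm : {K : Field c ℓ} {V : LeftModule (Field.ring K) m ℓm} →
                    QuadraticForm {K = K} V → Set (lsuc (c ⊔ ℓ) ⊔ m ⊔ ℓm)
IsScaledTraceForm {K = K} q =
  Σ[ F ∈ Extension K ] Σ[ d ∈ ℕ ] Σ[ b ∈ Basis {K = K} (vectorSpace F) d ]
  Σ[ α ∈ Carrier F ]
  (IsSeparable F × ¬ (_≈_ F α (0# F)) × Isomorphic q (scaledTraceForm F b α))
  where open Extension

HasSeparableExtension : Field c ℓ → ℕ → Set (lsuc (c ⊔ ℓ))
HasSeparableExtension K n =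
  Σ[ F ∈ Extension K ] (Basis {K = K} (Extension.vectorSpace F) n × IsSeparable F)

{-# OPTIONS --safe #-}

module Submission where

open import Defs
open import Level using (Level; _⊔_)
open import Data.Nat.Base as ℕ using (ℕ; zero; suc; _≤_; _<_; z≤n; s≤s)
import Data.Nat.Properties as ℕ
open import Data.Integer.Base as ℤ using (ℤ; +_; -[1+_])
import Data.Integer.Properties as ℤ
open import Data.Fin.Base using (Fin; zero; suc; toℕ; fromℕ<; punchIn; punchOut)
import Data.Fin.Properties as Fin
open import Data.List.Base as List using (List; []; _∷_; drop; length)
open import Data.Maybe.Base using (Maybe; just; nothing)
open import Data.Product.Base using (_×_; _,_; proj₁; proj₂; ∃-syntax; Σ-syntax)
open import Data.Sum.Base as Sum using (_⊎_; inj₁; inj₂)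
open import Data.Vec.Functional using (Vector) renaming (_∷_ to _∷ᵛ_)
open import Function.Bundles using (_⇔_; mk⇔)
open import Algebra.Bundles using (CommutativeRing)
open import Algebra.Module.Bundles using (LeftModule)
open import Algebra.Module.Morphism.Structures using (module LeftModuleMorphisms)
open import Algebra.Morphism.Structures using (module RingMorphisms)
open import Algebra.Solver.Ring.AlmostCommutativeRing
  using (fromCommutativeRing; _-Raw-AlmostCommutative⟶_)
import Algebra.Definitions.RawMagma as RawMagma
import Algebra.Properties.AbelianGroup as AbelianGroupProperties
import Algebra.Properties.CommutativeMonoid.Sum as MonoidSum
import Algebra.Properties.Group as GroupProperties
import Algebra.Properties.Ring as RingProperties
import Algebra.Properties.Semiring.Exp as Exp
import Algebra.Properties.Semiring.Mult.TCOptimised as Mult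
import Algebra.Properties.Semiring.Sum as SemiringSum
import Algebra.Solver.Ring as RingSolver
open import Axiom.ExcludedMiddle using (ExcludedMiddle)
open import Relation.Nullary using (yes; no; ¬_; contradiction)
open import Relation.Nullary.Decidable using (decidable-stable)
open import Relation.Binary.PropositionalEquality as ≡ using (_≡_; cong)
import Relation.Binary.Reasoning.Setoid as SetoidReasoning

-- If q is isometric to a scaled trace form of F, a basis of its space is
-- carried to a basis of F.
--
-- Conversely, the curve y² = g(x) is absolutely irreducible when g is
-- nonconstant with simple roots, so over a PAC field it has a point.
-- With g = (t - b x²) / a this makes every binary form a u² + b v²
-- universal, and q becomes ⟨1, -1, 1, …, d⟩ for some d ≠ 0.  Let θ be a
-- primitive element of F with minimal polynomial p, and s the top coordinate
-- in the basis of powers of θ.  By Euler's formula Tr(y) = s(y p′(θ)), so the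
-- forms s(y² / (θ - x)), x ∈ K, are scaled trace forms; such a form is
-- ⟨1, -1, 1, …, - 1 / p(x)⟩, and a point on y² = - d p(x) gives the isometry.

-- The family s(y² / (θ - x)) is dictated by a determinant. Once binary forms are universal,
-- everything about q can be normalised except its determinant, so what remains is to scale the
-- trace form to the right determinant up to squares. Scaling by 1 / (θ - x) changes it by the norm
-- of θ - x, which is p(x) up to sign; since p is separable, the condition on x is again a curve y²
-- = g(x) with g of simple roots. The signs 1, -1 come from hyperbolic planes, because the relevant
-- Gram matrix is a triangular Hankel matrix. Explicit orthogonal systems with equal norms replace a
-- classification of forms.
--
-- `PAC` is stated through prime ideals over an algebraic closure, so every variety used needs a
-- quotient ring explicit enough to be seen to be a domain. Besides y² = g(x) there is p(y) z = 1,
-- whose points provide non-roots of nonzero polynomials. Such non-roots drive the search for a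
-- primitive element, which proceeds by deformation and by the openness of linear independence, with
-- no embeddings into a Galois closure. Excluded middle supplies the tests for zero and the choice
-- of pivots.

private
  variable
    c ℓ c′ ℓ′ m ℓm : Level

-- Ring identities with integer coefficients

module IntegerSolver (R : CommutativeRing c ℓ) where
  open CommutativeRing R
  open RingProperties ring using (-‿distribˡ-*; -‿distribʳ-*; -0#≈0#; -‿involutive)
  open AbelianGroupProperties +-abelianGroup using (⁻¹-∙-comm)
  open Mult semiring using (1+×; ×-homo-+; ×1-homo-*) renaming (_×_ to _×ⁿ_)
  open SetoidReasoning setoid

  -- The solver has to compare coefficients, and equality in R is not decidable; subtraction rules
  -- out natural numbers as coefficients.
  fromℤ : ℤ → Carrier
  fromℤ (+ n)    = n ×ⁿ 1#
  fromℤ -[1+ n ] = - (suc n ×ⁿ 1#)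

  fromℤ-⊖ : ∀ m n → fromℤ (m ℤ.⊖ n) ≈ m ×ⁿ 1# - n ×ⁿ 1#
  fromℤ-⊖ m       zero    = begin
    m ×ⁿ 1#      ≈⟨ +-identityʳ _ ⟨
    m ×ⁿ 1# + 0# ≈⟨ +-congˡ -0#≈0# ⟨
    m ×ⁿ 1# - 0# ∎
  fromℤ-⊖ zero    (suc n) = sym (+-identityˡ _)
  fromℤ-⊖ (suc m) (suc n) = begin
    fromℤ (suc m ℤ.⊖ suc n)                     ≡⟨ cong fromℤ (ℤ.[1+m]⊖[1+n]≡m⊖n m n) ⟩
    fromℤ (m ℤ.⊖ n)                             ≈⟨ fromℤ-⊖ m n ⟩
    m ×ⁿ 1# - n ×ⁿ 1#                           ≈⟨ +-congˡ (+-identityˡ _) ⟨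
    m ×ⁿ 1# + (0# - n ×ⁿ 1#)                    ≈⟨ +-congˡ (+-congʳ (-‿inverseʳ 1#)) ⟨
    m ×ⁿ 1# + (1# - 1# - n ×ⁿ 1#)               ≈⟨ +-congˡ (+-assoc _ _ _) ⟩
    m ×ⁿ 1# + (1# + (- 1# - n ×ⁿ 1#))           ≈⟨ +-assoc _ _ _ ⟨
    m ×ⁿ 1# + 1# + (- 1# - n ×ⁿ 1#)             ≈⟨ +-cong (trans (+-comm _ _) (sym (1+× m 1#)))
                                                          (trans (⁻¹-∙-comm _ _)
                                                              (-‿cong (sym (1+× n 1#)))) ⟩
    suc m ×ⁿ 1# - suc n ×ⁿ 1#                   ∎

  fromℤ-+ : ∀ i j → fromℤ (i ℤ.+ j) ≈ fromℤ i + fromℤ j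
  fromℤ-+ (+ m)    (+ n)    = ×-homo-+ 1# m n
  fromℤ-+ (+ m)    -[1+ n ] = fromℤ-⊖ m (suc n)
  fromℤ-+ -[1+ m ] (+ n)    = trans (fromℤ-⊖ n (suc m)) (+-comm _ _)
  fromℤ-+ -[1+ m ] -[1+ n ] = begin
    - ((2 ℕ.+ (m ℕ.+ n)) ×ⁿ 1#)             ≡⟨ cong (λ k → - (suc k ×ⁿ 1#)) (ℕ.+-suc m n) ⟨
    - ((suc m ℕ.+ suc n) ×ⁿ 1#)             ≈⟨ -‿cong (×-homo-+ 1# (suc m) (suc n)) ⟩
    - (suc m ×ⁿ 1# + suc n ×ⁿ 1#)           ≈⟨ ⁻¹-∙-comm _ _ ⟨
    - (suc m ×ⁿ 1#) - suc n ×ⁿ 1#           ∎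

  fromℤ-neg : ∀ i → fromℤ (ℤ.- i) ≈ - fromℤ i
  fromℤ-neg (+ zero)    = sym -0#≈0#
  fromℤ-neg (+ suc n)   = refl
  fromℤ-neg -[1+ n ]    = sym (-‿involutive _)

  fromℤ-+* : ∀ m j → fromℤ (+ m ℤ.* j) ≈ m ×ⁿ 1# * fromℤ j
  fromℤ-+* m (+ n)    = trans (reflexive (cong fromℤ (≡.sym (ℤ.pos-* m n)))) (×1-homo-* m n)
  fromℤ-+* m -[1+ n ] = begin
    fromℤ (+ m ℤ.* -[1+ n ])         ≡⟨ cong fromℤ (ℤ.neg-distribʳ-* (+ m) (+ suc n)) ⟨
    fromℤ (ℤ.- (+ m ℤ.* + suc n))    ≈⟨ fromℤ-neg (+ m ℤ.* + suc n) ⟩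
    - fromℤ (+ m ℤ.* + suc n)        ≈⟨ -‿cong (fromℤ-+* m (+ suc n)) ⟩
    - (m ×ⁿ 1# * suc n ×ⁿ 1#)        ≈⟨ -‿distribʳ-* _ _ ⟩
    m ×ⁿ 1# * - (suc n ×ⁿ 1#)        ∎

  fromℤ-* : ∀ i j → fromℤ (i ℤ.* j) ≈ fromℤ i * fromℤ j
  fromℤ-* (+ m)    j = fromℤ-+* m j
  fromℤ-* -[1+ m ] j = begin
    fromℤ (-[1+ m ] ℤ.* j)           ≡⟨ cong fromℤ (ℤ.neg-distribˡ-* (+ suc m) j) ⟨
    fromℤ (ℤ.- (+ suc m ℤ.* j))      ≈⟨ fromℤ-neg (+ suc m ℤ.* j) ⟩
    - fromℤ (+ suc m ℤ.* j)          ≈⟨ -‿cong (fromℤ-+* (suc m) j) ⟩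
    - (suc m ×ⁿ 1# * fromℤ j)        ≈⟨ -‿distribˡ-* _ _ ⟩
    - (suc m ×ⁿ 1#) * fromℤ j        ∎

  fromℤ-morphism : ℤ.+-*-rawRing -Raw-AlmostCommutative⟶ fromCommutativeRing R
  fromℤ-morphism = record
    { ⟦_⟧ = fromℤ ; +-homo = fromℤ-+ ; *-homo = fromℤ-* ; -‿homo = fromℤ-neg
    ; 0-homo = refl ; 1-homo = refl }

  -- A one-sided test: `nothing` claims no inequality, as distinct integers may have equal images in
  -- R.
  fromℤ-≟ : ∀ i j → Maybe (fromℤ i ≈ fromℤ j)
  fromℤ-≟ i j with i ℤ.≟ j
  ... | yes e = just (reflexive (cong fromℤ e))
  ... | no _  = nothing

  open RingSolver ℤ.+-*-rawRing (fromCommutativeRing R) fromℤ-morphism fromℤ-≟ public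
    using (solve; _:=_; _:+_; _:*_; _:-_; :-_; con)

-- Homomorphisms, evaluation of polynomials, synthetic division

IsHom : (R : CommutativeRing c ℓ) (S : CommutativeRing c′ ℓ′) →
        (CommutativeRing.Carrier R → CommutativeRing.Carrier S) → Set (c ⊔ ℓ ⊔ ℓ′)
IsHom R S = IsRingHomomorphism
  where open RingMorphisms (CommutativeRing.rawRing R) (CommutativeRing.rawRing S)

-- Additivity between groups already forces 0 and negatives to be preserved, so four laws are
-- enough.
isHom : (R : CommutativeRing c ℓ) (S : CommutativeRing c′ ℓ′) →
        let module R = CommutativeRing R ; module S = CommutativeRing S in
        (φ : R.Carrier → S.Carrier) →
        (∀ {x y} → x R.≈ y → φ x S.≈ φ y) →
        (∀ x y → φ (x R.+ y) S.≈ φ x S.+ φ y) →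
        (∀ x y → φ (x R.* y) S.≈ φ x S.* φ y) →
        φ R.1# S.≈ S.1# → IsHom R S φ
isHom R S φ φ-cong φ-+ φ-* φ-1 = record
  { isSemiringHomomorphism = record
    { isNearSemiringHomomorphism = record
      { +-isMonoidHomomorphism = record
        { isMagmaHomomorphism = record
          { isRelHomomorphism = record { cong = φ-cong } ; homo = φ-+ }
        ; ε-homo = φ-0 }
      ; *-homo = φ-* }
    ; 1#-homo = φ-1 }
  ; -‿homo = λ x → inverseʳ-unique (φ x) (φ (R.- x))
      (S.trans (S.sym (φ-+ x (R.- x))) (S.trans (φ-cong (R.-‿inverseʳ x)) φ-0)) }
  where
  module R = CommutativeRing R
  module S = CommutativeRing S
  open GroupProperties S.+-group using (inverseʳ-unique; identityʳ-unique)
  φ-0 : φ R.0# S.≈ S.0#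
  φ-0 = identityʳ-unique (φ R.0#) (φ R.0#)
    (S.trans (S.sym (φ-+ R.0# R.0#)) (φ-cong (R.+-identityʳ R.0#)))

idHom : (R : CommutativeRing c ℓ) → IsHom R R (λ x → x)
idHom R = isHom R R (λ x → x) (λ e → e) (λ _ _ → refl) (λ _ _ → refl) refl
  where open CommutativeRing R

module Evaluation {R : CommutativeRing c ℓ} (S : CommutativeRing c′ ℓ′)
                  {φ : CommutativeRing.Carrier R → CommutativeRing.Carrier S}
                  (φ-hom : IsHom R S φ) (x : CommutativeRing.Carrier S) where
  private
    module R = CommutativeRing R
    module S[X] = Polynomial S
  open CommutativeRing S
  open Polynomial R hiding (eval)
  open RingMorphisms.IsRingHomomorphism φ-hom
    using (⟦⟧-cong; +-homo; *-homo; 0#-homo; 1#-homo)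
  open SetoidReasoning setoid
  open IntegerSolver S using (solve; _:=_; _:+_; _:*_)

  ⟦_⟧ : Poly → Carrier
  ⟦_⟧ = eval₂ S φ x

  -- A list of zeros equals `[]` under `≋`; `ev-cong` meets this case when one of its two lists ends
  -- before the other.
  ev-0 : ∀ p → p ≋ [] → ⟦ p ⟧ ≈ 0#
  ev-0 []      e = refl
  ev-0 (a ∷ p) e = begin
    φ a + x * ⟦ p ⟧ ≈⟨ +-cong (trans (⟦⟧-cong (at e 0)) 0#-homo)
                              (*-congˡ (ev-0 p (mk≋ λ i → at e (suc i)))) ⟩
    0# + x * 0#     ≈⟨ +-identityˡ _ ⟩
    x * 0#          ≈⟨ zeroʳ x ⟩
    0#              ∎

  ev-cong : ∀ {p q} → p ≋ q → ⟦ p ⟧ ≈ ⟦ q ⟧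
  ev-cong {[]}    {q}     e = sym (ev-0 q (mk≋ λ i → R.sym (at e i)))
  ev-cong {a ∷ p} {[]}    e = ev-0 (a ∷ p) e
  ev-cong {a ∷ p} {b ∷ q} e =
    +-cong (⟦⟧-cong (at e 0)) (*-congˡ (ev-cong {p} {q} (mk≋ λ i → at e (suc i))))

  ev-⊕ : ∀ p q → ⟦ p ⊕ q ⟧ ≈ ⟦ p ⟧ + ⟦ q ⟧
  ev-⊕ []      q       = sym (+-identityˡ _)
  ev-⊕ (a ∷ p) []      = sym (+-identityʳ _)
  ev-⊕ (a ∷ p) (b ∷ q) = begin
    φ (a R.+ b) + x * ⟦ p ⊕ q ⟧         ≈⟨ +-cong (+-homo a b) (*-congˡ (ev-⊕ p q)) ⟩
    φ a + φ b + x * (⟦ p ⟧ + ⟦ q ⟧)     ≈⟨ solve 5 (λ a b x p q →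
      a :+ b :+ x :* (p :+ q) := a :+ x :* p :+ (b :+ x :* q)) refl (φ a) (φ b) x ⟦ p ⟧ ⟦ q ⟧ ⟩
    φ a + x * ⟦ p ⟧ + (φ b + x * ⟦ q ⟧) ∎

  ev-· : ∀ a p → ⟦ a · p ⟧ ≈ φ a * ⟦ p ⟧
  ev-· a []      = sym (zeroʳ _)
  ev-· a (b ∷ p) = begin
    φ (a R.* b) + x * ⟦ a · p ⟧         ≈⟨ +-cong (*-homo a b) (*-congˡ (ev-· a p)) ⟩
    φ a * φ b + x * (φ a * ⟦ p ⟧)       ≈⟨ solve 4 (λ a b x p →
      a :* b :+ x :* (a :* p) := a :* (b :+ x :* p)) refl (φ a) (φ b) x ⟦ p ⟧ ⟩
    φ a * (φ b + x * ⟦ p ⟧)             ∎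

  ev-shift : ∀ p → ⟦ shift p ⟧ ≈ x * ⟦ p ⟧
  ev-shift p = trans (+-congʳ 0#-homo) (+-identityˡ _)

  ev-C : ∀ a → ⟦ a ∷ [] ⟧ ≈ φ a
  ev-C a = trans (+-congˡ (zeroʳ x)) (+-identityʳ _)

  ev-⊛ : ∀ p q → ⟦ p ⊛ q ⟧ ≈ ⟦ p ⟧ * ⟦ q ⟧
  ev-⊛ []      q = sym (zeroˡ _)
  ev-⊛ (a ∷ p) q = begin
    ⟦ a · q ⊕ shift (p ⊛ q) ⟧           ≈⟨ ev-⊕ (a · q) (shift (p ⊛ q)) ⟩
    ⟦ a · q ⟧ + ⟦ shift (p ⊛ q) ⟧       ≈⟨ +-cong (ev-· a q)
                                            (trans (ev-shift (p ⊛ q)) (*-congˡ (ev-⊛ p q))) ⟩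
    φ a * ⟦ q ⟧ + x * (⟦ p ⟧ * ⟦ q ⟧)   ≈⟨ solve 4 (λ a q x p →
      a :* q :+ x :* (p :* q) := (a :+ x :* p) :* q) refl (φ a) ⟦ q ⟧ x ⟦ p ⟧ ⟩
    (φ a + x * ⟦ p ⟧) * ⟦ q ⟧           ∎

  ev-hom : IsHom polynomialRing S ⟦_⟧
  ev-hom = isHom polynomialRing S ⟦_⟧ ev-cong ev-⊕ ev-⊛ (trans (ev-C R.1#) 1#-homo)

  open RingMorphisms.IsRingHomomorphism ev-hom public
    using () renaming (-‿homo to ev-⊖)

  -- Synthetic division: for f = a ∷ p these are the coefficients of the difference quotient (f(X) -
  -- f(x)) / (X - x), which does not involve a.
  horner : Poly → List Carrier
  horner []      = []
  horner (a ∷ p) = ⟦ a ∷ p ⟧ ∷ horner p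

  coeff-horner : ∀ p i → S[X].coeff (horner p) i ≈ ⟦ drop i p ⟧
  coeff-horner []      zero    = refl
  coeff-horner []      (suc i) = refl
  coeff-horner (a ∷ p) zero    = refl
  coeff-horner (a ∷ p) (suc i) = coeff-horner p i

  -- At X = x the difference quotient becomes the derivative.
  eval-horner : ∀ a p → S[X].eval x (horner p) ≈ ⟦ derivative (a ∷ p) ⟧
  eval-horner a []      = sym (trans (+-congʳ 0#-homo) (trans (+-identityˡ _) (zeroʳ x)))
  eval-horner a (b ∷ p) = begin
    ⟦ b ∷ p ⟧ + x * S[X].eval x (horner p)         ≈⟨ +-congˡ (*-congˡ (eval-horner b p)) ⟩
    ⟦ b ∷ p ⟧ + x * ⟦ derivative (b ∷ p) ⟧         ≈⟨ +-congˡ (ev-shift (derivative (b ∷ p))) ⟨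
    ⟦ b ∷ p ⟧ + ⟦ shift (derivative (b ∷ p)) ⟧     ≈⟨ ev-⊕ (b ∷ p) (shift (derivative (b ∷ p))) ⟨
    ⟦ derivative (a ∷ b ∷ p) ⟧                     ∎

coeff-drop : (R : CommutativeRing c ℓ) → let open Polynomial R in
             ∀ i p j → coeff (drop i p) j ≡ coeff p (i ℕ.+ j)
coeff-drop R zero    p       j = ≡.refl
coeff-drop R (suc i) []      j = ≡.refl
coeff-drop R (suc i) (a ∷ p) j = coeff-drop R i p j

module LinearFactor (R : CommutativeRing c ℓ) (r : CommutativeRing.Carrier R) where
  open CommutativeRing R
  open Polynomial R
  open Evaluation {R = R} R (idHom R) r public
  open SetoidReasoning setoid
  open IntegerSolver R using (solve; _:=_; _:+_; _:*_; :-_; con)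

  X-r : Poly
  X-r = - r ∷ 1# ∷ []

  -- The remainder e of the tail b ∷ p is the lowest coefficient of the quotient for a ∷ b ∷ p.
  -- Hence the identity for the tail, shifted by one degree, gives all coefficients but the constant
  -- one.
  divide : ∀ a p → a ∷ p ≋ (⟦ a ∷ p ⟧ ∷ []) ⊕ X-r ⊛ horner p
  divide a []      = mk≋ λ
    { zero → solve 2 (λ a r → a := a :+ r :* con (+ 0) :+ con (+ 0)) refl a r
    ; (suc zero) → refl
    ; (suc (suc i)) → refl }
  divide a (b ∷ p) = mk≋ λ
    { zero → trans (solve 3 (λ a r e → a := a :+ r :* e :+ (e :* (:- r) :+ con (+ 0))) refl a r e)
                   (+-congˡ (sym (at (⊛-∷ʳ X-r e (horner p)) 0)))
    ; (suc i) → begin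
        coeff (b ∷ p) i ≈⟨ at (divide b p) i ⟩
        coeff ((e ∷ []) ⊕ X-r ⊛ horner p) i
          ≈⟨ at (⊕-cong {e ∷ []} {e * 1# ∷ []} (∷-cong (sym (*-identityʳ e)) ≋-refl)
                        (≋-refl {X-r ⊛ horner p})) i ⟩
        coeff ((e * 1# ∷ []) ⊕ X-r ⊛ horner p) i ≈⟨ at (⊛-∷ʳ X-r e (horner p)) (suc i) ⟨
        coeff (X-r ⊛ (e ∷ horner p)) (suc i) ∎ }
    where
    e = ⟦ b ∷ p ⟧
    open CommutativeRing polynomialRing using () renaming (refl to ≋-refl)

  divide-drop : ∀ p → p ≋ (⟦ p ⟧ ∷ []) ⊕ X-r ⊛ horner (drop 1 p)
  divide-drop []      = mk≋ λ
    { zero → sym (+-identityˡ 0#) ; (suc zero) → refl ; (suc (suc i)) → refl }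
  divide-drop (a ∷ p) = divide a p

  length-horner : ∀ p → length (horner p) ≡ length p
  length-horner []      = ≡.refl
  length-horner (a ∷ p) = cong suc (length-horner p)

-- Integral domains

Integral : CommutativeRing c ℓ → Set (c ⊔ ℓ)
Integral R = ∀ x y → x * y ≈ 0# → x ≈ 0# ⊎ y ≈ 0#
  where open CommutativeRing R

Nontrivial : CommutativeRing c ℓ → Set ℓ
Nontrivial R = ¬ 1# ≈ 0#
  where open CommutativeRing R

module _ (em : ∀ {a : Level} → ExcludedMiddle a) where

  field-integral : (K : Field c ℓ) → Integral (Field.commutativeRing K)
  field-integral K x y e with em {P = Field._≈_ K x (Field.0# K)}
  ... | yes x≈0 = inj₁ x≈0
  ... | no x≉0 = inj₂ (begin
    y           ≈⟨ *-identityˡ y ⟨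
    1# * y      ≈⟨ *-congʳ xz≈1 ⟨
    x * z * y   ≈⟨ solve 3 (λ x y z → x :* z :* y := z :* (x :* y)) refl x y z ⟩
    z * (x * y) ≈⟨ *-congˡ e ⟩
    z * 0#      ≈⟨ zeroʳ z ⟩
    0#          ∎)
    where
    open Field K
    open SetoidReasoning setoid
    open IntegerSolver commutativeRing using (solve; _:=_; _:*_)
    z = proj₁ (inverse x x≉0)
    xz≈1 = proj₂ (inverse x x≉0)

  -- The comparison starts at the lowest coefficient, since trailing zeros leave a list without a
  -- definite leading one. Zeros at the front of the first factor are dropped; once its constant
  -- term is nonzero, the coefficients of the second factor vanish one after the other.
  polynomial-integral : (R : CommutativeRing c ℓ) → Integral R →
                        Integral (Polynomial.polynomialRing R)
  polynomial-integral R int = go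
    where
    open CommutativeRing R
    open Polynomial R
    module P = CommutativeRing polynomialRing
    tail≋ : ∀ {a p} → a ≈ 0# → p ≋ [] → a ∷ p ≋ []
    tail≋ e f = mk≋ λ { zero → e ; (suc i) → at f i }
    dropˡ : ∀ {a} p q → a ≈ 0# → (a ∷ p) ⊛ q ≋ [] → p ⊛ q ≋ []
    dropˡ {a} p q a≈0 e = mk≋ λ i → trans (sym (at lemma (suc i))) (at e (suc i))
      where
      lemma : (a ∷ p) ⊛ q ≋ shift (p ⊛ q)
      lemma = ⊕-cong {a · q} {[]} {shift (p ⊛ q)}
        (P.trans (·-cong a≈0 P.refl) (·-zeroˡ q)) P.refl
    dropʳ : ∀ {b} p q → b ≈ 0# → p ⊛ (b ∷ q) ≋ [] → p ⊛ q ≋ []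
    dropʳ {b} p q b≈0 e = P.trans (⊛-comm p q)
      (dropˡ q p b≈0 (P.trans (⊛-comm (b ∷ q) p) e))
    cancel : ∀ a p → ¬ a ≈ 0# → ∀ q → (a ∷ p) ⊛ q ≋ [] → q ≋ []
    cancel a p a≉0 []      e = P.refl
    cancel a p a≉0 (b ∷ q) e with int a b (trans (sym (+-identityʳ _)) (at e 0))
    ... | inj₁ a≈0 = contradiction a≈0 a≉0
    ... | inj₂ b≈0 = tail≋ b≈0 (cancel a p a≉0 q (dropʳ (a ∷ p) q b≈0 e))
    go : Integral polynomialRing
    go []      q e = inj₁ P.refl
    go (a ∷ p) q e with em {P = a ≈ 0#}
    ... | yes a≈0 = Sum.map₁ (tail≋ a≈0) (go p q (dropˡ p q a≈0 e))
    ... | no a≉0  = inj₂ (cancel a p a≉0 q e)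

-- Prime principal ideals in polynomial rings

module PrincipalIdeal (R : CommutativeRing c ℓ) (γ : Vector (CommutativeRing.Carrier R) 1) where
  open CommutativeRing R hiding (zero)

  ∈⇒multiple : ∀ {x} → _∈⟨_⟩ R x γ → ∃[ u ] x ≈ u * γ zero
  ∈⇒multiple (a , e) = a zero , trans e (+-identityʳ _)

  multiple⇒∈ : ∀ {x} u → x ≈ u * γ zero → _∈⟨_⟩ R x γ
  multiple⇒∈ u e = (λ _ → u) , trans e (sym (+-identityʳ _))

-- Lists rewritten in terms of `C` and `X` make computations modulo a polynomial accessible to the
-- ring solver.
module Generators (A : CommutativeRing c ℓ) where
  open CommutativeRing A hiding (zero)
  open Polynomial A
  module P = CommutativeRing polynomialRing

  C : Carrier → Poly
  C a = a ∷ []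

  X : Poly
  X = 0# ∷ 1# ∷ []

  C-* : ∀ a b → C (a * b) ≋ C a ⊛ C b
  C-* a b = mk≋ λ { zero → sym (+-identityʳ _) ; (suc i) → refl }

  C-0 : C 0# ≋ []
  C-0 = shift-[]

  C-injective : ∀ {a} → C a ≋ [] → a ≈ 0#
  C-injective e = at e 0

  C-⊛ : ∀ a p → C a ⊛ p ≋ a · p
  C-⊛ a p = P.trans (⊕-cong {a · p} P.refl C-0) (⊕-identityʳ (a · p))

  X-⊛ : ∀ p → X ⊛ p ≋ shift p
  X-⊛ p = P.trans (shift-⊛ (1# ∷ []) p) (shift-cong (⊛-identityˡ p))

  ∷≋C+X : ∀ a p → a ∷ p ≋ C a ⊕ X ⊛ p
  ∷≋C+X a p = P.trans (∷-cong (sym (+-identityʳ a)) P.refl)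
    (⊕-cong {C a} P.refl (P.sym (X-⊛ p)))

-- A[Z] / (P Z - 1) is the localisation A[1/P], a domain because A is one.
module LocalisationPrime
  (A : CommutativeRing c ℓ) (integral : Integral A)
  (1≉0 : Nontrivial A)
  (P : CommutativeRing.Carrier A)
  (P≉0 : ¬ CommutativeRing._≈_ A P (CommutativeRing.0# A)) where
  open CommutativeRing A hiding (zero)
  open Polynomial A
  open Generators A
  open IntegerSolver polynomialRing using (solve; _:=_; _:+_; _:*_; _:-_; con)
  open SetoidReasoning P.setoid

  G : Poly
  G = C P ⊛ X P.- P.1#

  linear≋G : - 1# ∷ P ∷ [] ≋ G
  linear≋G = P.sym (P.trans (P.+-congʳ {⊖ P.1#} (C-⊛ P X))
    (∷-cong (trans (+-congʳ (zeroʳ P)) (+-identityˡ _)) (∷-cong (*-identityʳ P) P.refl)))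

  -- Clearing denominators: modulo G the variable is 1/P, so p becomes the fraction `a` / `scale`.
  -- Here `scale` is a power of P, and `inverse`, a power of X, shows that it is a unit modulo G.
  record Reduction (p : Poly) : Set (c ⊔ ℓ) where
    field
      scale a : Carrier
      inverse t u : Poly
      invertible : C scale ⊛ inverse ≋ P.1# ⊕ t ⊛ G
      reduced : C scale ⊛ p ≋ C a ⊕ u ⊛ G

  reduce : ∀ p → Reduction p
  reduce [] = record
    { scale = 1# ; inverse = P.1# ; t = [] ; u = [] ; a = 0#
    ; invertible = ⊛-identityˡ P.1#
    ; reduced = P.trans (⊛-identityˡ []) (P.sym C-0) }
  reduce (k ∷ p) = record
    { scale = P * r.scale ; inverse = r.inverse ⊛ X
    -- As P X = 1 + G, multiplying a + u G by P X gives a + (a + P X u) G; `t` is the case a = 1.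
    ; t = P.1# ⊕ C P ⊛ X ⊛ r.t ; u = C r.a ⊕ C P ⊛ X ⊛ r.u
    ; a = P * r.scale * k + r.a
    ; invertible = begin
        C (P * r.scale) ⊛ (r.inverse ⊛ X)
          ≈⟨ ⊛-cong (C-* P r.scale) P.refl ⟩
        C P ⊛ C r.scale ⊛ (r.inverse ⊛ X)
          ≈⟨ solve 4 (λ P s i X → P :* s :* (i :* X) := P :* X :* (s :* i)) P.refl (C P)
              (C r.scale) r.inverse X ⟩
        C P ⊛ X ⊛ (C r.scale ⊛ r.inverse) ≈⟨ ⊛-congˡ (C P ⊛ X) r.invertible ⟩
        C P ⊛ X ⊛ (P.1# ⊕ r.t ⊛ G)
          ≈⟨ solve 3 (λ P X t → let G = P :* X :- con (+ 1) in
               P :* X :* (con (+ 1) :+ t :* G) := con (+ 1) :+ (con (+ 1) :+ P :* X :* t) :* G)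
               P.refl (C P) X r.t ⟩
        P.1# ⊕ (P.1# ⊕ C P ⊛ X ⊛ r.t) ⊛ G ∎
    ; reduced = begin
        C (P * r.scale) ⊛ (k ∷ p) ≈⟨ ⊛-cong (C-* P r.scale) (∷≋C+X k p) ⟩
        C P ⊛ C r.scale ⊛ (C k ⊕ X ⊛ p)
          ≈⟨ solve 5 (λ P s k X p → P :* s :* (k :+ X :* p) := P :* s :* k :+ P :* X :* (s :* p))
               P.refl (C P) (C r.scale) (C k) X p ⟩
        C P ⊛ C r.scale ⊛ C k ⊕ C P ⊛ X ⊛ (C r.scale ⊛ p)
          ≈⟨ ⊕-cong {C P ⊛ C r.scale ⊛ C k} (⊛-cong (P.sym (C-* P r.scale)) (P.refl {C k}))
              (⊛-congˡ (C P ⊛ X) r.reduced) ⟩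
        C (P * r.scale) ⊛ C k ⊕ C P ⊛ X ⊛ (C r.a ⊕ r.u ⊛ G)
          ≈⟨ ⊕-cong (P.sym (C-* (P * r.scale) k)) (P.refl {C P ⊛ X ⊛ (C r.a ⊕ r.u ⊛ G)}) ⟩
        C (P * r.scale * k) ⊕ C P ⊛ X ⊛ (C r.a ⊕ r.u ⊛ G)
          ≈⟨ solve 5 (λ P X a u z → let G = P :* X :- con (+ 1) in
               z :+ P :* X :* (a :+ u :* G) := z :+ a :+ (a :+ P :* X :* u) :* G)
               P.refl (C P) X (C r.a) r.u (C (P * r.scale * k)) ⟩
        C (P * r.scale * k + r.a) ⊕ (C r.a ⊕ C P ⊛ X ⊛ r.u) ⊛ G ∎ }
    where module r = Reduction (reduce p)

  multiple-coeff : ∀ u → u ⊛ G ≋ shift (P · u) P.- u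
  multiple-coeff u = begin
    u ⊛ (C P ⊛ X P.- P.1#)
      ≈⟨ solve 3 (λ u P X → u :* (P :* X :- con (+ 1)) := X :* (P :* u) :- u) P.refl u (C P) X ⟩
    X ⊛ (C P ⊛ u) P.- u ≈⟨ ⊕-cong (X-⊛ (C P ⊛ u)) (P.refl {⊖ u}) ⟩
    shift (C P ⊛ u) P.- u ≈⟨ ⊕-cong (shift-cong (C-⊛ P u)) (P.refl {⊖ u}) ⟩
    shift (P · u) P.- u ∎

  coeff-multiple : ∀ u i → coeff (u ⊛ G) (suc i) ≈ P * coeff u i - coeff u (suc i)
  coeff-multiple u i = trans (at (multiple-coeff u) (suc i))
    (trans (coeff-⊕ (shift (P · u)) (⊖ u) (suc i)) (+-cong (coeff-· P u i) (coeff-⊖ u (suc i))))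

  -- A list is finite, so the sequence of coefficients ends in zeros; since P is not a zero divisor,
  -- the zeros propagate backwards.
  geometric≋[] : ∀ u → (∀ i → P * coeff u i ≈ coeff u (suc i)) → u ≋ []
  geometric≋[] []      e = P.refl
  geometric≋[] (k ∷ u) e = mk≋ λ { zero → k≈0 ; (suc i) → at u≋[] i }
    where
    u≋[] = geometric≋[] u (λ i → e (suc i))
    k≈0 : k ≈ 0#
    k≈0 with integral P k (trans (e 0) (at u≋[] 0))
    ... | inj₁ P≈0 = contradiction P≈0 P≉0
    ... | inj₂ k≈0 = k≈0

  -- Injectivity of A → A[1/P]: u G has no coefficient in positive degree only if the coefficients
  -- of u form a geometric sequence with ratio P.
  constant-multiple : ∀ a u → C a ≋ u ⊛ G → a ≈ 0#
  constant-multiple a u e = C-injective (P.trans e (⊛-cong u≋[] (P.refl {G})))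
    where
    u≋[] = geometric≋[] u λ i →
      x∙y⁻¹≈ε⇒x≈y _ _ (trans (sym (coeff-multiple u i)) (sym (at e (suc i))))
      where open GroupProperties +-group using (x∙y⁻¹≈ε⇒x≈y)

  -- The numerator 0 puts `scale` times p in the ideal, and `scale` is a unit modulo G.
  zero⇒multiple : ∀ {p} (r : Reduction p) → Reduction.a r ≈ 0# → ∃[ u ] p ≋ u ⊛ G
  zero⇒multiple {p} r a≈0 = inverse ⊛ u P.- p ⊛ t , (begin
    p ≈⟨ solve 3 (λ p t G → p := p :* (con (+ 1) :+ t :* G) :- p :* t :* G) P.refl p t G ⟩
    p ⊛ (P.1# ⊕ t ⊛ G) P.- p ⊛ t ⊛ G
      ≈⟨ P.+-congʳ (⊛-congˡ p invertible) ⟨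
    p ⊛ (C scale ⊛ inverse) P.- p ⊛ t ⊛ G
      ≈⟨ solve 5 (λ p s i t G → p :* (s :* i) :- p :* t :* G := i :* (s :* p) :- p :* t :* G)
           P.refl p (C scale) inverse t G ⟩
    inverse ⊛ (C scale ⊛ p) P.- p ⊛ t ⊛ G
      ≈⟨ P.+-congʳ (⊛-congˡ inverse (P.trans reduced
          (⊕-cong (P.trans (∷-cong a≈0 P.refl) C-0) P.refl))) ⟩
    inverse ⊛ (u ⊛ G) P.- p ⊛ t ⊛ G
      ≈⟨ solve 5 (λ i u p t G → i :* (u :* G) :- p :* t :* G := (i :* u :- p :* t) :* G)
           P.refl inverse u p t G ⟩
    (inverse ⊛ u P.- p ⊛ t) ⊛ G ∎)
    where open Reduction r

  -- The generator is fixed only up to `≋`, because base change delivers a list whose entries are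
  -- images under ι. Primality is then the zero-product law of A for the numerators.
  isPrime : (γ : Vector Poly 1) → γ zero ≋ G → IsPrimeIdeal⟨_⟩ polynomialRing γ
  isPrime γ γ≋G = proper , prime
    where
    open PrincipalIdeal polynomialRing γ
    proper : ¬ _∈⟨_⟩ polynomialRing P.1# γ
    proper m = let u , e = ∈⇒multiple m in
      1≉0 (constant-multiple 1# u (P.trans e (⊛-congˡ u γ≋G)))
    in-ideal : ∀ {x} (r : Reduction x) → Reduction.a r ≈ 0# → _∈⟨_⟩ polynomialRing x γ
    in-ideal r a≈0 = let u , e = zero⇒multiple r a≈0 in
      multiple⇒∈ u (P.trans e (⊛-congˡ u (P.sym γ≋G)))
    prime : ∀ x y → _∈⟨_⟩ polynomialRing (x ⊛ y) γ →
            _∈⟨_⟩ polynomialRing x γ ⊎ _∈⟨_⟩ polynomialRing y γ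
    prime x y m = Sum.map (in-ideal (reduce x)) (in-ideal (reduce y))
      (integral r.a s.a (constant-multiple (r.a * s.a) v (begin
        C (r.a * s.a) ≈⟨ C-* r.a s.a ⟩
        C r.a ⊛ C s.a
          ≈⟨ solve 5 (λ a b u v G → a :* b :=
               (a :+ u :* G) :* (b :+ v :* G) :- (a :* v :+ b :* u :+ u :* v :* G) :* G)
               P.refl (C r.a) (C s.a) r.u s.u G ⟩
        (C r.a ⊕ r.u ⊛ G) ⊛ (C s.a ⊕ s.u ⊛ G) P.- w ⊛ G
          ≈⟨ P.+-congʳ (⊛-cong r.reduced s.reduced) ⟨
        (C r.scale ⊛ x) ⊛ (C s.scale ⊛ y) P.- w ⊛ G
          ≈⟨ solve 6 (λ m x n y w G → (m :* x) :* (n :* y) :- w :* G := m :* n :* (x :* y) :- w :* G)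
               P.refl (C r.scale) x (C s.scale) y w G ⟩
        C r.scale ⊛ C s.scale ⊛ (x ⊛ y) P.- w ⊛ G
          ≈⟨ P.+-congʳ (⊛-congˡ (C r.scale ⊛ C s.scale)
              (P.trans (proj₂ (∈⇒multiple m)) (⊛-congˡ z γ≋G))) ⟩
        C r.scale ⊛ C s.scale ⊛ (z ⊛ G) P.- w ⊛ G
          ≈⟨ solve 5 (λ m n z w G → m :* n :* (z :* G) :- w :* G := (m :* n :* z :- w) :* G)
               P.refl (C r.scale) (C s.scale) z w G ⟩
        v ⊛ G ∎)))
      where
      module r = Reduction (reduce x)
      module s = Reduction (reduce y)
      z = proj₁ (∈⇒multiple m)
      w = C r.a ⊛ s.u ⊕ C s.a ⊛ r.u ⊕ r.u ⊛ s.u ⊛ G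
      v = C r.scale ⊛ C s.scale ⊛ z P.- w

-- For a nontrivial domain A this says that g is not a square in the fraction field, expressed
-- without fractions.
Anisotropic : (A : CommutativeRing c ℓ) → CommutativeRing.Carrier A → Set (c ⊔ ℓ)
Anisotropic A g = ∀ a b → a * a ≈ g * (b * b) → a ≈ 0# × b ≈ 0#
  where open CommutativeRing A

-- A[Y] / (Y² - g) is A ⊕ A Y, a domain because its norm form a² - g b² is
-- anisotropic over A.
module QuadraticPrime
  (A : CommutativeRing c ℓ) (integral : Integral A)
  (1≉0 : Nontrivial A)
  (g : CommutativeRing.Carrier A)
  (anisotropic : Anisotropic A g) where
  open CommutativeRing A hiding (zero)
  open Polynomial A
  open Generators A
  open IntegerSolver polynomialRing using (solve; _:=_; _:+_; _:*_; _:-_; con)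
  open SetoidReasoning P.setoid

  G : Poly
  G = X ⊛ X P.- C g

  quadratic≋G : - g ∷ 0# ∷ 1# ∷ [] ≋ G
  quadratic≋G = P.sym (P.trans (P.+-congʳ {⊖ C g} (X-⊛ X))
    (∷-cong (+-identityˡ _) P.refl))

  -- Division by the monic G, with remainder a + b Y.
  record Reduction (p : Poly) : Set (c ⊔ ℓ) where
    field
      a b : Carrier
      u : Poly
      reduced : p ≋ C a ⊕ X ⊛ C b ⊕ u ⊛ G

  reduce : ∀ p → Reduction p
  reduce [] = record { a = 0# ; b = 0# ; u = [] ; reduced = P.sym (begin
    C 0# ⊕ X ⊛ C 0# ⊕ [] ⊛ G ≈⟨ P.+-congʳ {[]} (P.+-cong C-0 (⊛-congˡ X C-0)) ⟩
    [] ⊕ X ⊛ [] ⊕ [] ⊛ G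
      ≈⟨ solve 2 (λ X G → con (+ 0) :+ X :* con (+ 0) :+ con (+ 0) :* G := con (+ 0)) P.refl X G ⟩
    [] ∎) }
  reduce (k ∷ p) = record { a = k + g * r.b ; b = r.a ; u = C r.b ⊕ X ⊛ r.u ; reduced = begin
    k ∷ p ≈⟨ ∷≋C+X k p ⟩
    C k ⊕ X ⊛ p ≈⟨ P.+-congˡ {C k} (⊛-congˡ X r.reduced) ⟩
    C k ⊕ X ⊛ (C r.a ⊕ X ⊛ C r.b ⊕ r.u ⊛ G)
      ≈⟨ solve 6 (λ k X a b u g → let G = X :* X :- g in
           k :+ X :* (a :+ X :* b :+ u :* G) := k :+ g :* b :+ X :* a :+ (b :+ X :* u) :* G)
           P.refl (C k) X (C r.a) (C r.b) r.u (C g) ⟩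
    C k ⊕ C g ⊛ C r.b ⊕ X ⊛ C r.a ⊕ (C r.b ⊕ X ⊛ r.u) ⊛ G
      ≈⟨ P.+-congʳ {(C r.b ⊕ X ⊛ r.u) ⊛ G}
          (P.+-congʳ {X ⊛ C r.a} (P.+-congˡ {C k} (P.sym (C-* g r.b)))) ⟩
    C (k + g * r.b) ⊕ X ⊛ C r.a ⊕ (C r.b ⊕ X ⊛ r.u) ⊛ G ∎ }
    where module r = Reduction (reduce p)

  coeff-multiple : ∀ u i → coeff (u ⊛ G) (suc (suc i)) ≈ coeff u i - g * coeff u (suc (suc i))
  coeff-multiple u i = trans (at lemma (suc (suc i)))
    (trans (coeff-⊕ (shift (shift u)) (⊖ (g · u)) (suc (suc i)))
           (+-congˡ (trans (coeff-⊖ (g · u) (suc (suc i))) (-‿cong (coeff-· g u (suc (suc i)))))))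
    where
    lemma : u ⊛ G ≋ shift (shift u) P.- g · u
    lemma = begin
      u ⊛ (X ⊛ X P.- C g)
        ≈⟨ solve 3 (λ u X g → u :* (X :* X :- g) := X :* (X :* u) :- g :* u) P.refl u X (C g) ⟩
      X ⊛ (X ⊛ u) P.- C g ⊛ u
        ≈⟨ P.+-cong (P.trans (X-⊛ (X ⊛ u)) (shift-cong (X-⊛ u))) (⊖-cong (C-⊛ g u)) ⟩
      shift (shift u) P.- g · u ∎

  -- Each coefficient is determined by the one two places later, and beyond the end of the list all
  -- of them are zero.
  recurrent≋[] : ∀ u → (∀ i → coeff u i ≈ g * coeff u (suc (suc i))) → u ≋ []
  recurrent≋[] []      e = P.refl
  recurrent≋[] (k ∷ u) e = mk≋ λ
    { zero → trans (e 0) (trans (*-congˡ (at u≋[] 1)) (zeroʳ g)) ; (suc i) → at u≋[] i }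
    where u≋[] = recurrent≋[] u (λ i → e (suc i))

  coeff-linear : ∀ a b → C a ⊕ X ⊛ C b ≋ a ∷ b ∷ []
  coeff-linear a b = P.trans (P.+-congˡ {C a} (X-⊛ (C b))) (∷-cong (+-identityʳ a) P.refl)

  linear-multiple : ∀ a b u → C a ⊕ X ⊛ C b ≋ u ⊛ G → a ≈ 0# × b ≈ 0#
  linear-multiple a b u e = at linear≋[] 0 , at linear≋[] 1
    where
    open GroupProperties +-group using (x∙y⁻¹≈ε⇒x≈y)
    u≋[] : u ≋ []
    u≋[] = recurrent≋[] u λ i → x∙y⁻¹≈ε⇒x≈y _ _
      (trans (sym (coeff-multiple u i))
      (trans (sym (at e (suc (suc i)))) (at (coeff-linear a b) (suc (suc i)))))
    linear≋[] : a ∷ b ∷ [] ≋ []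
    linear≋[] = P.trans (P.sym (coeff-linear a b)) (P.trans e (⊛-cong u≋[] (P.refl {G})))

  -- The hypotheses say that (a + b Y)(k + l Y) = 0 in A[Y] / (Y² - g); the conclusion follows from
  -- multiplicativity of the norm.
  product-norm : ∀ a b k l → a * k + g * (b * l) ≈ 0# → a * l + b * k ≈ 0# →
                 (a * a - g * (b * b)) * (k * k - g * (l * l)) ≈ 0#
  product-norm a b k l e f = trans
    (A.solve 5 (λ a b k l g →
       (a A.:* a A.:- g A.:* (b A.:* b)) A.:* (k A.:* k A.:- g A.:* (l A.:* l)) A.:=
       (a A.:* k A.:+ g A.:* (b A.:* l)) A.:* (a A.:* k A.:+ g A.:* (b A.:* l))
       A.:- g A.:* (a A.:* l A.:+ b A.:* k) A.:* (a A.:* l A.:+ b A.:* k)) refl a b k l g)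
    (trans (+-cong (*-cong e e) (-‿cong (*-cong (*-congˡ f) f)))
    (A.solve 1 (λ g → A.con (+ 0) A.:* A.con (+ 0) A.:- g A.:* A.con (+ 0) A.:* A.con (+ 0)
       A.:= A.con (+ 0)) refl g))
    where module A = IntegerSolver A

  -- If a product lies in the ideal, the product of the norms of the remainders is 0, so one norm is
  -- 0 in the domain A; anisotropy then kills both coordinates of that remainder.
  isPrime : (γ : Vector Poly 1) → γ zero ≋ G → IsPrimeIdeal⟨_⟩ polynomialRing γ
  isPrime γ γ≋G = proper , prime
    where
    open PrincipalIdeal polynomialRing γ
    open GroupProperties +-group using (x∙y⁻¹≈ε⇒x≈y)
    proper : ¬ _∈⟨_⟩ polynomialRing P.1# γ
    proper m = let u , e = ∈⇒multiple m in 1≉0 (proj₁ (linear-multiple 1# 0# u (begin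
      C 1# ⊕ X ⊛ C 0# ≈⟨ coeff-linear 1# 0# ⟩
      1# ∷ 0# ∷ []    ≈⟨ ∷-cong refl C-0 ⟩
      C 1#            ≈⟨ P.trans e (⊛-congˡ u γ≋G) ⟩
      u ⊛ G           ∎)))
    norm≈0⇒∈ : ∀ {x} (r : Reduction x) → let open Reduction r in
               a * a - g * (b * b) ≈ 0# → _∈⟨_⟩ polynomialRing x γ
    norm≈0⇒∈ {x} r e = multiple⇒∈ u (begin
      x ≈⟨ reduced ⟩
      C a ⊕ X ⊛ C b ⊕ u ⊛ G ≈⟨ P.+-congʳ {u ⊛ G} (P.+-cong (P.trans (∷-cong a≈0 P.refl) C-0)
                                  (⊛-congˡ X (P.trans (∷-cong b≈0 P.refl) C-0))) ⟩
      [] ⊕ X ⊛ [] ⊕ u ⊛ G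
        ≈⟨ solve 3 (λ X u G → con (+ 0) :+ X :* con (+ 0) :+ u :* G := u :* G) P.refl X u G ⟩
      u ⊛ G ≈⟨ ⊛-congˡ u γ≋G ⟨
      u ⊛ γ zero ∎)
      where
      open Reduction r
      a≈0 = proj₁ (anisotropic a b (x∙y⁻¹≈ε⇒x≈y _ _ e))
      b≈0 = proj₂ (anisotropic a b (x∙y⁻¹≈ε⇒x≈y _ _ e))
    prime : ∀ x y → _∈⟨_⟩ polynomialRing (x ⊛ y) γ →
            _∈⟨_⟩ polynomialRing x γ ⊎ _∈⟨_⟩ polynomialRing y γ
    prime x y m = Sum.map (norm≈0⇒∈ (reduce x)) (norm≈0⇒∈ (reduce y))
      (integral _ _ (product-norm r.a r.b s.a s.b (proj₁ both) (proj₂ both)))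
      where
      module r = Reduction (reduce x)
      module s = Reduction (reduce y)
      z = proj₁ (∈⇒multiple m)
      w = (C r.a ⊕ X ⊛ C r.b) ⊛ s.u ⊕ (C s.a ⊕ X ⊛ C s.b) ⊛ r.u ⊕ r.u ⊛ s.u ⊛ G
      both : r.a * s.a + g * (r.b * s.b) ≈ 0# × r.a * s.b + r.b * s.a ≈ 0#
      -- The last term accounts for b Y · l Y = b l g + b l G; `w` collects the other multiples of G
      -- in the product.
      both = linear-multiple _ _ (z P.- w P.- C r.b ⊛ C s.b) (begin
        C (r.a * s.a + g * (r.b * s.b)) ⊕ X ⊛ C (r.a * s.b + r.b * s.a)
          ≈⟨ P.+-cong (P.+-cong (C-* r.a s.a)
              (P.trans (C-* g (r.b * s.b)) (⊛-congˡ (C g) (C-* r.b s.b))))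
               (⊛-congˡ X (P.+-cong (C-* r.a s.b) (C-* r.b s.a))) ⟩
        C r.a ⊛ C s.a ⊕ C g ⊛ (C r.b ⊛ C s.b) ⊕ X ⊛ (C r.a ⊛ C s.b ⊕ C r.b ⊛ C s.a)
          ≈⟨ solve 8 (λ a b k l u v X g → let G = X :* X :- g in
               a :* k :+ g :* (b :* l) :+ X :* (a :* l :+ b :* k) :=
               (a :+ X :* b :+ u :* G) :* (k :+ X :* l :+ v :* G)
                 :- ((a :+ X :* b) :* v :+ (k :+ X :* l) :* u :+ u :* v :* G) :* G :- b :* l :* G)
               P.refl (C r.a) (C r.b) (C s.a) (C s.b) r.u s.u X (C g) ⟩
        (C r.a ⊕ X ⊛ C r.b ⊕ r.u ⊛ G) ⊛ (C s.a ⊕ X ⊛ C s.b ⊕ s.u ⊛ G) P.- w ⊛ G P.- C r.b ⊛ C s.b ⊛ G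
          ≈⟨ P.+-congʳ (P.+-congʳ (⊛-cong r.reduced s.reduced)) ⟨
        x ⊛ y P.- w ⊛ G P.- C r.b ⊛ C s.b ⊛ G
          ≈⟨ P.+-congʳ (P.+-congʳ (P.trans (proj₂ (∈⇒multiple m)) (⊛-congˡ z γ≋G))) ⟩
        z ⊛ G P.- w ⊛ G P.- C r.b ⊛ C s.b ⊛ G
          ≈⟨ solve 4 (λ z w b G → z :* G :- w :* G :- b :* G := (z :- w :- b) :* G)
               P.refl z w (C r.b ⊛ C s.b) G ⟩
        (z P.- w P.- C r.b ⊛ C s.b) ⊛ G ∎)

-- Cancellation, and polynomials with a simple root

integral-≉0 : (R : CommutativeRing c ℓ) → Integral R → let open CommutativeRing R in
              ∀ {x y} → ¬ x ≈ 0# → x * y ≈ 0# → y ≈ 0#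
integral-≉0 R integral {x} {y} x≉0 e with integral x y e
... | inj₁ x≈0 = contradiction x≈0 x≉0
... | inj₂ y≈0 = y≈0

integral-*-≉0 : (R : CommutativeRing c ℓ) → Integral R → let open CommutativeRing R in
                ∀ {x y} → ¬ x ≈ 0# → ¬ y ≈ 0# → ¬ x * y ≈ 0#
integral-*-≉0 R integral x≉0 y≉0 e = y≉0 (integral-≉0 R integral x≉0 e)

integral-cancel : (R : CommutativeRing c ℓ) → Integral R → let open CommutativeRing R in
                  ∀ {x y z} → ¬ x ≈ 0# → x * y ≈ x * z → y ≈ z
integral-cancel R integral {x} {y} {z} x≉0 e = x∙y⁻¹≈ε⇒x≈y y z
  (integral-≉0 R integral x≉0 (begin
    x * (y - z)   ≈⟨ solve 3 (λ x y z → x :* (y :- z) := x :* y :- x :* z) refl x y z ⟩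
    x * y - x * z ≈⟨ x≈y⇒x∙y⁻¹≈ε e ⟩
    0#            ∎))
  where
  open CommutativeRing R
  open GroupProperties +-group using (x≈y⇒x∙y⁻¹≈ε; x∙y⁻¹≈ε⇒x≈y)
  open IntegerSolver R using (solve; _:=_; _:*_; _:-_)
  open SetoidReasoning setoid

-- At a simple root r of g, the left side of a² = g b² vanishes to even and
-- the right side to odd order.
module SimpleRoot (R : CommutativeRing c ℓ) (integral : Integral R)
  (integral[X] : Integral (Polynomial.polynomialRing R))
  (1≉0 : Nontrivial R)
  (r : CommutativeRing.Carrier R) where
  open CommutativeRing R hiding (zero)
  open Polynomial R hiding (eval)
  open LinearFactor R r
  private module P = CommutativeRing polynomialRing

  X-r≉0 : ¬ X-r ≋ []
  X-r≉0 e = 1≉0 (at e 1)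

  ev-X-r : ⟦ X-r ⟧ ≈ 0#
  ev-X-r = solve 1 (λ r → :- r :+ r :* (con (+ 1) :+ r :* con (+ 0)) := con (+ 0)) refl r
    where open IntegerSolver R using (solve; _:=_; _:+_; _:*_; :-_; con)

  -- The length of the list is recorded as the measure for the descent; unlike a degree it needs no
  -- test for zero.
  factor : ∀ p → ⟦ p ⟧ ≈ 0# → ∃[ q ] (p ≋ X-r ⊛ q × length q ≡ ℕ.pred (length p))
  factor []      e = [] , P.sym (⊛-zeroʳ X-r) , ≡.refl
  factor (a ∷ p) e = horner p ,
    P.trans (divide a p) (P.trans (P.+-congʳ {X-r ⊛ horner p}
      (P.trans (∷-cong e P.refl) shift-[])) (P.+-identityˡ _)) ,
    length-horner p

  -- The cofactor of X - r is the difference quotient at r, whose value there is g′(r).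
  cofactor : ∀ g → ⟦ g ⟧ ≈ 0# → ¬ ⟦ derivative g ⟧ ≈ 0# → ∃[ h ] (g ≋ X-r ⊛ h × ¬ ⟦ h ⟧ ≈ 0#)
  cofactor []      e s = contradiction refl s
  cofactor (k ∷ g) e s = horner g , proj₁ (proj₂ (factor (k ∷ g) e)) ,
    λ h≈0 → s (trans (sym (eval-horner k g)) h≈0)

  square-root : ∀ p → ⟦ p ⊛ p ⟧ ≈ 0# → ⟦ p ⟧ ≈ 0#
  square-root p e = Sum.reduce (integral _ _ (trans (sym (ev-⊛ p p)) e))

  -- m is X - r, kept abstract to stop products from being expanded.
  module Descent (m : Poly) (m≉[] : ¬ m ≋ []) (m-root : ⟦ m ⟧ ≈ 0#)
    (factor : ∀ p → ⟦ p ⟧ ≈ 0# → ∃[ q ] (p ≋ m ⊛ q × length q ≡ ℕ.pred (length p)))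
    (g h : Poly) (root : ⟦ g ⟧ ≈ 0#) (g≋ : g ≋ m ⊛ h) (simple : ¬ ⟦ h ⟧ ≈ 0#) where

    -- Infinite descent on b. The root of g forces a = m a′, whence m a′² = h b². As h(r) is not 0,
    -- this gives b = m b′, and a′² = g b′² is the same equation with a shorter b.
    descent : ∀ n a b → length b ≤ n → a ⊛ a ≋ g ⊛ (b ⊛ b) → b ≋ []
    descent zero    a []      b≤n e = P.refl
    descent (suc n) a b b≤n e = P.trans b≋ (P.trans (⊛-congˡ m b′≋[]) (⊛-zeroʳ m))
      where
      open IntegerSolver polynomialRing using (solve; _:=_; _:*_)
      a-root : ⟦ a ⟧ ≈ 0#
      a-root = square-root a (trans (ev-cong e)
          (trans (ev-⊛ g (b ⊛ b)) (trans (*-congʳ root) (zeroˡ _))))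
      a′ = proj₁ (factor a a-root)
      a≋ = proj₁ (proj₂ (factor a a-root))
      step₁ : m ⊛ (a′ ⊛ a′) ≋ h ⊛ (b ⊛ b)
      step₁ = integral-cancel polynomialRing integral[X] m≉[] (begin
        m ⊛ (m ⊛ (a′ ⊛ a′))
          ≈⟨ solve 2 (λ m a → m :* (m :* (a :* a)) := m :* a :* (m :* a)) P.refl m a′ ⟩
        (m ⊛ a′) ⊛ (m ⊛ a′) ≈⟨ ⊛-cong a≋ a≋ ⟨
        a ⊛ a                   ≈⟨ e ⟩
        g ⊛ (b ⊛ b)             ≈⟨ ⊛-cong g≋ (P.refl {b ⊛ b}) ⟩
        m ⊛ h ⊛ (b ⊛ b)       ≈⟨ ⊛-assoc m h (b ⊛ b) ⟩
        m ⊛ (h ⊛ (b ⊛ b))     ∎)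
        where open SetoidReasoning P.setoid
      b-root : ⟦ b ⟧ ≈ 0#
      b-root = square-root b (integral-≉0 R integral simple (begin
          ⟦ h ⟧ * ⟦ b ⊛ b ⟧    ≈⟨ ev-⊛ h (b ⊛ b) ⟨
          ⟦ h ⊛ (b ⊛ b) ⟧      ≈⟨ ev-cong step₁ ⟨
          ⟦ m ⊛ (a′ ⊛ a′) ⟧    ≈⟨ ev-⊛ m (a′ ⊛ a′) ⟩
          ⟦ m ⟧ * ⟦ a′ ⊛ a′ ⟧  ≈⟨ *-congʳ m-root ⟩
          0# * ⟦ a′ ⊛ a′ ⟧     ≈⟨ zeroˡ _ ⟩
          0#                   ∎))
        where open SetoidReasoning setoid
      b′ = proj₁ (factor b b-root)
      b≋ = proj₁ (proj₂ (factor b b-root))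
      b′≤n : length b′ ≤ n
      b′≤n = ℕ.≤-trans (ℕ.≤-reflexive (proj₂ (proj₂ (factor b b-root)))) (ℕ.pred-mono-≤ b≤n)
      b′≋[] : b′ ≋ []
      b′≋[] = descent n a′ b′ b′≤n (integral-cancel polynomialRing integral[X] m≉[] (begin
        m ⊛ (a′ ⊛ a′)                   ≈⟨ step₁ ⟩
        h ⊛ (b ⊛ b)                       ≈⟨ ⊛-congˡ h (⊛-cong b≋ b≋) ⟩
        h ⊛ ((m ⊛ b′) ⊛ (m ⊛ b′))
          ≈⟨ solve 3 (λ h m b → h :* ((m :* b) :* (m :* b)) := m :* (m :* h :* (b :* b))) P.refl h m b′ ⟩
        m ⊛ (m ⊛ h ⊛ (b′ ⊛ b′))       ≈⟨ ⊛-congˡ m (⊛-cong g≋ (P.refl {b′ ⊛ b′})) ⟨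
        m ⊛ (g ⊛ (b′ ⊛ b′))             ∎))
        where open SetoidReasoning P.setoid

  anisotropic : ∀ g → ⟦ g ⟧ ≈ 0# → ¬ ⟦ derivative g ⟧ ≈ 0# →
                Anisotropic polynomialRing g
  anisotropic g root simple a b e = Sum.reduce (integral[X] a a (P.trans e
    (P.trans (⊛-congˡ g (⊛-cong b≋[] b≋[])) (⊛-zeroʳ g)))) , b≋[]
    where
    open Descent X-r X-r≉0 ev-X-r factor g (proj₁ (cofactor g root simple)) root
      (proj₁ (proj₂ (cofactor g root simple))) (proj₂ (proj₂ (cofactor g root simple)))
    b≋[] = descent (length b) a b ℕ.≤-refl e

-- Base change and points over PAC fields

module BaseChange (em : ∀ {a : Level} → ExcludedMiddle a) {K : Field c ℓ} (L : Extension K) where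
  private
    module K = Field K
    module L = Extension L
    module K[X] = Polynomial K.commutativeRing
    module L[X] = Polynomial L.commutativeRing
    open SetoidReasoning L.setoid

  -- In a field nonzero elements are units, and ι preserves units.
  ι-≉0 : ∀ {x} → ¬ x K.≈ K.0# → ¬ L.ι x L.≈ L.0#
  ι-≉0 {x} x≉0 e = L.1≉0 (begin
    L.1#             ≈⟨ L.1#-homo ⟨
    L.ι K.1#         ≈⟨ L.⟦⟧-cong (proj₂ (K.inverse x x≉0)) ⟨
    L.ι (x K.* y)    ≈⟨ L.*-homo x y ⟩
    L.ι x L.* L.ι y  ≈⟨ L.*-congʳ e ⟩
    L.0# L.* L.ι y   ≈⟨ L.zeroˡ _ ⟩
    L.0#             ∎)
    where y = proj₁ (K.inverse x x≉0)

  coeff-map : ∀ p i → L[X].coeff (List.map L.ι p) i L.≈ L.ι (K[X].coeff p i)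
  coeff-map []      i       = L.sym L.0#-homo
  coeff-map (a ∷ p) zero    = L.refl
  coeff-map (a ∷ p) (suc i) = coeff-map p i

  map-≉[] : ∀ {p} → ¬ p K[X].≋ [] → ¬ List.map L.ι p L[X].≋ []
  map-≉[] {p} p≉[] e = p≉[] (K[X].mk≋ λ i → decidable-stable em λ pᵢ≉0 →
    ι-≉0 pᵢ≉0 (L.trans (L.sym (coeff-map p i)) (L[X].at e i)))

  map-⊕ : ∀ p q → List.map L.ι (p K[X].⊕ q) L[X].≋ List.map L.ι p L[X].⊕ List.map L.ι q
  map-⊕ p q = L[X].mk≋ λ i → begin
    L[X].coeff (List.map L.ι (p K[X].⊕ q)) i         ≈⟨ coeff-map (p K[X].⊕ q) i ⟩
    L.ι (K[X].coeff (p K[X].⊕ q) i)                  ≈⟨ L.⟦⟧-cong (K[X].coeff-⊕ p q i) ⟩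
    L.ι (K[X].coeff p i K.+ K[X].coeff q i)          ≈⟨ L.+-homo _ _ ⟩
    L.ι (K[X].coeff p i) L.+ L.ι (K[X].coeff q i)
      ≈⟨ L.+-cong (coeff-map p i) (coeff-map q i) ⟨
    L[X].coeff (List.map L.ι p) i L.+ L[X].coeff (List.map L.ι q) i
      ≈⟨ L[X].coeff-⊕ (List.map L.ι p) (List.map L.ι q) i ⟨
    L[X].coeff (List.map L.ι p L[X].⊕ List.map L.ι q) i ∎

  map-⊖ : ∀ p → List.map L.ι (K[X].⊖ p) L[X].≋ L[X].⊖ List.map L.ι p
  map-⊖ p = L[X].mk≋ λ i → begin
    L[X].coeff (List.map L.ι (K[X].⊖ p)) i  ≈⟨ coeff-map (K[X].⊖ p) i ⟩
    L.ι (K[X].coeff (K[X].⊖ p) i)           ≈⟨ L.⟦⟧-cong (K[X].coeff-⊖ p i) ⟩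
    L.ι (K.- K[X].coeff p i)                ≈⟨ L.-‿homo _ ⟩
    L.- L.ι (K[X].coeff p i)                ≈⟨ L.-‿cong (coeff-map p i) ⟨
    L.- L[X].coeff (List.map L.ι p) i       ≈⟨ L[X].coeff-⊖ (List.map L.ι p) i ⟨
    L[X].coeff (L[X].⊖ List.map L.ι p) i    ∎

  map-derivative : ∀ p → List.map L.ι (K[X].derivative p) L[X].≋ L[X].derivative (List.map L.ι p)
  map-derivative []      = LP.refl
    where module LP = CommutativeRing L[X].polynomialRing
  map-derivative (a ∷ p) = LP.trans (map-⊕ p (K[X].shift (K[X].derivative p)))
    (L[X].⊕-cong {List.map L.ι p} LP.refl (L[X].∷-cong L.0#-homo (map-derivative p)))
    where module LP = CommutativeRing L[X].polynomialRing

  eval-map : ∀ x p → L[X].eval x (List.map L.ι p) ≡ L.evalAt x p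
  eval-map x []      = ≡.refl
  eval-map x (a ∷ p) = cong (λ y → L.ι a L.+ x L.* y) (eval-map x p)

module PACField (em : ∀ {a : Level} → ExcludedMiddle a) (K : Field c ℓ) (pac : PAC K) where
  open Field K hiding (zero)
  open Polynomial commutativeRing
  private
    module P = CommutativeRing polynomialRing
    open SetoidReasoning setoid

  -- A point on the variety p(y) z = 1, whose coordinate ring over the closure is a localisation of
  -- a polynomial ring. This takes the place of a proof that K is infinite together with a count of
  -- roots.
  nonvanishing : ∀ p → ¬ p ≋ [] → ∃[ x ] ¬ eval x p ≈ 0#
  nonvanishing p p≉[] = y , λ p[y]≈0 → 1≉0 (begin
      1#                                    ≈⟨ solve 3 (λ y z p → con (+ 1) :=
        z :* p :- (:- con (+ 1) :+ y :* con (+ 0) :+ z :* (p :+ z :* con (+ 0)))) refl y z (eval y p) ⟩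
      z * eval y p - evalMv commutativeRing 2 x (f zero)
                                            ≈⟨ +-cong (*-congˡ p[y]≈0) (-‿cong vanishes) ⟩
      z * 0# - 0#                           ≈⟨ solve 1 (λ z →
        z :* con (+ 0) :- con (+ 0) := con (+ 0)) refl z ⟩
      0#                                    ∎)
    where
    open IntegerSolver commutativeRing using (solve; _:=_; _:+_; _:*_; _:-_; :-_; con)
    f : Vector (MvPoly commutativeRing 2) 1
    -- The outer variable is z and the coefficients are polynomials in y, so this is p(y) z - 1.
    f _ = (⊖ P.1#) ∷ p ∷ []
    irreducible : AbsolutelyIrreducible K {2} f
    irreducible L closure = isPrime
      (λ i → mapMv commutativeRing L.commutativeRing L.ι 2 (f i)) (A.trans (L[Y].∷-cong
      (LP.trans (map-⊖ P.1#) (L[X].⊖-cong (L[X].∷-cong L.1#-homo LP.refl))) A.refl) linear≋G)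
      where
      open BaseChange em L
      module L = Extension L
      module L[X] = Polynomial L.commutativeRing
      module LP = CommutativeRing L[X].polynomialRing
      module L[Y] = Polynomial L[X].polynomialRing
      module A = CommutativeRing L[Y].polynomialRing
      open LocalisationPrime L[X].polynomialRing
        (polynomial-integral em L.commutativeRing (field-integral em L.top))
        (λ e → L.1≉0 (L[X].at e 0)) (List.map L.ι p) (map-≉[] p≉[])
    x = proj₁ (pac {2} f irreducible)
    y = x (suc zero)
    z = x zero
    vanishes = proj₂ (pac {2} f irreducible) zero

  -- All extensions are allowed, since absolute irreducibility confronts g with an arbitrary
  -- algebraic closure.
  Simple : Poly → Set _
  Simple g = (L : Extension K) → let module L = Extension L in
             ∀ r → L.evalAt r g L.≈ L.0# → ¬ L.evalAt r (derivative g) L.≈ L.0#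

  curve-point : ∀ g → NonConstant g → Simple g → ∃[ x ] ∃[ y ] y * y ≈ eval x g
  curve-point g (d , lead≉0) simple = x , y , (begin
      y * y ≈⟨ solve 3 (λ x y g → y :* y := g :+ (:- g :+
        y :* (con (+ 0) :+ y :* (con (+ 1) :+ x :* con (+ 0) :+ y :* con (+ 0))))) refl x y (eval x g) ⟩
      eval x g + (- eval x g + y * (0# + y * (1# + x * 0# + y * 0#)))
        ≈⟨ +-congˡ (+-congʳ (ev-⊖ g)) ⟨
      eval x g + evalMv commutativeRing 2 v (f zero) ≈⟨ +-congˡ vanishes ⟩
      eval x g + 0#                                  ≈⟨ +-identityʳ _ ⟩
      eval x g                                       ∎)
    where
    open IntegerSolver commutativeRing using (solve; _:=_; _:+_; _:*_; :-_; con)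
    f : Vector (MvPoly commutativeRing 2) 1
    f _ = (⊖ g) ∷ [] ∷ P.1# ∷ []
    irreducible : AbsolutelyIrreducible K {2} f
    irreducible L closure = isPrime
      (λ i → mapMv commutativeRing L.commutativeRing L.ι 2 (f i)) (A.trans (L[Y].∷-cong (map-⊖ g)
      (L[Y].∷-cong LP.refl (L[Y].∷-cong (L[X].∷-cong L.1#-homo LP.refl) A.refl))) quadratic≋G)
      where
      open BaseChange em L
      module L = Extension L
      module L[X] = Polynomial L.commutativeRing
      module LP = CommutativeRing L[X].polynomialRing
      module L[Y] = Polynomial L[X].polynomialRing
      module A = CommutativeRing L[Y].polynomialRing
      gᴸ = List.map L.ι g
      integral = field-integral em L.top
      integral[X] = polynomial-integral em L.commutativeRing integral
      -- Nonconstancy is used here: one simple root in the closure suffices for Y² - g to generate a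
      -- prime ideal.
      has-root : ∃[ r ] L[X].eval r gᴸ L.≈ L.0#
      has-root = IsAlgebraicClosure.algebraicallyClosed closure gᴸ
        (d , λ e → ι-≉0 lead≉0 (L.trans (L.sym (coeff-map g (suc d))) e))
      r = proj₁ has-root
      open LinearFactor L.commutativeRing r using () renaming (ev-cong to evᴸ-cong)
      simpleᴸ : ¬ L[X].eval r (L[X].derivative gᴸ) L.≈ L.0#
      simpleᴸ e = simple L r (L.trans (L.reflexive (≡.sym (eval-map r g))) (proj₂ has-root))
        (L.trans (L.reflexive (≡.sym (eval-map r (derivative g))))
          (L.trans (evᴸ-cong (map-derivative g)) e))
      open SimpleRoot L.commutativeRing integral integral[X] L.1≉0 r using (anisotropic)
      open QuadraticPrime L[X].polynomialRing integral[X]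
        (λ e → L.1≉0 (L[X].at e 0)) gᴸ (anisotropic gᴸ (proj₂ has-root) simpleᴸ)
    v = proj₁ (pac {2} f irreducible)
    x = v (suc zero)
    y = v zero
    vanishes = proj₂ (pac {2} f irreducible) zero
    open LinearFactor commutativeRing x using (ev-⊖)

-- Fraction-free elimination and finite-dimensional linear algebra

module Elimination (em : ∀ {a : Level} → ExcludedMiddle a) (K : Field c ℓ) where
  open Field K hiding (zero)
  open SemiringSum semiring using (sum; sum-cong-≋; *-distribˡ-sum; sum-replicate-zero)
  open IntegerSolver commutativeRing using (solve; _:=_; _:+_; _:*_; _:-_; :-_; con)
  open SetoidReasoning setoid
  private
    integral : Integral commutativeRing
    integral = field-integral em K

  ≈0⇒sum≈0 : ∀ {n} (f : Vector Carrier n) → (∀ i → f i ≈ 0#) → sum f ≈ 0#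
  ≈0⇒sum≈0 {n} f f≈0 = trans (sum-cong-≋ {n} f≈0) (sum-replicate-zero n)

  RowsIndependent : ∀ {k n} → (Fin k → Fin n → Carrier) → Set _
  RowsIndependent {k} {n} u =
    ∀ (x : Vector Carrier k) → (∀ m → sum (λ j → x j * u j m) ≈ 0#) → ∀ j → x j ≈ 0#

  sum-minor : ∀ {k} (x a b : Vector Carrier k) p q →
              sum (λ j → x j * (p * a j - b j * q)) ≈
              p * sum (λ j → x j * a j) - sum (λ j → x j * b j) * q
  sum-minor {zero}  x a b p q = solve 2 (λ p q → con (+ 0) := p :* con (+ 0) :- con (+ 0) :* q) refl p q
  sum-minor {suc k} x a b p q = trans
      (+-congˡ (sum-minor (λ j → x (suc j)) (λ j → a (suc j)) (λ j → b (suc j)) p q))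
    (solve 7 (λ x a b p q s t → x :* (p :* a :- b :* q) :+ (p :* s :- t :* q) :=
       p :* (x :* a :+ s) :- (x :* b :+ t) :* q) refl (x zero) (a zero) (b zero) p q _ _)

  module _ {k n} (u : Fin (suc k) → Fin n → Carrier) (i : Fin n) where
    -- Cross multiplication instead of division by the pivot: the same formula makes sense over any
    -- commutative ring and commutes with homomorphisms.
    reduced : Fin k → Fin n → Carrier
    reduced j m = u zero i * u (suc j) m - u (suc j) i * u zero m

    -- Both sums on the right may include the pivot row, as its two contributions cancel.
    sum-reduced : ∀ (x : Vector Carrier (suc k)) m → sum (λ j → x (suc j) * reduced j m) ≈
                  u zero i * sum (λ j → x j * u j m) - sum (λ j → x j * u j i) * u zero m
    sum-reduced x m = trans
      (sum-minor (λ j → x (suc j)) (λ j → u (suc j) m) (λ j → u (suc j) i) (u zero i) (u zero m))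
      (solve 5 (λ p q x s t → p :* s :- t :* q := p :* (x :* q :+ s) :- (x :* p :+ t) :* q) refl
        (u zero i) (u zero m) (x zero) _ _)

    module _ (pivot : ¬ u zero i ≈ 0#) where

      reduced-independent : RowsIndependent u → RowsIndependent reduced
      reduced-independent ind y y≈0 j = integral-≉0 commutativeRing integral pivot
        (ind x (λ m → integral-≉0 commutativeRing integral pivot (begin
          u zero i * sum (λ j → x j * u j m)
            ≈⟨ solve 3 (λ p s q → p :* s := p :* s :- con (+ 0) :* q) refl (u zero i) _ (u zero m) ⟩
          u zero i * sum (λ j → x j * u j m) - 0# * u zero m
            ≈⟨ +-congˡ (-‿cong (*-congʳ x-kills-i)) ⟨
          u zero i * sum (λ j → x j * u j m) - sum (λ j → x j * u j i) * u zero m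
            ≈⟨ sum-reduced x m ⟨
          sum (λ j → u zero i * y j * reduced j m)
            ≈⟨ sum-cong-≋ {k} (λ j → *-assoc (u zero i) (y j) (reduced j m)) ⟩
          sum (λ j → u zero i * (y j * reduced j m))
            ≈⟨ *-distribˡ-sum {k} (u zero i) (λ j → y j * reduced j m) ⟨
          u zero i * sum (λ j → y j * reduced j m)   ≈⟨ *-congˡ (y≈0 m) ⟩
          u zero i * 0#                              ≈⟨ zeroʳ _ ⟩
          0#                                         ∎)) (suc j))
        where
        s = sum (λ j → y j * u (suc j) i)
        x : Vector Carrier (suc k)
        -- The rest is scaled by the pivot so that the entry for the pivot row, which must make
        -- column i vanish, needs no division.
        x = (- s) ∷ᵛ (λ j → u zero i * y j)
        x-kills-i : sum (λ j → x j * u j i) ≈ 0#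
        x-kills-i = begin
          - s * u zero i + sum (λ j → u zero i * y j * u (suc j) i)
            ≈⟨ +-congˡ (sum-cong-≋ {k} (λ j → *-assoc (u zero i) (y j) (u (suc j) i))) ⟩
          - s * u zero i + sum (λ j → u zero i * (y j * u (suc j) i))
            ≈⟨ +-congˡ (*-distribˡ-sum {k} (u zero i) (λ j → y j * u (suc j) i)) ⟨
          - s * u zero i + u zero i * s
            ≈⟨ solve 2 (λ s p → :- s :* p :+ p :* s := con (+ 0)) refl s (u zero i) ⟩
          0# ∎

      independent-from-reduced : RowsIndependent reduced → RowsIndependent u
      independent-from-reduced ind x x≈0 = λ { zero → x₀≈0 ; (suc j) → xⱼ≈0 j }
        where
        xⱼ≈0 : ∀ j → x (suc j) ≈ 0#
        xⱼ≈0 = ind (λ j → x (suc j)) λ m → begin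
          sum (λ j → x (suc j) * reduced j m) ≈⟨ sum-reduced x m ⟩
          u zero i * sum (λ j → x j * u j m) - sum (λ j → x j * u j i) * u zero m
            ≈⟨ +-cong (*-congˡ (x≈0 m)) (-‿cong (*-congʳ (x≈0 i))) ⟩
          u zero i * 0# - 0# * u zero m
            ≈⟨ solve 2 (λ p q → p :* con (+ 0) :- con (+ 0) :* q := con (+ 0)) refl (u zero i)
                (u zero m) ⟩
          0# ∎
        x₀≈0 : x zero ≈ 0#
        x₀≈0 = integral-≉0 commutativeRing integral pivot (begin
          u zero i * x zero          ≈⟨ *-comm _ _ ⟩
          x zero * u zero i          ≈⟨ +-identityʳ _ ⟨
          x zero * u zero i + 0#
            ≈⟨ +-congˡ (≈0⇒sum≈0 (λ j → x (suc j) * u (suc j) i)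
                 (λ j → trans (*-congʳ (xⱼ≈0 j)) (zeroˡ _))) ⟨
          sum (λ j → x j * u j i)    ≈⟨ x≈0 i ⟩
          0#                         ∎)

  pivot-exists : ∀ {k n} (u : Fin (suc k) → Fin n → Carrier) → RowsIndependent u →
                 ∃[ i ] ¬ u zero i ≈ 0#
  pivot-exists {k} {n} u ind = Fin.¬∀⟶∃¬ n (λ i → u zero i ≈ 0#) (λ i → em) λ u₀≈0 →
    1≉0 (ind (1# ∷ᵛ (λ _ → 0#)) (λ m → begin
      1# * u zero m + sum (λ j → 0# * u (suc j) m)
        ≈⟨ +-cong (trans (*-identityˡ _) (u₀≈0 m))
             (≈0⇒sum≈0 (λ j → 0# * u (suc j) m) (λ j → zeroˡ (u (suc j) m))) ⟩
      0# + 0#  ≈⟨ +-identityˡ 0# ⟩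
      0#       ∎) zero)

  module _ {a ℓa} (A : CommutativeRing a ℓa) where
    private module A = CommutativeRing A

    -- P is the product of the pivots of a fraction-free Gaussian elimination
    -- for e₀.
    independence-open :
      ∀ k n (v : Fin k → Fin n → A.Carrier) e₀ → IsHom A commutativeRing e₀ →
      RowsIndependent (λ j m → e₀ (v j m)) →
      k ≤ n × ∃[ P ] (¬ e₀ P ≈ 0# ×
        (∀ e → IsHom A commutativeRing e → ¬ e P ≈ 0# → RowsIndependent (λ j m → e (v j m))))
    independence-open zero    n       v e₀ hom ind =
      z≤n , A.1# , (λ e → 1≉0 (trans (sym 1#-homo) e)) , λ _ _ _ _ _ ()
      where open RingMorphisms.IsRingHomomorphism hom
    independence-open (suc k) zero    v e₀ hom ind =
      contradiction (ind (λ _ → 1#) (λ ()) zero) 1≉0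
    independence-open (suc k) (suc n) v e₀ hom ind =
      s≤s (proj₁ rec) , v zero i A.* P , PP≉0 , open-set
      where
      i = proj₁ (pivot-exists (λ j m → e₀ (v j m)) ind)
      pivot = proj₂ (pivot-exists (λ j m → e₀ (v j m)) ind)
      -- The reduction takes place over A, before specialisation, and deletes the pivot column; the
      -- shrinking number of columns gives the bound k ≤ n.
      w : Fin k → Fin n → A.Carrier
      w j m = v zero i A.* v (suc j) (punchIn i m) A.- v (suc j) i A.* v zero (punchIn i m)
      image : ∀ e → IsHom A commutativeRing e → ∀ j m →
              e (w j m) ≈ reduced (λ j m → e (v j m)) i j (punchIn i m)
      image e hom j m = trans (+-homo _ _) (+-cong (*-homo _ _) (trans (-‿homo _) (-‿cong (*-homo _ _))))
        where open RingMorphisms.IsRingHomomorphism hom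
      -- The pivot column of the reduced matrix vanishes.
      forward : ∀ e (hom : IsHom A commutativeRing e) →
                RowsIndependent (reduced (λ j m → e (v j m)) i) → RowsIndependent (λ j m → e (w j m))
      forward e hom ind x x≈0 = ind x column
        where
        column : ∀ m → sum (λ j → x j * reduced (λ j m → e (v j m)) i j m) ≈ 0#
        column m with i Fin.≟ m
        ... | yes ≡.refl = ≈0⇒sum≈0 _ λ j →
          solve 3 (λ x p q → x :* (p :* q :- q :* p) := con (+ 0)) refl (x j) (e (v zero i))
              (e (v (suc j) i))
        ... | no i≢m = ≡.subst (λ m → sum (λ j → x j * reduced (λ j m → e (v j m)) i j m) ≈ 0#)
          (Fin.punchIn-punchOut i≢m)
          (trans (sum-cong-≋ {k} λ j → *-congˡ (sym (image e hom j (punchOut i≢m))))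
              (x≈0 (punchOut i≢m)))
      backward : ∀ e (hom : IsHom A commutativeRing e) →
                 RowsIndependent (λ j m → e (w j m)) → RowsIndependent (reduced (λ j m → e (v j m)) i)
      backward e hom ind x x≈0 = ind x λ m →
        trans (sum-cong-≋ {k} λ j → *-congˡ (image e hom j m)) (x≈0 (punchIn i m))
      rec = independence-open k n w e₀ hom
        (forward e₀ hom (reduced-independent (λ j m → e₀ (v j m)) i pivot ind))
      P = proj₁ (proj₂ rec)
      PP≉0 : ¬ e₀ (v zero i A.* P) ≈ 0#
      PP≉0 e = proj₁ (proj₂ (proj₂ rec)) (integral-≉0 commutativeRing integral pivot
        (trans (sym (*-homo _ _)) e))
        where open RingMorphisms.IsRingHomomorphism hom
      open-set : ∀ e → IsHom A commutativeRing e → ¬ e (v zero i A.* P) ≈ 0# →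
                 RowsIndependent (λ j m → e (v j m))
      open-set e hom P≉0 = independent-from-reduced (λ j m → e (v j m)) i
        (λ p≈0 → P≉0 (trans (*-homo _ _) (trans (*-congʳ p≈0) (zeroˡ _))))
        (backward e hom (proj₂ (proj₂ (proj₂ rec)) e hom
          (λ P≈0 → P≉0 (trans (*-homo _ _) (trans (*-congˡ P≈0) (zeroʳ _))))))
        where open RingMorphisms.IsRingHomomorphism hom

  independent⇒≤ : ∀ {k n} (u : Fin k → Fin n → Carrier) → RowsIndependent u → k ≤ n
  independent⇒≤ {k} {n} u ind =
    proj₁ (independence-open commutativeRing k n u (λ x → x) (idHom commutativeRing) ind)

module LinearCombination (K : Field c ℓ) (V : LeftModule (Field.ring K) m ℓm) where
  open Field K hiding (zero)
  open LeftModule V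
  open MonoidSum +ᴹ-commutativeMonoid public
    using () renaming (sum to sumᴹ; sum-cong-≋ to sumᴹ-cong; ∑-distrib-+ to sumᴹ-+; sum-replicate-zero to
        sumᴹ-0)
  open SetoidReasoning ≈ᴹ-setoid

  comb : ∀ {k} → Vector Carrier k → Vector Carrierᴹ k → Carrierᴹ
  comb a u = sumᴹ (λ i → a i *ₗ u i)

  comb-congˡ : ∀ {k} {a a′ : Vector Carrier k} (u : Vector Carrierᴹ k) →
               (∀ i → a i ≈ a′ i) → comb a u ≈ᴹ comb a′ u
  comb-congˡ {k} u e = sumᴹ-cong {k} λ i → *ₗ-congʳ (e i)

  comb-0 : ∀ {k} {a : Vector Carrier k} (u : Vector Carrierᴹ k) →
           (∀ i → a i ≈ 0#) → comb a u ≈ᴹ 0ᴹ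
  comb-0 {k} u e = ≈ᴹ-trans (sumᴹ-cong {k} λ i → ≈ᴹ-trans (*ₗ-congʳ (e i)) (*ₗ-zeroˡ (u i))) (sumᴹ-0 k)

  comb-+ : ∀ {k} (a a′ : Vector Carrier k) (u : Vector Carrierᴹ k) →
           comb (λ i → a i + a′ i) u ≈ᴹ comb a u +ᴹ comb a′ u
  comb-+ {k} a a′ u = ≈ᴹ-trans (sumᴹ-cong {k} λ i → *ₗ-distribʳ (u i) (a i) (a′ i))
    (sumᴹ-+ (λ i → a i *ₗ u i) (λ i → a′ i *ₗ u i))

  comb-* : ∀ {k} x (a : Vector Carrier k) (u : Vector Carrierᴹ k) →
           comb (λ i → x * a i) u ≈ᴹ x *ₗ comb a u
  comb-* {zero}  x a u = ≈ᴹ-sym (*ₗ-zeroʳ x)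
  comb-* {suc k} x a u = ≈ᴹ-trans
    (+ᴹ-cong (*ₗ-assoc x (a zero) (u zero)) (comb-* x (λ i → a (suc i)) (λ i → u (suc i))))
    (≈ᴹ-sym (*ₗ-distribˡ x _ _))

  Independent : ∀ {k} → Vector Carrierᴹ k → Set _
  Independent {k} u = ∀ (a : Vector Carrier k) → comb a u ≈ᴹ 0ᴹ → ∀ i → a i ≈ 0#

  Span : ∀ {k} → Vector Carrierᴹ k → Carrierᴹ → Set _
  Span {k} u x = ∃[ a ] x ≈ᴹ comb {k} a u

  comb-injective : ∀ {k} {u : Vector Carrierᴹ k} → Independent u →
                   ∀ a a′ → comb a u ≈ᴹ comb a′ u → ∀ i → a i ≈ a′ i
  comb-injective {u = u} ind a a′ e i = x∙y⁻¹≈ε⇒x≈y _ _ (trans (+-congˡ (sym (-1*x≈-x (a′ i))))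
    (ind (λ i → a i + - 1# * a′ i) (begin
      comb (λ i → a i + - 1# * a′ i) u          ≈⟨ comb-+ a (λ i → - 1# * a′ i) u ⟩
      comb a u +ᴹ comb (λ i → - 1# * a′ i) u    ≈⟨ +ᴹ-cong e (comb-* (- 1#) a′ u) ⟩
      t +ᴹ - 1# *ₗ t                            ≈⟨ +ᴹ-congʳ (*ₗ-identityˡ t) ⟨
      1# *ₗ t +ᴹ - 1# *ₗ t                      ≈⟨ *ₗ-distribʳ t 1# (- 1#) ⟨
      (1# - 1#) *ₗ t                            ≈⟨ ≈ᴹ-trans (*ₗ-congʳ (-‿inverseʳ 1#)) (*ₗ-zeroˡ t) ⟩
      0ᴹ                                        ∎) i))
    where
    open GroupProperties +-group using (x∙y⁻¹≈ε⇒x≈y)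
    open RingProperties ring using (-1*x≈-x)
    t = comb a′ u

module VectorSpace (em : ∀ {a : Level} → ExcludedMiddle a) (K : Field c ℓ)
                   (V : LeftModule (Field.ring K) m ℓm) where
  open Field K hiding (zero)
  open LeftModule V
  open LinearCombination K V public
  open SemiringSum semiring using (sum)
  open Elimination em K using (RowsIndependent; independent⇒≤)

  relation⇒Span : ∀ {k} {u : Vector Carrierᴹ k} {w} a → w +ᴹ comb a u ≈ᴹ 0ᴹ → Span u w
  relation⇒Span {u = u} {w} a e = (λ i → - 1# * a i) , (begin
    w                            ≈⟨ +ᴹ-identityʳ w ⟨
    w +ᴹ 0ᴹ                      ≈⟨ +ᴹ-congˡ (≈ᴹ-trans (*ₗ-congʳ (-‿inverseʳ 1#)) (*ₗ-zeroˡ t)) ⟨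
    w +ᴹ (1# - 1#) *ₗ t          ≈⟨ +ᴹ-congˡ (*ₗ-distribʳ t 1# (- 1#)) ⟩
    w +ᴹ (1# *ₗ t +ᴹ - 1# *ₗ t)  ≈⟨ +ᴹ-assoc _ _ _ ⟨
    w +ᴹ 1# *ₗ t +ᴹ - 1# *ₗ t    ≈⟨ +ᴹ-congʳ (≈ᴹ-trans (+ᴹ-congˡ (*ₗ-identityˡ t)) e) ⟩
    0ᴹ +ᴹ - 1# *ₗ t              ≈⟨ +ᴹ-identityˡ _ ⟩
    - 1# *ₗ t                    ≈⟨ comb-* (- 1#) a u ⟨
    comb (λ i → - 1# * a i) u    ∎)
    where
    open SetoidReasoning ≈ᴹ-setoid
    t = comb a u

  independent-∷ : ∀ {k} {u : Vector Carrierᴹ k} {w} →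
                  Independent u → ¬ Span u w → Independent (w ∷ᵛ u)
  independent-∷ {k} {u} {w} ind w∉u a e = λ { zero → a₀≈0 ; (suc i) → ind (λ i → a (suc i)) tail≈0 i }
    where
    open SetoidReasoning ≈ᴹ-setoid
    t = comb (λ i → a (suc i)) u
    a₀≈0 : a zero ≈ 0#
    a₀≈0 = decidable-stable em λ a₀≉0 → let (y , a₀y≈1) = inverse (a zero) a₀≉0 in
      w∉u (relation⇒Span (λ i → y * a (suc i)) (begin
        w +ᴹ comb (λ i → y * a (suc i)) u  ≈⟨ +ᴹ-cong (≈ᴹ-sym (*ₗ-identityˡ w))
            (comb-* y (λ i → a (suc i)) u) ⟩
        1# *ₗ w +ᴹ y *ₗ t                  ≈⟨ +ᴹ-congʳ (*ₗ-congʳ (trans (sym a₀y≈1) (*-comm _ _))) ⟩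
        (y * a zero) *ₗ w +ᴹ y *ₗ t        ≈⟨ +ᴹ-congʳ (*ₗ-assoc y (a zero) w) ⟩
        y *ₗ (a zero *ₗ w) +ᴹ y *ₗ t       ≈⟨ *ₗ-distribˡ y (a zero *ₗ w) t ⟨
        y *ₗ (a zero *ₗ w +ᴹ t)            ≈⟨ *ₗ-congˡ e ⟩
        y *ₗ 0ᴹ                            ≈⟨ *ₗ-zeroʳ y ⟩
        0ᴹ                                 ∎))
    tail≈0 : t ≈ᴹ 0ᴹ
    tail≈0 = begin
      t                     ≈⟨ +ᴹ-identityˡ t ⟨
      0ᴹ +ᴹ t               ≈⟨ +ᴹ-congʳ (≈ᴹ-trans (*ₗ-congʳ a₀≈0) (*ₗ-zeroˡ w)) ⟨
      a zero *ₗ w +ᴹ t      ≈⟨ e ⟩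
      0ᴹ                    ∎

  module Finite {n} (b : Basis {K = K} V n) where
    open Basis b

    coord-0 : ∀ l → coord 0ᴹ l ≈ 0#
    coord-0 l = trans (coord-cong b (≈ᴹ-sym (*ₗ-zeroˡ 0ᴹ)) l) (trans (coord-* b 0# 0ᴹ l) (zeroˡ _))

    coord-comb : ∀ {k} (a : Vector Carrier k) u l → coord (comb a u) l ≈ sum (λ j → a j * coord (u j) l)
    coord-comb {zero}  a u l = coord-0 l
    coord-comb {suc k} a u l = trans (coord-+ b _ _ l)
      (+-cong (coord-* b (a zero) (u zero) l) (coord-comb (λ i → a (suc i)) (λ i → u (suc i)) l))

    coord≈0⇒≈0 : ∀ x → (∀ l → coord x l ≈ 0#) → x ≈ᴹ 0ᴹ
    coord≈0⇒≈0 x e = ≈ᴹ-trans (spanning x) (comb-0 vec e)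

    rows-independent : ∀ {k} {u : Vector Carrierᴹ k} → Independent u →
        RowsIndependent (λ j → coord (u j))
    rows-independent {u = u} ind a e =
      ind a (coord≈0⇒≈0 _ (λ l → trans (coord-comb a u l) (e l)))

    independent-from-rows : ∀ {k} {u : Vector Carrierᴹ k} → RowsIndependent (λ j → coord (u j)) →
        Independent u
    independent-from-rows {u = u} ind a e = ind a λ l →
      trans (sym (coord-comb a u l)) (trans (coord-cong b e l) (coord-0 l))

    independent⇒≤dim : ∀ {k} {u : Vector Carrierᴹ k} → Independent u → k ≤ n
    independent⇒≤dim ind = independent⇒≤ _ (rows-independent ind)

    -- The matrix expressing the basis in terms of u has independent rows, and such a matrix has at
    -- least as many columns as rows.
    spanning⇒dim≤ : ∀ {k} (u : Vector Carrierᴹ k) → (∀ x → Span u x) → n ≤ k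
    spanning⇒dim≤ {k} u span = independent⇒≤ (λ i → proj₁ (span (vec i))) λ a e →
      independent a (≈ᴹ-trans (regroup a vec _ (λ i → proj₂ (span (vec i)))) (comb-0 u e))
      where
      regroup : ∀ {j} (a : Vector Carrier j) (v : Vector Carrierᴹ j) (s : Fin j → Vector Carrier k) →
                (∀ i → v i ≈ᴹ comb (s i) u) →
                comb a v ≈ᴹ comb (λ l → sum (λ i → a i * s i l)) u
      regroup {zero}  a v s e = ≈ᴹ-sym (comb-0 u (λ _ → refl))
      regroup {suc j} a v s e = ≈ᴹ-trans
        (+ᴹ-cong (≈ᴹ-trans (*ₗ-congˡ (e zero)) (≈ᴹ-sym (comb-* (a zero) (s zero) u)))
                 (regroup (λ i → a (suc i)) (λ i → v (suc i)) (λ i → s (suc i)) (λ i → e (suc i))))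
        (≈ᴹ-sym (comb-+ (λ l → a zero * s zero l) _ u))

    extend : ∀ {k} {u : Vector Carrierᴹ k} → k < n → ∃[ w ] ¬ Span u w
    extend {u = u} k<n = decidable-stable em λ none →
      ℕ.<⇒≱ k<n (spanning⇒dim≤ u λ x → decidable-stable em λ x∉u → none (x , x∉u))

    -- A vector outside the span would give n + 1 independent vectors.
    independent⇒basis : {u : Vector Carrierᴹ n} → Independent u → Basis {K = K} V n
    independent⇒basis {u} ind = record
      { vec = u ; coord = λ x → proj₁ (span x) ; spanning = λ x → proj₂ (span x) ; independent = ind }
      where
      span : ∀ x → Span u x
      span x = decidable-stable em λ x∉u →
          ℕ.<-irrefl ≡.refl (independent⇒≤dim {u = x ∷ᵛ u} (independent-∷ ind x∉u))

-- Simple extensions and a primitive element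

module Coefficients (R : CommutativeRing c ℓ) where
  open CommutativeRing R hiding (zero)
  open Polynomial R
  private module P = CommutativeRing polynomialRing

  -- The bound deg p < d, in a form insensitive to trailing zeros.
  VanishesFrom : ℕ → Poly → Set ℓ
  VanishesFrom d p = ∀ i → d ≤ i → coeff p i ≈ 0#

  coeff-tabulate : ∀ {k} (a : Vector Carrier k) i → coeff (List.tabulate a) (toℕ i) ≈ a i
  coeff-tabulate a zero    = refl
  coeff-tabulate a (suc i) = coeff-tabulate (λ i → a (suc i)) i

  tabulate-vanishes : ∀ {k} (a : Vector Carrier k) → VanishesFrom k (List.tabulate a)
  tabulate-vanishes {zero}  a i       _         = refl
  tabulate-vanishes {suc k} a (suc i) (s≤s k≤i) = tabulate-vanishes (λ i → a (suc i)) i k≤i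

  tabulate-coeff : ∀ k p → VanishesFrom k p → List.tabulate {n = k} (λ i → coeff p (toℕ i)) ≋ p
  tabulate-coeff zero    p       v = mk≋ λ i → sym (v i z≤n)
  tabulate-coeff (suc k) []      v = mk≋ λ
    { zero → refl ; (suc i) → at (tabulate-coeff k [] (λ _ _ → refl)) i }
  tabulate-coeff (suc k) (a ∷ p) v = ∷-cong refl (tabulate-coeff k p (λ i k≤i → v (suc i) (s≤s k≤i)))

  -- Nonzero multiples of a monic p have degree at least d. Above degree d the summand a · p
  -- contributes nothing, so the tail u satisfies the same bound and is 0; the coefficient in degree
  -- d is then a.
  monic-multiple : ∀ {d} p → coeff p d ≈ 1# → VanishesFrom (suc d) p →
                   ∀ u → VanishesFrom d (u ⊛ p) → u ≋ []
  monic-multiple {d} p lead above []      v = P.refl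
  monic-multiple {d} p lead above (a ∷ u) v = mk≋ λ { zero → a≈0 ; (suc i) → at u≋[] i }
    where
    open SetoidReasoning setoid
    u≋[] : u ≋ []
    u≋[] = monic-multiple p lead above u λ i d≤i → begin
      coeff (u ⊛ p) i                            ≈⟨ +-identityˡ _ ⟨
      0# + coeff (u ⊛ p) i                       ≈⟨ +-congʳ (zeroʳ a) ⟨
      a * 0# + coeff (u ⊛ p) i                   ≈⟨ +-congʳ (*-congˡ (above (suc i) (s≤s d≤i))) ⟨
      a * coeff p (suc i) + coeff (u ⊛ p) i      ≈⟨ +-congʳ (coeff-· a p (suc i)) ⟨
      coeff (a · p) (suc i) + coeff (u ⊛ p) i    ≈⟨ coeff-⊕ (a · p) (shift (u ⊛ p)) (suc i) ⟨
      coeff ((a ∷ u) ⊛ p) (suc i)                ≈⟨ v (suc i) (ℕ.m≤n⇒m≤1+n d≤i) ⟩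
      0#                                         ∎
    a≈0 : a ≈ 0#
    a≈0 = begin
      a                                          ≈⟨ *-identityʳ a ⟨
      a * 1#                                     ≈⟨ *-congˡ lead ⟨
      a * coeff p d                              ≈⟨ coeff-· a p d ⟨
      coeff (a · p) d                            ≈⟨ +-identityʳ _ ⟨
      coeff (a · p) d + 0#
        ≈⟨ +-congˡ (at (P.trans (shift-cong (⊛-cong u≋[] (P.refl {p}))) shift-[]) d) ⟨
      coeff (a · p) d + coeff (shift (u ⊛ p)) d  ≈⟨ coeff-⊕ (a · p) (shift (u ⊛ p)) d ⟨
      coeff ((a ∷ u) ⊛ p) d                      ≈⟨ v d ℕ.≤-refl ⟩
      0#                                         ∎

eval₂-homo : (R : CommutativeRing c ℓ) {S : CommutativeRing c′ ℓ′} {T : CommutativeRing m ℓm} →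
             let module R = CommutativeRing R ; module S = CommutativeRing S
                 module T = CommutativeRing T in
             ∀ {φ : R.Carrier → S.Carrier} {ψ : R.Carrier → T.Carrier} {h : S.Carrier → T.Carrier} →
             IsHom S T h → (∀ a → h (φ a) T.≈ ψ a) →
             ∀ x p → h (Polynomial.eval₂ R S φ x p) T.≈ Polynomial.eval₂ R T ψ (h x) p
eval₂-homo R {T = T} hom hφ≈ψ x []      = RingMorphisms.IsRingHomomorphism.0#-homo hom
eval₂-homo R {T = T} hom hφ≈ψ x (a ∷ p) = T.trans (+-homo _ _)
  (T.+-cong (hφ≈ψ a) (T.trans (*-homo _ _) (T.*-congˡ (eval₂-homo R hom hφ≈ψ x p))))
  where
  module T = CommutativeRing T
  open RingMorphisms.IsRingHomomorphism hom using (+-homo; *-homo)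

module _ (R : CommutativeRing c ℓ) (S : CommutativeRing c′ ℓ′) where
  open CommutativeRing S hiding (zero)
  private module R = CommutativeRing R
  open Exp semiring using (_^_)
  open Exp R.semiring using () renaming (_^_ to _^ᴿ_)

  ^-homo : ∀ {h} → IsHom R S h → ∀ x k → h (x ^ᴿ k) ≈ h x ^ k
  ^-homo hom x zero    = RingMorphisms.IsRingHomomorphism.1#-homo hom
  ^-homo hom x (suc k) = trans (RingMorphisms.IsRingHomomorphism.*-homo hom x (x ^ᴿ k))
    (*-congˡ (^-homo hom x k))

-- The value and the derivative at x of p, read off from p(x + b T) mod T².
module FirstOrder {K : CommutativeRing c ℓ} (F : CommutativeRing c′ ℓ′)
  {ι : CommutativeRing.Carrier K → CommutativeRing.Carrier F}
  (ι-hom : IsHom K F ι) (x b : CommutativeRing.Carrier F) where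
  open CommutativeRing F hiding (zero)
  open Polynomial F
  open Evaluation {R = K} F ι-hom x
  open IntegerSolver F using (solve; _:=_; _:+_; _:*_; con)
  open SetoidReasoning setoid
  private module K[X] = Polynomial K

  line : Poly
  line = x ∷ b ∷ []

  along : K[X].Poly → Poly
  along = K[X].eval₂ polynomialRing (λ a → ι a ∷ []) line

  coeff₀-line-⊛ : ∀ q → coeff (line ⊛ q) 0 ≈ x * coeff q 0
  coeff₀-line-⊛ q = trans (coeff-⊕ (x · q) _ 0) (trans (+-identityʳ _) (coeff-· x q 0))

  coeff₁-line-⊛ : ∀ q → coeff (line ⊛ q) 1 ≈ x * coeff q 1 + b * coeff q 0
  coeff₁-line-⊛ q = trans (coeff-⊕ (x · q) _ 1) (+-cong (coeff-· x q 1)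
    (trans (coeff-⊕ (b · q) (shift []) 0) (trans (+-identityʳ _) (coeff-· b q 0))))

  coeff₀-along : ∀ p → coeff (along p) 0 ≈ ⟦ p ⟧
  coeff₀-along []      = refl
  coeff₀-along (a ∷ p) = trans (coeff-⊕ (ι a ∷ []) (line ⊛ along p) 0)
    (+-congˡ (trans (coeff₀-line-⊛ (along p)) (*-congˡ (coeff₀-along p))))

  coeff₁-along : ∀ p → coeff (along p) 1 ≈ b * ⟦ K[X].derivative p ⟧
  coeff₁-along []      = sym (zeroʳ b)
  coeff₁-along (a ∷ p) = begin
    coeff (along (a ∷ p)) 1                      ≈⟨ coeff-⊕ (ι a ∷ []) (line ⊛ along p) 1 ⟩
    0# + coeff (line ⊛ along p) 1                ≈⟨ +-congˡ (coeff₁-line-⊛ (along p)) ⟩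
    0# + (x * coeff (along p) 1 + b * coeff (along p) 0)
      ≈⟨ +-congˡ (+-cong (*-congˡ (coeff₁-along p)) (*-congˡ (coeff₀-along p))) ⟩
    0# + (x * (b * ⟦ K[X].derivative p ⟧) + b * ⟦ p ⟧)
      ≈⟨ solve 4 (λ x b d p → con (+ 0) :+ (x :* (b :* d) :+ b :* p) := b :* (p :+ x :* d))
           refl x b ⟦ K[X].derivative p ⟧ ⟦ p ⟧ ⟩
    b * (⟦ p ⟧ + x * ⟦ K[X].derivative p ⟧)      ≈⟨ *-congˡ (+-congˡ (ev-shift (K[X].derivative p))) ⟨
    b * (⟦ p ⟧ + ⟦ K[X].shift (K[X].derivative p) ⟧)
      ≈⟨ *-congˡ (ev-⊕ p (K[X].shift (K[X].derivative p))) ⟨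
    b * ⟦ K[X].derivative (a ∷ p) ⟧              ∎

module _ {K : Field c ℓ} (L : Extension K) where
  private
    module K = Field K
    module L = Extension L
  open Polynomial K.commutativeRing

  -- The Bézout identity persists in every extension and excludes a common root of p and p′.
  separable⇒simple : ∀ {p} → SeparablePolynomial p →
                     ∀ r → L.evalAt r p L.≈ L.0# → ¬ L.evalAt r (derivative p) L.≈ L.0#
  separable⇒simple {p} (u , v , bezout) r root p′≈0 = L.1≉0 (begin
    L.1#                               ≈⟨ L.1#-homo ⟨
    L.ι K.1#                           ≈⟨ ev-C K.1# ⟨
    ⟦ K.1# ∷ [] ⟧                      ≈⟨ ev-cong bezout ⟨
    ⟦ u ⊛ p ⊕ v ⊛ p′ ⟧                 ≈⟨ ev-⊕ (u ⊛ p) (v ⊛ p′) ⟩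
    ⟦ u ⊛ p ⟧ L.+ ⟦ v ⊛ p′ ⟧           ≈⟨ L.+-cong (ev-⊛ u p) (ev-⊛ v p′) ⟩
    ⟦ u ⟧ L.* ⟦ p ⟧ L.+ ⟦ v ⟧ L.* ⟦ p′ ⟧ ≈⟨ L.+-cong (L.*-congˡ root) (L.*-congˡ p′≈0) ⟩
    ⟦ u ⟧ L.* L.0# L.+ ⟦ v ⟧ L.* L.0#  ≈⟨ L.+-cong (L.zeroʳ _) (L.zeroʳ _) ⟩
    L.0# L.+ L.0#                      ≈⟨ L.+-identityˡ _ ⟩
    L.0#                               ∎)
    where
    open Evaluation {R = K.commutativeRing} L.commutativeRing L.ι-hom r
    open SetoidReasoning L.setoid
    p′ = derivative p

module SimpleExtension (em : ∀ {a : Level} → ExcludedMiddle a) (K : Field c ℓ) (F : Extension K) where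
  private
    module K = Field K
    module F = Extension F
    module K[X] = Polynomial K.commutativeRing
    module F[T] = Polynomial F.commutativeRing
    module K[X]ᴿ = CommutativeRing K[X].polynomialRing
  open Coefficients K.commutativeRing
  open VectorSpace em K F.vectorSpace
  open Exp F.semiring using (_^_)

  powers : F.Carrier → ∀ k → Vector F.Carrier k
  powers x k i = x ^ toℕ i

  evalAt-tabulate : ∀ {k} x (a : Vector K.Carrier k) → F.evalAt x (List.tabulate a) F.≈ comb a
      (powers x k)
  evalAt-tabulate {zero}  x a = F.refl
  evalAt-tabulate {suc k} x a = F.+-cong (F.sym (F.*-identityʳ _)) (begin
    x F.* F.evalAt x (List.tabulate (λ i → a (suc i)))   ≈⟨ F.*-congˡ
        (evalAt-tabulate x (λ i → a (suc i))) ⟩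
    x F.* comb (λ i → a (suc i)) (powers x k)
      ≈⟨ *-distribˡ-sum {k} x (λ i → F.ι (a (suc i)) F.* x ^ toℕ i) ⟩
    sumᴹ (λ i → x F.* (F.ι (a (suc i)) F.* x ^ toℕ i))
      ≈⟨ sumᴹ-cong {k} (λ i → solve 3 (λ x a p → x :* (a :* p) := a :* (x :* p)) F.refl
                               x (F.ι (a (suc i))) (x ^ toℕ i)) ⟩
    comb (λ i → a (suc i)) (λ i → powers x (suc k) (suc i)) ∎)
    where
    open SetoidReasoning F.setoid
    open SemiringSum F.semiring using (*-distribˡ-sum)
    open IntegerSolver F.commutativeRing using (solve; _:=_; _:*_)

  module At (x : F.Carrier) = Evaluation {R = K.commutativeRing} F.commutativeRing F.ι-hom x

  -- An element of degree exactly d over K. Minimality of p appears as independence of 1, θ, ...,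
  -- θ^(d-1), the form that specialisation can preserve.
  record Generator (d : ℕ) : Set (c ⊔ ℓ) where
    field
      θ           : F.Carrier
      p           : K[X].Poly
      lead        : K[X].coeff p d K.≈ K.1#
      above       : VanishesFrom (suc d) p
      root        : F.evalAt θ p F.≈ F.0#
      separable   : K[X].SeparablePolynomial p
      independent : Independent (powers θ d)

    open At θ

    annihilator : ∀ q → VanishesFrom d q → F.evalAt θ q F.≈ F.0# → q K[X].≋ []
    annihilator q v e = K[X].mk≋ coeff≈0
      where
      tab : List.tabulate {n = d} (λ i → K[X].coeff q (toℕ i)) K[X].≋ q
      tab = tabulate-coeff d q v
      coeffs≈0 : ∀ i → K[X].coeff q (toℕ i) K.≈ K.0#
      coeffs≈0 = independent (λ i → K[X].coeff q (toℕ i))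
        (F.trans (F.sym (evalAt-tabulate {d} θ (λ i → K[X].coeff q (toℕ i)))) (F.trans (ev-cong tab) e))
      coeff≈0 : ∀ i → K[X].coeff q i K.≈ K.0#
      coeff≈0 i with i ℕ.<? d
      ... | yes i<d = ≡.subst (λ i → K[X].coeff q i K.≈ K.0#) (Fin.toℕ-fromℕ< i<d)
          (coeffs≈0 (fromℕ< i<d))
      ... | no i≮d  = v i (ℕ.≮⇒≥ i≮d)

    derivative≉0 : ¬ F.evalAt θ (K[X].derivative p) F.≈ F.0#
    derivative≉0 = separable⇒simple F separable θ root

  -- A relation among the powers is a polynomial of degree below d killed by θ, hence a multiple of
  -- the monic p, hence 0.
  generator : IsSeparable F → ∀ θ → ∃[ d ] Σ[ g ∈ Generator d ] Generator.θ g ≡ θ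
  generator sep θ with sep θ
  ... | p , min , separable = d , record
    { θ = θ ; p = p ; lead = proj₁ (proj₂ monic) ; above = proj₂ (proj₂ monic)
    ; root = root ; separable = separable ; independent = independent } , ≡.refl
    where
    open IsMinimalPolynomial min
    open RawMagma (CommutativeRing.*-rawMagma K[X].polynomialRing) using (module _∣ʳ_)
    d = proj₁ monic
    independent : Independent (powers θ d)
    independent a e i = begin
      a i                                 ≈⟨ coeff-tabulate a i ⟨
      K[X].coeff (List.tabulate a) (toℕ i) ≈⟨ K[X].at tab≋[] (toℕ i) ⟩
      K.0#                                ∎
      where
      open SetoidReasoning K.setoid
      divides : ∃[ u ] u K[X].⊛ p K[X].≋ List.tabulate a
      divides = let m = minimal (List.tabulate a) (F.trans (evalAt-tabulate θ a) e) in
        _∣ʳ_.quotient m , _∣ʳ_.equality m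
      u = proj₁ divides
      tab≋[] : List.tabulate a K[X].≋ []
      tab≋[] = K[X]ᴿ.trans (K[X]ᴿ.sym (proj₂ divides)) (K[X].⊛-cong (monic-multiple p
        (proj₁ (proj₂ monic)) (proj₂ (proj₂ monic)) u λ i d≤i →
          K.trans (K[X].at (proj₂ divides) i) (tabulate-vanishes a i d≤i)) (K[X]ᴿ.refl {p}))

  Independent-cong : ∀ {k} {u v : Vector F.Carrier k} →
      (∀ i → u i F.≈ v i) → Independent u → Independent v
  Independent-cong {k} e ind a a≈0 = ind a (F.trans (sumᴹ-cong {k} (λ i → F.*-congˡ (e i))) a≈0)

  -- If powers of θ do not span F, move θ in the direction b = w / p′(θ) for
  -- some w outside their span: then p(θ + b T) = T (w + O(T)), so w stays
  -- independent of the powers of θ + b t for all but finitely many t, and a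
  -- polynomial of degree at most d cannot annihilate θ + b t if t ≠ 0.
  module Enlarge (pac : PAC K) {n} (basis : Basis {K = K} F.vectorSpace n) (sep : IsSeparable F)
                 {d} (d<n : d < n) (g : Generator d) where
    open Generator g
    open Basis basis using (coord)
    open Finite basis
    open Elimination em K using (RowsIndependent; independence-open)
    open PACField em K pac using (nonvanishing)

    w = proj₁ (extend {u = powers θ d} d<n)
    w∉powers = proj₂ (extend {u = powers θ d} d<n)
    1/p′ = F.inverse (F.evalAt θ (K[X].derivative p)) derivative≉0
    b = w F.* proj₁ 1/p′
    open FirstOrder {K = K.commutativeRing} F.commutativeRing F.ι-hom θ b
    module AtF (t : K.Carrier) = Evaluation {R = F.commutativeRing} F.commutativeRing
        (idHom F.commutativeRing) (F.ι t)

    -- p(θ + b T) / T; the division is exact because the constant term is p(θ) = 0.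
    q : F[T].Poly
    q = drop 1 (along p)

    along≋ : along p F[T].≋ F.0# ∷ q
    along≋ = F[T].mk≋ λ
      { zero → F.trans (coeff₀-along p) root
      ; (suc i) → F.reflexive (≡.sym (coeff-drop F.commutativeRing 1 (along p) i)) }

    q₀≈w : F[T].coeff q 0 F.≈ w
    q₀≈w = begin
      F[T].coeff q 0                   ≡⟨ coeff-drop F.commutativeRing 1 (along p) 0 ⟩
      F[T].coeff (along p) 1           ≈⟨ coeff₁-along p ⟩
      w F.* proj₁ 1/p′ F.* p′          ≈⟨ F.*-assoc _ _ _ ⟩
      w F.* (proj₁ 1/p′ F.* p′)        ≈⟨ F.*-congˡ (F.trans (F.*-comm _ _) (proj₂ 1/p′)) ⟩
      w F.* F.1#                       ≈⟨ F.*-identityʳ w ⟩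
      w                                ∎
      where
      open SetoidReasoning F.setoid
      p′ = F.evalAt θ (K[X].derivative p)

    open Exp (CommutativeRing.semiring F[T].polynomialRing) using () renaming (_^_ to _^ᵀ_)

    v : Fin (suc d) → F[T].Poly
    v = q ∷ᵛ (λ j → line ^ᵀ toℕ j)

    -- Coordinates taken coefficientwise give a matrix over K[T]; at T = t it is the coordinate
    -- matrix of the specialised vectors, and at T = 0 these are w, 1, θ, ..., θ^(d-1).
    rows : Fin (suc d) → Fin n → K[X].Poly
    rows j i = List.map (λ x → coord x i) (v j)

    eval-rows : ∀ t f i → K[X].eval t (List.map (λ x → coord x i) f) K.≈ coord (AtF.⟦_⟧ t f) i
    eval-rows t []      i = K.sym (coord-0 i)
    eval-rows t (x ∷ f) i = K.sym (K.trans (coord-+ basis _ _ i)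
      (K.+-congˡ (K.trans (coord-* basis t _ i) (K.*-congˡ (K.sym (eval-rows t f i))))))

    rows-cong : ∀ {k} {u v : Fin k → Fin n → K.Carrier} → (∀ j i → u j i K.≈ v j i) →
                RowsIndependent u → RowsIndependent v
    rows-cong {k} e ind x x≈0 = ind x λ i →
      K.trans (sum-cong-≋ {k} λ j → K.*-congˡ (e j i)) (x≈0 i)
      where open SemiringSum K.semiring using (sum-cong-≋)

    at-0 : ∀ f → AtF.⟦_⟧ K.0# f F.≈ F[T].coeff f 0
    at-0 []      = F.refl
    at-0 (x ∷ f) = F.trans (F.+-congˡ (F.trans (F.*-congʳ F.0#-homo) (F.zeroˡ _))) (F.+-identityʳ x)

    powers-line : ∀ t j → AtF.⟦_⟧ t (line ^ᵀ j) F.≈ AtF.⟦_⟧ t line ^ j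
    powers-line t j = ^-homo F[T].polynomialRing F.commutativeRing (AtF.ev-hom t) line j

    independent-at-0 : RowsIndependent (λ j i → K[X].eval K.0# (rows j i))
    independent-at-0 = rows-cong (λ j i → K.sym (eval-rows K.0# (v j) i))
      (rows-independent {u = λ j → AtF.⟦_⟧ K.0# (v j)}
        (Independent-cong specialised (independent-∷ independent w∉powers)))
      where
      open Exp F.semiring using (^-congˡ)
      specialised : ∀ j → (w ∷ᵛ powers θ d) j F.≈ AtF.⟦_⟧ K.0# (v j)
      specialised zero    = F.sym (F.trans (at-0 q) q₀≈w)
      specialised (suc j) = F.sym (F.trans (powers-line K.0# (toℕ j)) (^-congˡ (toℕ j) (at-0 line)))

    -- The product T P is a nonzero polynomial since P(0) is not 0; a non-root t of it secures both
    -- t ≠ 0 and P(t) ≠ 0.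
    nearby : ∃[ t ] (¬ t K.≈ K.0# × RowsIndependent (λ j i → K[X].eval t (rows j i)))
    nearby = t , (λ t≈0 → proj₂ good (K.trans (At′.ev-shift P) (K.trans (K.*-congʳ t≈0) (K.zeroˡ _)))) ,
      proj₂ (proj₂ (proj₂ minor)) (K[X].eval t) At′.ev-hom
        (λ P≈0 → proj₂ good (K.trans (At′.ev-shift P) (K.trans (K.*-congˡ P≈0) (K.zeroʳ _))))
      where
      module Eval (t : K.Carrier) = Evaluation {R = K.commutativeRing} K.commutativeRing
          (idHom K.commutativeRing) t
      minor = independence-open K[X].polynomialRing (suc d) n rows (K[X].eval K.0#)
          (Eval.ev-hom K.0#) independent-at-0
      P = proj₁ (proj₂ minor)
      good = nonvanishing (K[X].shift P) λ shiftP≋[] →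
        proj₁ (proj₂ (proj₂ minor)) (Eval.ev-0 K.0# P (K[X].mk≋ λ i → K[X].at shiftP≋[] (suc i)))
      t = proj₁ good
      module At′ = Eval t

    t = proj₁ nearby
    open AtF t using (ev-C; ev-cong; ev-hom) renaming (⟦_⟧ to atF)

    θ′ = atF line

    independent′ : Independent (atF q ∷ᵛ powers θ′ d)
    independent′ = Independent-cong {u = λ j → atF (v j)} {v = atF q ∷ᵛ powers θ′ d}
        (λ { zero → F.refl ; (suc j) → powers-line t (toℕ j) })
      (independent-from-rows {u = λ j → atF (v j)}
        (rows-cong (λ j i → eval-rows t (v j) i) (proj₂ (proj₂ nearby))))

    p[θ′] : F.evalAt θ′ p F.≈ F.ι t F.* atF q
    p[θ′] = begin
      F.evalAt θ′ p
        ≈⟨ eval₂-homo K.commutativeRing {S = F[T].polynomialRing} {T = F.commutativeRing}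
                                    ev-hom (λ a → ev-C (F.ι a)) line p ⟨
      atF (along p)            ≈⟨ ev-cong along≋ ⟩
      F.0# F.+ F.ι t F.* atF q ≈⟨ F.+-identityˡ _ ⟩
      F.ι t F.* atF q          ∎
      where open SetoidReasoning F.setoid

    -- Let s be the coefficient of r in degree d. Then r - s p has degree below d and value - s t
    -- q(t) at θ′, which is a relation between q(t) and the powers of θ′. Independence gives s t =
    -- 0, so s = 0, and r - s p = 0.
    no-annihilator : ∀ r → VanishesFrom (suc d) r → F.evalAt θ′ r F.≈ F.0# → r K[X].≋ []
    no-annihilator r r-above r≈0 = begin
      r
        ≈⟨ solve 2 (λ r x → r := (r :+ x) :- x) K[X]ᴿ.refl r (K.- s K[X].· p) ⟩
      (r K[X].⊕ K.- s K[X].· p) K[X]ᴿ.- (K.- s K[X].· p)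
        ≈⟨ K[X]ᴿ.+-cong r′≋[] (K[X].⊖-cong (K[X].·-cong -s≈0 (K[X]ᴿ.refl {p}))) ⟩
      K[X].⊖ (K.0# K[X].· p)                       ≈⟨ K[X].⊖-cong (K[X].·-zeroˡ p) ⟩
      []                                           ∎
      where
      open SetoidReasoning K[X]ᴿ.setoid
      open IntegerSolver K[X].polynomialRing using (solve; _:=_; _:+_; _:-_)
      module Kₛ = IntegerSolver K.commutativeRing
      module Fₛ = IntegerSolver F.commutativeRing
      s = K[X].coeff r d
      r′ = r K[X].⊕ K.- s K[X].· p
      coeff-r′ : ∀ i → K[X].coeff r′ i K.≈ K[X].coeff r i K.+ K.- s K.* K[X].coeff p i
      coeff-r′ i = K.trans (K[X].coeff-⊕ r (K.- s K[X].· p) i) (K.+-congˡ (K[X].coeff-· (K.- s) p i))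
      r′-above : VanishesFrom d r′
      r′-above i d≤i = Sum.[ beyond , (λ { ≡.refl → top }) ]′ (ℕ.m≤n⇒m<n∨m≡n d≤i)
        where
        beyond : d < i → K[X].coeff r′ i K.≈ K.0#
        beyond d<i = K.trans (coeff-r′ i) (K.trans (K.+-cong (r-above i d<i) (K.*-congˡ (above i d<i)))
          (Kₛ.solve 1 (λ s → Kₛ.con (+ 0) Kₛ.:+ Kₛ.:- s Kₛ.:* Kₛ.con (+ 0) Kₛ.:= Kₛ.con (+ 0)) K.refl s))
        top : K[X].coeff r′ d K.≈ K.0#
        top = K.trans (coeff-r′ d) (K.trans (K.+-congˡ (K.*-congˡ lead))
          (Kₛ.solve 1 (λ s → s Kₛ.:+ Kₛ.:- s Kₛ.:* Kₛ.con (+ 1) Kₛ.:= Kₛ.con (+ 0)) K.refl s))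
      tab : List.tabulate {n = d} (λ i → K[X].coeff r′ (toℕ i)) K[X].≋ r′
      tab = tabulate-coeff d r′ r′-above
      relation : comb ((s K.* t) ∷ᵛ (λ i → K[X].coeff r′ (toℕ i))) (atF q ∷ᵛ powers θ′ d) F.≈ F.0#
      relation = F.trans (F.+-cong (F.*-congʳ (F.*-homo s t))
          (F.trans (F.sym (evalAt-tabulate {d} θ′ (λ i → K[X].coeff r′ (toℕ i))))
          (F.trans (At.ev-cong θ′ tab) (F.trans (At.ev-⊕ θ′ r (K.- s K[X].· p))
          (F.+-cong r≈0 (F.trans (At.ev-· θ′ (K.- s) p) (F.*-cong (F.-‿homo s) p[θ′])))))))
        (Fₛ.solve 3 (λ s t q → s Fₛ.:* t Fₛ.:* q Fₛ.:+ (Fₛ.con (+ 0) Fₛ.:+ Fₛ.:- s Fₛ.:* (t Fₛ.:* q))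
          Fₛ.:= Fₛ.con (+ 0)) F.refl (F.ι s) (F.ι t) (atF q))
      trivial = independent′ ((s K.* t) ∷ᵛ (λ i → K[X].coeff r′ (toℕ i))) relation
      -s≈0 : K.- s K.≈ K.0#
      -s≈0 = K.trans (K.-‿cong (integral-≉0 K.commutativeRing (field-integral em K)
          (proj₁ (proj₂ nearby))
        (K.trans (K.*-comm t s) (trivial zero))))
            (Kₛ.solve 0 (Kₛ.:- Kₛ.con (+ 0) Kₛ.:= Kₛ.con (+ 0)) K.refl)
      r′≋[] : r′ K[X].≋ []
      r′≋[] = K[X]ᴿ.trans (K[X]ᴿ.sym tab) (K[X].mk≋ λ i → tab≈0 _ (λ i → trivial (suc i)) i)
        where
        tab≈0 : ∀ {k} (a : Vector K.Carrier k) →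
            (∀ i → a i K.≈ K.0#) → ∀ i → K[X].coeff (List.tabulate a) i K.≈ K.0#
        tab≈0 {zero}  a a≈0 i       = K.refl
        tab≈0 {suc k} a a≈0 zero    = a≈0 zero
        tab≈0 {suc k} a a≈0 (suc i) = tab≈0 (λ i → a (suc i)) (λ i → a≈0 (suc i)) i

    enlarged : ∃[ d′ ] (d < d′ × Generator d′)
    -- The minimal polynomial of `θ′` is monic, so a degree of at most d would contradict
    -- `no-annihilator`.
    enlarged = d′ , ℕ.≰⇒> (λ d′≤d → K.1≉0 (K.trans (K.sym lead′) (K[X].at
        (no-annihilator p′ (λ i d<i → above′ i (ℕ.≤-trans (s≤s d′≤d) d<i))
          (≡.subst (λ θ → F.evalAt θ p′ F.≈ F.0#) θ≡ root′)) d′))) , g′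
      where
      found = generator sep θ′
      d′ = proj₁ found
      g′ = proj₁ (proj₂ found)
      θ≡ = proj₂ (proj₂ found)
      open Generator g′ using () renaming (p to p′; lead to lead′; above to above′; root to root′)

  -- Independence of powers bounds the degree by n, and every enlargement raises it. The counter k
  -- with n ≤ d + k makes the recursion structural; it may start from any element, here 0.
  primitive-element : PAC K → ∀ {n} → Basis {K = K} F.vectorSpace n → IsSeparable F → Generator n
  primitive-element pac {n} basis sep = climb n (proj₁ (proj₂ (generator sep F.0#))) (ℕ.m≤n+m n _)
    where
    open Finite basis
    climb : ∀ k {d} (g : Generator d) → n ≤ d ℕ.+ k → Generator n
    climb k {d} g n≤d+k with ℕ.m≤n⇒m<n∨m≡n (independent⇒≤dim (Generator.independent g))
    ... | inj₂ ≡.refl = g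
    climb zero    {d} g n≤d | inj₁ d<n =
      contradiction (ℕ.≤-trans n≤d (ℕ.≤-reflexive (ℕ.+-identityʳ d))) (ℕ.<⇒≱ d<n)
    climb (suc k) {d} g n≤d+k | inj₁ d<n =
      climb k (proj₂ (proj₂ bigger)) (ℕ.≤-trans n≤d+k (ℕ.≤-trans (ℕ.≤-reflexive (ℕ.+-suc d k))
        (ℕ.+-monoˡ-≤ k (proj₁ (proj₂ bigger)))))
      where bigger = Enlarge.enlarged pac basis sep d<n g

-- The power basis and Euler's formula for the trace

module PowerBasis (em : ∀ {a : Level} → ExcludedMiddle a) (K : Field c ℓ) (F : Extension K)
  {N : ℕ} (basis : Basis {K = K} (Extension.vectorSpace F) (suc N))
  (g : SimpleExtension.Generator em K F (suc N)) where
  private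
    module K = Field K
    module F = Extension F
    module K[X] = Polynomial K.commutativeRing
    module KSum = SemiringSum K.semiring
    module Kₛ = IntegerSolver K.commutativeRing
    module Fₛ = IntegerSolver F.commutativeRing
  open SimpleExtension em K F
  open Generator g
  open Coefficients K.commutativeRing
  open VectorSpace em K F.vectorSpace
  open Exp F.semiring using (_^_)
  open At θ

  powerBasis : Basis {K = K} F.vectorSpace (suc N)
  powerBasis = Finite.independent⇒basis basis {u = powers θ (suc N)} independent

  open Basis powerBasis using (coord; spanning)

  rep : F.Carrier → K[X].Poly
  rep z = List.tabulate (coord z)

  eval-rep : ∀ z → ⟦ rep z ⟧ F.≈ z
  eval-rep z = F.trans (evalAt-tabulate θ (coord z)) (F.sym (spanning z))

  -- Coordinates indexed by all natural numbers, zero beyond N, so that multiplication by θ can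
  -- shift the index freely.
  coord∞ : F.Carrier → ℕ → K.Carrier
  coord∞ z i = K[X].coeff (rep z) i

  coord∞-vanishes : ∀ z i → suc N ≤ i → coord∞ z i K.≈ K.0#
  coord∞-vanishes z = tabulate-vanishes (coord z)

  coord∞-unique : ∀ q {z} → VanishesFrom (suc N) q → ⟦ q ⟧ F.≈ z → ∀ i → coord∞ z i K.≈ K[X].coeff q i
  coord∞-unique q {z} v e i = x∙y⁻¹≈ε⇒x≈y _ _ (K.trans
    (K.+-congˡ (K.sym (K[X].coeff-⊖ q i)))
    (K.trans (K.sym (K[X].coeff-⊕ (rep z) (K[X].⊖ q) i)) (K[X].at difference≋[] i)))
    where
    open GroupProperties K.+-group using (x∙y⁻¹≈ε⇒x≈y)
    difference = rep z K[X].⊕ (K[X].⊖ q)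
    difference≋[] : difference K[X].≋ []
    difference≋[] = annihilator difference
      (λ i n≤i → K.trans (K[X].coeff-⊕ (rep z) (K[X].⊖ q) i) (K.trans
        (K.+-cong (coord∞-vanishes z i n≤i) (K.trans (K[X].coeff-⊖ q i) (K.-‿cong (v i n≤i))))
        (K.-‿inverseʳ K.0#)))
      (F.trans (ev-⊕ (rep z) (K[X].⊖ q)) (F.trans
        (F.+-cong (eval-rep z) (F.trans (ev-⊖ q) (F.-‿cong e)))
        (F.-‿inverseʳ z)))

  s : F.Carrier → K.Carrier
  s z = coord∞ z N

  s-cong : ∀ {x y} → x F.≈ y → s x K.≈ s y
  s-cong {x} {y} e = coord∞-unique (rep y) (coord∞-vanishes y) (F.trans (eval-rep y) (F.sym e)) N

  s-+ : ∀ x y → s (x F.+ y) K.≈ s x K.+ s y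
  s-+ x y = K.trans (coord∞-unique (rep x K[X].⊕ rep y)
    (λ i n≤i → K.trans (K[X].coeff-⊕ (rep x) (rep y) i) (K.trans
      (K.+-cong (coord∞-vanishes x i n≤i) (coord∞-vanishes y i n≤i)) (K.+-identityˡ _)))
    (F.trans (ev-⊕ (rep x) (rep y)) (F.+-cong (eval-rep x) (eval-rep y))) N)
    (K[X].coeff-⊕ (rep x) (rep y) N)

  s-* : ∀ a x → s (F.ι a F.* x) K.≈ a K.* s x
  s-* a x = K.trans (coord∞-unique (a K[X].· rep x)
    (λ i n≤i → K.trans (K[X].coeff-· a (rep x) i) (K.trans
      (K.*-congˡ (coord∞-vanishes x i n≤i)) (K.zeroʳ a)))
    (F.trans (ev-· a (rep x)) (F.*-congˡ (eval-rep x))) N)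
    (K[X].coeff-· a (rep x) N)

  s-0 : s F.0# K.≈ K.0#
  s-0 = coord∞-unique [] (λ _ _ → K.refl) F.refl N

  s-sum : ∀ {k} (f : Vector F.Carrier k) → s (sumᴹ f) K.≈ KSum.sum (λ i → s (f i))
  s-sum {zero}  f = s-0
  s-sum {suc k} f = K.trans (s-+ (f zero) _) (K.+-congˡ (s-sum (λ i → f (suc i))))

  -- The companion matrix of p: multiplication by θ shifts the coordinates, and the overflow s(z)
  -- θ^(N+1) is removed by subtracting s(z) p.
  coord∞-θ : ∀ z i → coord∞ (θ F.* z) (suc i) K.≈ coord∞ z i K.+ K.- s z K.* K[X].coeff p (suc i)
  coord∞-θ z i = K.trans (coord∞-unique q vanishes evaluates (suc i)) (coeff-q i)
    where
    q = K[X].shift (rep z) K[X].⊕ K.- s z K[X].· p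
    coeff-q : ∀ i → K[X].coeff q (suc i) K.≈ coord∞ z i K.+ K.- s z K.* K[X].coeff p (suc i)
    coeff-q i = K.trans (K[X].coeff-⊕ (K[X].shift (rep z)) (K.- s z K[X].· p) (suc i))
      (K.+-congˡ (K[X].coeff-· (K.- s z) p (suc i)))
    vanishes : VanishesFrom (suc N) q
    vanishes (suc i) (s≤s N≤i) = K.trans (coeff-q i)
      (Sum.[ beyond , (λ { ≡.refl → top }) ]′ (ℕ.m≤n⇒m<n∨m≡n N≤i))
      where
      beyond : N ℕ.< i → coord∞ z i K.+ K.- s z K.* K[X].coeff p (suc i) K.≈ K.0#
      beyond N<i = K.trans (K.+-cong (coord∞-vanishes z i N<i) (K.*-congˡ (above (suc i) (s≤s N<i))))
        (Kₛ.solve 1 (λ s → Kₛ.con (+ 0) Kₛ.:+ Kₛ.:- s Kₛ.:* Kₛ.con (+ 0) Kₛ.:= Kₛ.con (+ 0)) K.refl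
            (s z))
      top : s z K.+ K.- s z K.* K[X].coeff p (suc N) K.≈ K.0#
      top = K.trans (K.+-congˡ (K.*-congˡ lead))
        (Kₛ.solve 1 (λ s → s Kₛ.:+ Kₛ.:- s Kₛ.:* Kₛ.con (+ 1) Kₛ.:= Kₛ.con (+ 0)) K.refl (s z))
    evaluates : ⟦ q ⟧ F.≈ θ F.* z
    evaluates = begin
      ⟦ q ⟧                                        ≈⟨ ev-⊕ (K[X].shift (rep z)) (K.- s z K[X].· p) ⟩
      ⟦ K[X].shift (rep z) ⟧ F.+ ⟦ K.- s z K[X].· p ⟧
        ≈⟨ F.+-cong (F.trans (ev-shift (rep z)) (F.*-congˡ (eval-rep z))) (ev-· (K.- s z) p) ⟩
      θ F.* z F.+ F.ι (K.- s z) F.* ⟦ p ⟧          ≈⟨ F.+-congˡ (F.trans (F.*-congˡ root) (F.zeroʳ _)) ⟩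
      θ F.* z F.+ F.0#                             ≈⟨ F.+-identityʳ _ ⟩
      θ F.* z                                      ∎
      where open SetoidReasoning F.setoid

  -- The Horner suffixes of p, evaluated at θ, are dual to the powers of θ
  -- with respect to (x , y) ↦ s (x y).
  coord∞-dual : ∀ l i → (∀ j → K[X].coeff l j K.≈ K[X].coeff p (suc i ℕ.+ j)) →
                ∀ z → coord∞ z i K.≈ s (⟦ l ⟧ F.* z)
  coord∞-dual [] i e z = K.trans (coord∞-vanishes z i (ℕ.≮⇒≥ λ i≤N → K.1≉0 (begin
      K.1#                                        ≈⟨ lead ⟨
      K[X].coeff p (suc N)                        ≡⟨ cong (K[X].coeff p) (ℕ.m+[n∸m]≡n i≤N) ⟨
      K[X].coeff p (suc i ℕ.+ (suc N ℕ.∸ suc i))  ≈⟨ e (suc N ℕ.∸ suc i) ⟨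
      K.0#                                        ∎)))
    (K.sym (K.trans (s-cong (F.zeroˡ z)) s-0))
    where open SetoidReasoning K.setoid
  coord∞-dual (a ∷ l) i e z = begin
    coord∞ z i
      ≈⟨ Kₛ.solve 2 (λ c t → c Kₛ.:= (c Kₛ.:- t) Kₛ.:+ t) K.refl (coord∞ z i) (s z K.* pᵢ) ⟩
    coord∞ z i K.- s z K.* pᵢ K.+ s z K.* pᵢ
      ≈⟨ K.+-congʳ (Kₛ.solve 3 (λ c s p → c Kₛ.:- s Kₛ.:* p Kₛ.:= c Kₛ.:+ Kₛ.:- s Kₛ.:* p) K.refl
          (coord∞ z i) (s z) pᵢ) ⟩
    coord∞ z i K.+ K.- s z K.* pᵢ K.+ s z K.* pᵢ
      ≈⟨ K.+-cong (K.sym (coord∞-θ z i))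
          (K.trans (K.*-comm _ _) (K.*-congʳ
          (K.sym (K.trans (e 0) (K.reflexive (cong (K[X].coeff p) (ℕ.+-identityʳ (suc i)))))))) ⟩
    coord∞ (θ F.* z) (suc i) K.+ a K.* s z
      ≈⟨ K.+-congʳ (coord∞-dual l (suc i)
          (λ j → K.trans (e (suc j)) (K.reflexive (cong (K[X].coeff p) (ℕ.+-suc (suc i) j))))
          (θ F.* z)) ⟩
    s (⟦ l ⟧ F.* (θ F.* z)) K.+ a K.* s z
      ≈⟨ K.trans (K.+-congˡ (K.sym (s-* a z))) (K.sym (s-+ _ _)) ⟩
    s (⟦ l ⟧ F.* (θ F.* z) F.+ F.ι a F.* z)
      ≈⟨ s-cong (Fₛ.solve 4 (λ l t z a → l Fₛ.:* (t Fₛ.:* z) Fₛ.:+ a Fₛ.:* z Fₛ.:=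
          (a Fₛ.:+ t Fₛ.:* l) Fₛ.:* z)
           F.refl ⟦ l ⟧ θ z (F.ι a)) ⟩
    s (⟦ a ∷ l ⟧ F.* z) ∎
    where
    open SetoidReasoning K.setoid
    pᵢ = K[X].coeff p (suc i)

  -- The suffix values are the coefficients of (q(X) - q(θ)) / (X - θ), and the sum is the value of
  -- this difference quotient at X = θ.
  suffix-sum : ∀ k q → VanishesFrom (suc k) q →
               sumᴹ {k} (λ i → θ ^ toℕ i F.* ⟦ drop (suc (toℕ i)) q ⟧) F.≈ ⟦ K[X].derivative q ⟧
  suffix-sum k       []      v = F.trans (sumᴹ-cong {k} (λ i → F.zeroʳ (θ ^ toℕ i))) (sumᴹ-0 k)
  suffix-sum zero    (a ∷ q) v = F.sym (begin
    ⟦ q K[X].⊕ K[X].shift (K[X].derivative q) ⟧     ≈⟨ ev-⊕ q (K[X].shift (K[X].derivative q)) ⟩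
    ⟦ q ⟧ F.+ ⟦ K[X].shift (K[X].derivative q) ⟧
      ≈⟨ F.+-cong (ev-0 q (K[X].mk≋ λ i → v (suc i) (s≤s z≤n))) (F.trans (ev-shift (K[X].derivative q))
           (F.*-congˡ (F.sym (suffix-sum zero q λ i _ → v (suc i) (s≤s z≤n))))) ⟩
    F.0# F.+ θ F.* F.0#                             ≈⟨ F.trans (F.+-identityˡ _) (F.zeroʳ θ) ⟩
    F.0#                                            ∎)
    where open SetoidReasoning F.setoid
  suffix-sum (suc k) (a ∷ q) v = begin
    F.1# F.* ⟦ q ⟧ F.+ sumᴹ {k} (λ i → θ F.* θ ^ toℕ i F.* ⟦ drop (suc (toℕ i)) q ⟧)
      ≈⟨ F.+-cong (F.*-identityˡ _) (F.trans (sumᴹ-cong {k} (λ i → F.*-assoc _ _ _))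
           (F.sym (*-distribˡ-sum {k} θ (λ i → θ ^ toℕ i F.* ⟦ drop (suc (toℕ i)) q ⟧)))) ⟩
    ⟦ q ⟧ F.+ θ F.* sumᴹ {k} (λ i → θ ^ toℕ i F.* ⟦ drop (suc (toℕ i)) q ⟧)
      ≈⟨ F.+-congˡ (F.*-congˡ (suffix-sum k q λ i k<i → v (suc i) (s≤s k<i))) ⟩
    ⟦ q ⟧ F.+ θ F.* ⟦ K[X].derivative q ⟧           ≈⟨ F.+-congˡ (ev-shift (K[X].derivative q)) ⟨
    ⟦ q ⟧ F.+ ⟦ K[X].shift (K[X].derivative q) ⟧    ≈⟨ ev-⊕ q (K[X].shift (K[X].derivative q)) ⟨
    ⟦ K[X].derivative (a ∷ q) ⟧                     ∎
    where
    open SetoidReasoning F.setoid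
    open SemiringSum F.semiring using (*-distribˡ-sum)

  -- By duality the i-th diagonal entry of multiplication by a is s of a θ^i times the i-th suffix
  -- of p; summed over i, these products add up to a p′(θ).
  euler : ∀ a → Tr F powerBasis a K.≈ s (a F.* ⟦ K[X].derivative p ⟧)
  euler a = begin
    sum {suc N} (λ i → coord (a F.* θ ^ toℕ i) i)
      ≈⟨ sum-cong-≋ {suc N} (λ i → K.trans (K.sym (coeff-tabulate (coord (a F.* θ ^ toℕ i)) i))
           (coord∞-dual (drop (suc (toℕ i)) p) (toℕ i)
             (λ j → K.reflexive (coeff-drop K.commutativeRing (suc (toℕ i)) p j)) (a F.* θ ^ toℕ i))) ⟩
    sum {suc N} (λ i → s (⟦ drop (suc (toℕ i)) p ⟧ F.* (a F.* θ ^ toℕ i)))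
      ≈⟨ sum-cong-≋ {suc N} (λ i → s-cong
          (Fₛ.solve 3 (λ d a t → d Fₛ.:* (a Fₛ.:* t) Fₛ.:= a Fₛ.:* (t Fₛ.:* d))
           F.refl ⟦ drop (suc (toℕ i)) p ⟧ a (θ ^ toℕ i))) ⟩
    sum {suc N} (λ i → s (a F.* (θ ^ toℕ i F.* ⟦ drop (suc (toℕ i)) p ⟧)))
      ≈⟨ s-sum {suc N} (λ i → a F.* (θ ^ toℕ i F.* ⟦ drop (suc (toℕ i)) p ⟧)) ⟨
    s (sumᴹ {suc N} (λ i → a F.* (θ ^ toℕ i F.* ⟦ drop (suc (toℕ i)) p ⟧)))
      ≈⟨ s-cong (*-distribˡ-sum {suc N} a (λ i → θ ^ toℕ i F.* ⟦ drop (suc (toℕ i)) p ⟧)) ⟨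
    s (a F.* sumᴹ {suc N} (λ i → θ ^ toℕ i F.* ⟦ drop (suc (toℕ i)) p ⟧))
      ≈⟨ s-cong (F.*-congˡ (suffix-sum (suc N) p above)) ⟩
    s (a F.* ⟦ K[X].derivative p ⟧) ∎
    where
    open SetoidReasoning K.setoid
    open SemiringSum K.semiring using (sum; sum-cong-≋)
    open SemiringSum F.semiring using (*-distribˡ-sum)

-- Orthogonal systems for symmetric bilinear forms

module _ (K : Field c ℓ) (V : LeftModule (Field.ring K) m ℓm) where
  open Field K hiding (zero)
  open LeftModule V

  record SymmetricBilinear : Set (c ⊔ ℓ ⊔ m ⊔ ℓm) where
    field
      β      : Carrierᴹ → Carrierᴹ → Carrier
      β-cong : ∀ {x x′ y y′} → x ≈ᴹ x′ → y ≈ᴹ y′ → β x y ≈ β x′ y′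
      β-sym  : ∀ x y → β x y ≈ β y x
      β-+ˡ   : ∀ x y z → β (x +ᴹ y) z ≈ β x z + β y z
      β-*ˡ   : ∀ a x y → β (a *ₗ x) y ≈ a * β x y

-- a₀, …, a_{N-1}, d
_∷ʳ⟨_⟩_ : {A : Set c} → (ℕ → A) → (N : ℕ) → A → Vector A (suc N)
(a ∷ʳ⟨ zero ⟩ d)  = λ _ → d
(a ∷ʳ⟨ suc N ⟩ d) = a 0 ∷ᵛ ((λ i → a (suc i)) ∷ʳ⟨ N ⟩ d)

module Alternating (R : CommutativeRing c ℓ) where
  open CommutativeRing R hiding (zero)

  signs : ℕ → Carrier
  signs zero          = 1#
  signs (suc zero)    = - 1#
  signs (suc (suc k)) = signs k

module Orthogonal (em : ∀ {a : Level} → ExcludedMiddle a) (K : Field c ℓ)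
  (V : LeftModule (Field.ring K) m ℓm) (form : SymmetricBilinear K V) where
  open Field K hiding (zero)
  open LeftModule V
  open VectorSpace em K V
  open SymmetricBilinear form
  open SemiringSum semiring using (sum; sum-cong-≋; sum-replicate-zero)
  open IntegerSolver commutativeRing using (solve; _:=_; _:+_; _:*_; _:-_; :-_; con)

  private integral = field-integral em K

  β-+ʳ : ∀ x y z → β x (y +ᴹ z) ≈ β x y + β x z
  β-+ʳ x y z = trans (β-sym x _) (trans (β-+ˡ y z x) (+-cong (β-sym y x) (β-sym z x)))

  β-*ʳ : ∀ a x y → β x (a *ₗ y) ≈ a * β x y
  β-*ʳ a x y = trans (β-sym x _) (trans (β-*ˡ a y x) (*-congˡ (β-sym y x)))

  β-0ˡ : ∀ x → β 0ᴹ x ≈ 0#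
  β-0ˡ x = trans (β-cong (≈ᴹ-sym (*ₗ-zeroˡ 0ᴹ)) ≈ᴹ-refl) (trans (β-*ˡ 0# 0ᴹ x) (zeroˡ _))

  β-linearˡ : ∀ a x b y z → β (a *ₗ x +ᴹ b *ₗ y) z ≈ a * β x z + b * β y z
  β-linearˡ a x b y z = trans (β-+ˡ _ _ z) (+-cong (β-*ˡ a x z) (β-*ˡ b y z))

  β-linearʳ : ∀ z a x b y → β z (a *ₗ x +ᴹ b *ₗ y) ≈ a * β z x + b * β z y
  β-linearʳ z a x b y = trans (β-+ʳ z _ _) (+-cong (β-*ʳ a z x) (β-*ʳ b z y))

  β-combˡ : ∀ {k} (a : Vector Carrier k) u z → β (comb a u) z ≈ sum (λ i → a i * β (u i) z)
  β-combˡ {zero}  a u z = β-0ˡ z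
  β-combˡ {suc k} a u z = trans (β-+ˡ _ _ z)
    (+-cong (β-*ˡ (a zero) (u zero) z) (β-combˡ (λ i → a (suc i)) (λ i → u (suc i)) z))

  infix 4 _⟂_
  _⟂_ : ∀ {k} → Carrierᴹ → Vector Carrierᴹ k → Set ℓ
  z ⟂ u = ∀ i → β z (u i) ≈ 0#

  ⟂-comb : ∀ {k} z (u : Vector Carrierᴹ k) → z ⟂ u → ∀ a → β z (comb a u) ≈ 0#
  ⟂-comb {k} z u z⟂u a = trans (β-sym z _) (trans (β-combˡ a u z)
    (trans (sum-cong-≋ {k} λ i → trans (*-congˡ (trans (β-sym (u i) z) (z⟂u i))) (zeroʳ (a i)))
           (sum-replicate-zero k)))

  record System {k} (a : Vector Carrier k) : Set (c ⊔ ℓ ⊔ m ⊔ ℓm) where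
    field
      vector     : Vector Carrierᴹ k
      norm       : ∀ i → β (vector i) (vector i) ≈ a i
      orthogonal : ∀ i j → ¬ i ≡ j → β (vector i) (vector j) ≈ 0#
  open System public

  cons : ∀ {k x} {a : Vector Carrier k} z → β z z ≈ x → (S : System a) → z ⟂ vector S → System (x ∷ᵛ a)
  vector     (cons z e S z⟂S) = z ∷ᵛ vector S
  norm       (cons z e S z⟂S) zero    = e
  norm       (cons z e S z⟂S) (suc i) = norm S i
  orthogonal (cons z e S z⟂S) zero    zero    i≢j = contradiction ≡.refl i≢j
  orthogonal (cons z e S z⟂S) zero    (suc j) i≢j = z⟂S j
  orthogonal (cons z e S z⟂S) (suc i) zero    i≢j = trans (β-sym _ z) (z⟂S i)
  orthogonal (cons z e S z⟂S) (suc i) (suc j) i≢j = orthogonal S i j (λ i≡j → i≢j (cong suc i≡j))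

  rest : ∀ {k} {a : Vector Carrier (suc k)} → System a → System (λ i → a (suc i))
  vector     (rest S) i = vector S (suc i)
  norm       (rest S) i = norm S (suc i)
  orthogonal (rest S) i j i≢j = orthogonal S (suc i) (suc j) λ { ≡.refl → i≢j ≡.refl }

  sum-single : ∀ {k} (f : Vector Carrier k) j → (∀ i → ¬ i ≡ j → f i ≈ 0#) → sum f ≈ f j
  sum-single {suc k} f zero    e = trans (+-congˡ (trans (sum-cong-≋ {k} λ i → e (suc i) λ ())
    (sum-replicate-zero k))) (+-identityʳ _)
  sum-single {suc k} f (suc j) e = trans (+-congʳ (e zero λ ())) (trans (+-identityˡ _)
    (sum-single (λ i → f (suc i)) j λ i i≢j → e (suc i) λ { ≡.refl → i≢j ≡.refl }))

  module _ {k} {a : Vector Carrier k} (S : System a) where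

    β-coeff : ∀ x j → β (comb x (vector S)) (vector S j) ≈ x j * a j
    β-coeff x j = trans (β-combˡ x (vector S) (vector S j)) (trans
      (sum-single _ j λ i i≢j → trans (*-congˡ (orthogonal S i j i≢j)) (zeroʳ _))
      (*-congˡ (norm S j)))

    β-diagonal : ∀ x → β (comb x (vector S)) (comb x (vector S)) ≈ sum (λ i → x i * (x i * a i))
    β-diagonal x = trans (β-combˡ x (vector S) _)
      (sum-cong-≋ {k} λ i → *-congˡ (trans (β-sym (vector S i) _) (β-coeff x i)))

    system-independent : (∀ i → ¬ a i ≈ 0#) → Independent (vector S)
    system-independent a≉0 x e j = integral-≉0 commutativeRing integral (a≉0 j)
      (trans (*-comm _ _) (trans (sym (β-coeff x j)) (trans (β-cong e ≈ᴹ-refl) (β-0ˡ _))))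

  module Diagonalisation (2≉0 : Characteristic≢2 K) {n} (basis : Basis {K = K} V n)
    (nonDegenerate : ∀ x → (∀ y → β x y ≈ 0#) → x ≈ᴹ 0ᴹ) where
    open Finite basis

    module _ {k} {a : Vector Carrier k} (a≉0 : ∀ i → ¬ a i ≈ 0#) (S : System a) where
      open SetoidReasoning setoid
      u = vector S

      coefficient : Carrierᴹ → Vector Carrier k
      coefficient y i = - (β y (u i) * proj₁ (inverse (a i) (a≉0 i)))

      project : Carrierᴹ → Carrierᴹ
      project y = y +ᴹ comb (coefficient y) u

      project-⟂ : ∀ y → project y ⟂ u
      project-⟂ y i = begin
        β (project y) (u i)                        ≈⟨ β-+ˡ y _ (u i) ⟩
        β y (u i) + β (comb (coefficient y) u) (u i) ≈⟨ +-congˡ (β-coeff S (coefficient y) i) ⟩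
        β y (u i) + - (β y (u i) * 1/a) * a i
          ≈⟨ solve 3 (λ b y a → b :+ :- (b :* y) :* a := b :- b :* (a :* y)) refl (β y (u i)) 1/a (a i) ⟩
        β y (u i) - β y (u i) * (a i * 1/a)
          ≈⟨ +-congˡ (-‿cong (*-congˡ (proj₂ (inverse (a i) (a≉0 i))))) ⟩
        β y (u i) - β y (u i) * 1#
          ≈⟨ solve 1 (λ b → b :- b :* con (+ 1) := con (+ 0)) refl (β y (u i)) ⟩
        0#                                         ∎
        where 1/a = proj₁ (inverse (a i) (a≉0 i))

      -- If all vectors orthogonal to u were isotropic, polarisation (2 ≠ 0) would make β vanish on
      -- them. The projection of a vector outside the span of u would then be orthogonal to
      -- everything, hence 0, which puts the vector in the span.
      anisotropic-⟂ : k < n → ∃[ z ] (z ⟂ u × ¬ β z z ≈ 0#)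
      anisotropic-⟂ k<n = decidable-stable em λ none →
        proj₂ w (relation⇒Span (coefficient (proj₁ w))
          (nonDegenerate (project (proj₁ w)) (orthogonal-to-all none)))
        where
        w = extend {u = u} k<n
        module _ (none : ¬ (∃[ z ] (z ⟂ u × ¬ β z z ≈ 0#))) where
          isotropic : ∀ z → z ⟂ u → β z z ≈ 0#
          isotropic z z⟂u = decidable-stable em λ zz≉0 → none (z , z⟂u , zz≉0)
          polarised : ∀ x y → x ⟂ u → y ⟂ u → β x y ≈ 0#
          polarised x y x⟂u y⟂u = integral-≉0 commutativeRing integral 2≉0 (begin
            (1# + 1#) * β x y
              ≈⟨ solve 3 (λ p q r → (con (+ 1) :+ con (+ 1)) :* q := (p :+ q :+ (q :+ r)) :- p :- r) refl
                  (β x x) (β x y) (β y y) ⟩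
            (β x x + β x y + (β x y + β y y)) - β x x - β y y
              ≈⟨ +-cong (+-cong (sym expand) (-‿cong (isotropic x x⟂u))) (-‿cong (isotropic y y⟂u)) ⟩
            β (x +ᴹ y) (x +ᴹ y) - 0# - 0#
              ≈⟨ +-congʳ (+-congʳ (isotropic (x +ᴹ y) λ i →
                   trans (β-+ˡ x y (u i)) (trans (+-cong (x⟂u i) (y⟂u i)) (+-identityˡ 0#)))) ⟩
            0# - 0# - 0#  ≈⟨ solve 0 (con (+ 0) :- con (+ 0) :- con (+ 0) := con (+ 0)) refl ⟩
            0#            ∎)
            where
            expand : β (x +ᴹ y) (x +ᴹ y) ≈ β x x + β x y + (β x y + β y y)
            expand = trans (β-+ˡ x y _) (+-cong (β-+ʳ x x y) (trans (β-+ʳ y x y) (+-congʳ (β-sym y x))))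
          orthogonal-to-all : ∀ y → β (project (proj₁ w)) y ≈ 0#
          orthogonal-to-all y = begin
            β z y                                   ≈⟨ +-identityʳ _ ⟨
            β z y + 0#                              ≈⟨ +-congˡ (⟂-comb z u z⟂u (coefficient y)) ⟨
            β z y + β z (comb (coefficient y) u)    ≈⟨ β-+ʳ z y _ ⟨
            β z (project y)                         ≈⟨ polarised z (project y) z⟂u (project-⟂ y) ⟩
            0#                                      ∎
            where
            z = project (proj₁ w)
            z⟂u = project-⟂ (proj₁ w)

    orthogonal-system : ∀ k → k ≤ n → Σ[ a ∈ Vector Carrier k ] ((∀ i → ¬ a i ≈ 0#) × System a)
    orthogonal-system zero    _   = (λ ()) ,
        (λ ()) , record { vector = λ () ; norm = λ () ; orthogonal = λ () }
    orthogonal-system (suc k) k<n = (β z z ∷ᵛ proj₁ IH) ,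
      (λ { zero → proj₂ (proj₂ found) ; (suc i) → proj₁ (proj₂ IH) i }) ,
      cons z refl S (proj₁ (proj₂ found))
      where
      IH = orthogonal-system k (ℕ.<⇒≤ k<n)
      S = proj₂ (proj₂ IH)
      found = anisotropic-⟂ (proj₁ (proj₂ IH)) S k<n
      z = proj₁ found

    diagonalise : Σ[ a ∈ Vector Carrier n ] ((∀ i → ¬ a i ≈ 0#) × System a)
    diagonalise = orthogonal-system n ℕ.≤-refl

  -- If every nondegenerate binary form represents every t ≠ 0, all but the
  -- last diagonal entry can be prescribed: a u² + b v² represents t by x u + y v,
  -- whose orthogonal complement is spanned by - b y u + a x v.
  module Reshape
    (represent : ∀ a b t → ¬ a ≈ 0# → ¬ b ≈ 0# → ¬ t ≈ 0# → ∃[ x ] ∃[ y ] a * (x * x) + b * (y * y) ≈ t)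
        where

    -- The final clause stands for the inclusion of the span of S′ in that of S; applied to p in the
    -- recursion, it shows that p is orthogonal to the rest of the new system.
    reshape : ∀ N (t : ℕ → Carrier) → (∀ i → ¬ t i ≈ 0#) →
              (a : Vector Carrier (suc N)) → (∀ i → ¬ a i ≈ 0#) → (S : System a) →
              ∃[ d ] (¬ d ≈ 0# × Σ[ S′ ∈ System (t ∷ʳ⟨ N ⟩ d) ] (∀ z → z ⟂ vector S → z ⟂ vector S′))
    reshape zero    t t≉0 a a≉0 S = a zero , a≉0 zero ,
      record { vector = vector S ; norm = λ { zero → norm S zero } ; orthogonal = orthogonal S } ,
          λ z z⟂S → z⟂S
    reshape (suc N) t t≉0 a a≉0 S = d , d≉0 ,
      cons p p-norm S₂ (closed p (λ { zero → pq≈0 ; (suc i) → p⟂rest i })) ,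
      λ z z⟂S → λ { zero → combination z z⟂S x y
                  ; (suc i) → closed z (λ { zero → combination z z⟂S (- (b₁ * y)) (b₀ * x)
                                          ; (suc i) → z⟂S (suc (suc i)) }) i }
      where
      open SetoidReasoning setoid
      b₀ = a zero
      b₁ = a (suc zero)
      u₀ = vector S zero
      u₁ = vector S (suc zero)
      xy = represent b₀ b₁ (t 0) (a≉0 zero) (a≉0 (suc zero)) (t≉0 0)
      x = proj₁ xy
      y = proj₁ (proj₂ xy)
      p = x *ₗ u₀ +ᴹ y *ₗ u₁
      q = (- (b₁ * y)) *ₗ u₀ +ᴹ (b₀ * x) *ₗ u₁
      gram : ∀ x y z w → β (x *ₗ u₀ +ᴹ y *ₗ u₁) (z *ₗ u₀ +ᴹ w *ₗ u₁) ≈ b₀ * (x * z) + b₁ * (y * w)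
      gram x y z w = begin
        β (x *ₗ u₀ +ᴹ y *ₗ u₁) (z *ₗ u₀ +ᴹ w *ₗ u₁)
          ≈⟨ β-linearˡ x u₀ y u₁ _ ⟩
        x * β u₀ (z *ₗ u₀ +ᴹ w *ₗ u₁) + y * β u₁ (z *ₗ u₀ +ᴹ w *ₗ u₁)
          ≈⟨ +-cong (*-congˡ (β-linearʳ u₀ z u₀ w u₁)) (*-congˡ (β-linearʳ u₁ z u₀ w u₁)) ⟩
        x * (z * β u₀ u₀ + w * β u₀ u₁) + y * (z * β u₁ u₀ + w * β u₁ u₁)
          ≈⟨ +-cong (*-congˡ (+-cong (*-congˡ (norm S zero))
              (*-congˡ (orthogonal S zero (suc zero) λ ()))))
                    (*-congˡ (+-cong (*-congˡ (orthogonal S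
                        (suc zero) zero λ ())) (*-congˡ (norm S (suc zero))))) ⟩
        x * (z * b₀ + w * 0#) + y * (z * 0# + w * b₁)
          ≈⟨ solve 6 (λ x y z w a b → x :* (z :* a :+ w :* con (+ 0)) :+ y :* (z :* con (+ 0) :+ w :* b)
               := a :* (x :* z) :+ b :* (y :* w)) refl x y z w b₀ b₁ ⟩
        b₀ * (x * z) + b₁ * (y * w) ∎
      p-norm : β p p ≈ t 0
      p-norm = trans (gram x y x y) (proj₂ (proj₂ xy))
      pq≈0 : β p q ≈ 0#
      pq≈0 = trans (gram x y _ _) (solve 4 (λ a b x y →
        a :* (x :* :- (b :* y)) :+ b :* (y :* (a :* x)) := con (+ 0)) refl b₀ b₁ x y)
      q-norm : β q q ≈ b₀ * b₁ * t 0
      q-norm = trans (gram _ _ _ _) (trans (solve 4 (λ a b x y →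
        a :* (:- (b :* y) :* :- (b :* y)) :+ b :* (a :* x :* (a :* x)) :=
        a :* b :* (a :* (x :* x) :+ b :* (y :* y))) refl b₀ b₁ x y) (*-congˡ (proj₂ (proj₂ xy))))
      combination : ∀ z → z ⟂ vector S → ∀ x y → β z (x *ₗ u₀ +ᴹ y *ₗ u₁) ≈ 0#
      combination z z⟂S x y = trans (β-linearʳ z x u₀ y u₁)
        (trans (+-cong (*-congˡ (z⟂S zero)) (*-congˡ (z⟂S (suc zero))))
          (solve 2 (λ x y → x :* con (+ 0) :+ y :* con (+ 0) := con (+ 0)) refl x y))
      ⟂rest : ∀ x y → (x *ₗ u₀ +ᴹ y *ₗ u₁) ⟂ vector (rest (rest S))
      ⟂rest x y i = trans (β-linearˡ x u₀ y u₁ _)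
        (trans (+-cong (*-congˡ (orthogonal S zero (suc (suc i)) λ ()))
                       (*-congˡ (orthogonal S (suc zero) (suc (suc i)) λ ())))
          (solve 2 (λ x y → x :* con (+ 0) :+ y :* con (+ 0) := con (+ 0)) refl x y))
      p⟂rest = ⟂rest x y
      product-≉0 = integral-*-≉0 commutativeRing integral
      S₁ = cons q q-norm (rest (rest S)) (⟂rest (- (b₁ * y)) (b₀ * x))
      -- The complement vector q takes the place of the first two vectors, with nonzero norm b₀ b₁
      -- t₀.
      IH = reshape N (λ i → t (suc i)) (λ i → t≉0 (suc i)) _
        (λ { zero → product-≉0 (product-≉0 (a≉0 zero) (a≉0 (suc zero))) (t≉0 0)
           ; (suc i) → a≉0 (suc (suc i)) }) S₁
      d = proj₁ IH
      d≉0 = proj₁ (proj₂ IH)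
      S₂ = proj₁ (proj₂ (proj₂ IH))
      closed = proj₂ (proj₂ (proj₂ IH))

  -- Vectors with Gram matrix (h (i + j)) vanishing above the antidiagonal and
  -- equal to 1 on it: w₀ and w_{N-1} span a hyperbolic plane, and its
  -- complement in the span is of the same shape.
  module Hankel (2≉0 : Characteristic≢2 K) where
    open SetoidReasoning setoid
    open Alternating commutativeRing

    half = proj₁ (inverse (1# + 1#) 2≉0)

    half+half : half + half ≈ 1#
    half+half = trans (solve 1 (λ x → x :+ x := (con (+ 1) :+ con (+ 1)) :* x) refl half)
        (proj₂ (inverse (1# + 1#) 2≉0))

    -- The vector z₀ is carried along and ends up last, with norm d. The second component again
    -- replaces an inclusion of spans and yields the orthogonality of each new plane to the system
    -- found by recursion.
    hankel : ∀ N (w : ℕ → Carrierᴹ) (h : ℕ → Carrier) →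
             (∀ i j → i < N → j < N → β (w i) (w j) ≈ h (i ℕ.+ j)) →
             (∀ k → suc k < N → h k ≈ 0#) → (∀ k → suc k ≡ N → h k ≈ 1#) →
             ∀ z₀ d → β z₀ z₀ ≈ d → (∀ i → i < N → β z₀ (w i) ≈ 0#) →
             Σ[ S ∈ System (signs ∷ʳ⟨ N ⟩ d) ]
               (∀ z → (∀ i → i < N → β z (w i) ≈ 0#) → β z z₀ ≈ 0# → z ⟂ vector S)
    hankel zero w h gram h≈0 h≈1 z₀ d z₀-norm z₀⟂w =
      record { vector = λ _ → z₀ ; norm = λ _ → z₀-norm
             ; orthogonal = λ { zero zero i≢j → contradiction ≡.refl i≢j } } ,
      λ z _ zz₀≈0 _ → zz₀≈0
    hankel (suc zero) w h gram h≈0 h≈1 z₀ d z₀-norm z₀⟂w =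
      cons (w 0) (trans (gram 0 0 (s≤s z≤n) (s≤s z≤n)) (h≈1 0 ≡.refl))
        (record { vector = λ _ → z₀ ; norm = λ _ → z₀-norm
                ; orthogonal = λ { zero zero i≢j → contradiction ≡.refl i≢j } })
        (λ _ → trans (β-sym _ _) (z₀⟂w 0 (s≤s z≤n))) ,
      λ z z⟂w zz₀≈0 → λ { zero → z⟂w 0 (s≤s z≤n) ; (suc _) → zz₀≈0 }
    hankel (suc (suc M)) w h gram h≈0 h≈1 z₀ d z₀-norm z₀⟂w =
      cons u u-norm (cons v v-norm S′ v⟂S′) (λ { zero → uv≈0 ; (suc i) → u⟂S′ i }) ,
      λ z z⟂w zz₀≈0 → λ
        { zero → plane z (z⟂w _ f<N) (z⟂w 0 0<N) _
        ; (suc zero) → plane z (z⟂w _ f<N) (z⟂w 0 0<N) _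
        ; (suc (suc i)) → closed z (λ i i<M → plane z (z⟂w (suc i) (s≤s (ℕ.m≤n⇒m≤1+n i<M)))
            (z⟂w 0 0<N) _) zz₀≈0 i }
      where
      0<N : 0 < suc (suc M)
      0<N = s≤s z≤n
      f<N : suc M < suc (suc M)
      f<N = ℕ.≤-refl
      e = w 0
      f = w (suc M)
      η = h (suc M ℕ.+ suc M)
      ee≈0 : β e e ≈ 0#
      ee≈0 = trans (gram 0 0 0<N 0<N) (h≈0 0 (s≤s (s≤s z≤n)))
      ef≈1 : β e f ≈ 1#
      ef≈1 = trans (gram 0 (suc M) 0<N f<N) (h≈1 (suc M) ≡.refl)
      ff≈η : β f f ≈ η
      ff≈η = gram (suc M) (suc M) f<N f<N
      infixl 6 _+e_
      _+e_ : Carrierᴹ → Carrier → Carrierᴹ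
      x +e a = 1# *ₗ x +ᴹ a *ₗ e
      β-+e : ∀ x a y b → β (x +e a) (y +e b) ≈ β x y + b * β x e + a * β e y
      β-+e x a y b = begin
        β (x +e a) (y +e b)
          ≈⟨ β-linearˡ 1# x a e _ ⟩
        1# * β x (y +e b) + a * β e (y +e b)
          ≈⟨ +-cong (*-congˡ (β-linearʳ x 1# y b e)) (*-congˡ (β-linearʳ e 1# y b e)) ⟩
        1# * (1# * β x y + b * β x e) + a * (1# * β e y + b * β e e)
          ≈⟨ +-congˡ (*-congˡ (+-congˡ (*-congˡ ee≈0))) ⟩
        1# * (1# * β x y + b * β x e) + a * (1# * β e y + b * 0#)
          ≈⟨ solve 5 (λ p q r a b → con (+ 1) :* (con (+ 1) :* p :+ b :* q) :+ a :*
              (con (+ 1) :* r :+ b :* con (+ 0))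
               := p :+ b :* q :+ a :* r) refl (β x y) (β x e) (β e y) a b ⟩
        β x y + b * β x e + a * β e y ∎
      plane : ∀ z {x} → β z x ≈ 0# → β z e ≈ 0# → ∀ a → β z (x +e a) ≈ 0#
      plane z {x} zx≈0 ze≈0 a = trans (β-linearʳ z 1# x a e)
        (trans (+-cong (*-congˡ zx≈0) (*-congˡ ze≈0))
          (solve 1 (λ a → con (+ 1) :* con (+ 0) :+ a :* con (+ 0) := con (+ 0)) refl a))
      ff-+e : ∀ a b → β (f +e a) (f +e b) ≈ η + b + a
      ff-+e a b = trans (β-+e f a f b) (trans
        (+-cong (+-cong ff≈η (*-congˡ (trans (β-sym f e) ef≈1))) (*-congˡ ef≈1))
        (+-cong (+-congˡ (*-identityʳ b)) (*-identityʳ a)))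
      -- As e is isotropic and pairs with f to 1, f + a e has norm η + 2 a; these solve η + 2 a = 1
      -- and η + 2 a = - 1. Their sum - η also makes u and v orthogonal.
      a₊ = half * (1# - η)
      a₋ = - (half * (1# + η))
      u = f +e a₊
      v = f +e a₋
      u-norm : β u u ≈ 1#
      u-norm = begin
        β u u                        ≈⟨ ff-+e a₊ a₊ ⟩
        η + a₊ + a₊
          ≈⟨ solve 2 (λ η x → η :+ x :* (con (+ 1) :- η) :+ x :* (con (+ 1) :- η)
                                          := η :+ (x :+ x) :* (con (+ 1) :- η)) refl η half ⟩
        η + (half + half) * (1# - η) ≈⟨ +-congˡ (*-congʳ half+half) ⟩
        η + 1# * (1# - η)
          ≈⟨ solve 1 (λ η → η :+ con (+ 1) :* (con (+ 1) :- η) := con (+ 1)) refl η ⟩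
        1#                           ∎
      v-norm : β v v ≈ - 1#
      v-norm = begin
        β v v                        ≈⟨ ff-+e a₋ a₋ ⟩
        η + a₋ + a₋
          ≈⟨ solve 2 (λ η x → η :+ :- (x :* (con (+ 1) :+ η)) :+ :- (x :* (con (+ 1) :+ η))
                                          := η :- (x :+ x) :* (con (+ 1) :+ η)) refl η half ⟩
        η - (half + half) * (1# + η) ≈⟨ +-congˡ (-‿cong (*-congʳ half+half)) ⟩
        η - 1# * (1# + η)
          ≈⟨ solve 1 (λ η → η :- con (+ 1) :* (con (+ 1) :+ η) := :- con (+ 1)) refl η ⟩
        - 1#                         ∎
      uv≈0 : β u v ≈ 0#
      uv≈0 = begin
        β u v                        ≈⟨ ff-+e a₊ a₋ ⟩
        η + a₋ + a₊
          ≈⟨ solve 2 (λ η x → η :+ :- (x :* (con (+ 1) :+ η)) :+ x :* (con (+ 1) :- η)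
                                          := η :- (x :+ x) :* η) refl η half ⟩
        η - (half + half) * η        ≈⟨ +-congˡ (-‿cong (*-congʳ half+half)) ⟩
        η - 1# * η                   ≈⟨ solve 1 (λ η → η :- con (+ 1) :* η := con (+ 0)) refl η ⟩
        0#                           ∎
      -- The product of w (i + 1) with f. Subtracting κ i times e makes w (i + 1) orthogonal to f;
      -- since e is isotropic and orthogonal to these vectors, their Gram entries do not change, and
      -- h is merely shifted by 2.
      κ : ℕ → Carrier
      κ i = h (suc i ℕ.+ suc M)
      w′ : ℕ → Carrierᴹ
      w′ i = w (suc i) +e - κ i
      i<N : ∀ {i} → i < M → suc i < suc (suc M)
      i<N i<M = s≤s (ℕ.m≤n⇒m≤1+n i<M)
      ew≈0 : ∀ i → i < M → β e (w (suc i)) ≈ 0#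
      ew≈0 i i<M = trans (gram 0 (suc i) 0<N (i<N i<M)) (h≈0 (suc i) (s≤s (s≤s i<M)))
      gram′ : ∀ i j → i < M → j < M → β (w′ i) (w′ j) ≈ h (suc (suc (i ℕ.+ j)))
      gram′ i j i<M j<M = begin
        β (w′ i) (w′ j)
          ≈⟨ β-+e (w (suc i)) (- κ i) (w (suc j)) (- κ j) ⟩
        β (w (suc i)) (w (suc j)) + - κ j * β (w (suc i)) e + - κ i * β e (w (suc j))
          ≈⟨ +-cong (+-cong (gram (suc i) (suc j) (i<N i<M) (i<N j<M))
               (*-congˡ (trans (β-sym _ e) (ew≈0 i i<M)))) (*-congˡ (ew≈0 j j<M)) ⟩
        h (suc i ℕ.+ suc j) + - κ j * 0# + - κ i * 0#
          ≈⟨ solve 3 (λ h a b → h :+ a :* con (+ 0) :+ b :* con (+ 0) := h) refl _ (- κ j) (- κ i) ⟩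
        h (suc i ℕ.+ suc j)          ≡⟨ cong (λ k → h (suc k)) (ℕ.+-suc i j) ⟩
        h (suc (suc (i ℕ.+ j)))      ∎
      f+e⟂w′ : ∀ a i → i < M → β (f +e a) (w′ i) ≈ 0#
      f+e⟂w′ a i i<M = begin
        β (f +e a) (w′ i)                                          ≈⟨ β-+e f a (w (suc i)) (- κ i) ⟩
        β f (w (suc i)) + - κ i * β f e + a * β e (w (suc i))
          ≈⟨ +-cong (+-cong (trans (β-sym f _) (gram (suc i) (suc M) (i<N i<M) f<N))
               (*-congˡ (trans (β-sym f e) ef≈1))) (*-congˡ (ew≈0 i i<M)) ⟩
        κ i + - κ i * 1# + a * 0#
          ≈⟨ solve 2 (λ k a → k :+ :- k :* con (+ 1) :+ a :* con (+ 0) := con (+ 0)) refl (κ i) a ⟩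
        0# ∎
      z₀⟂+e : ∀ i → i < suc (suc M) → ∀ a → β z₀ (w i +e a) ≈ 0#
      z₀⟂+e i i<N a = plane z₀ (z₀⟂w i i<N) (z₀⟂w 0 0<N) a
      IH = hankel M w′ (λ k → h (suc (suc k))) gram′
        (λ k k<M → h≈0 (suc (suc k)) (s≤s (s≤s k<M)))
        (λ k k≡M → h≈1 (suc (suc k)) (cong (λ i → suc (suc i)) k≡M))
        z₀ d z₀-norm (λ i i<M → z₀⟂+e (suc i) (i<N i<M) _)
      S′ = proj₁ IH
      closed = proj₂ IH
      u⟂S′ : u ⟂ vector S′
      u⟂S′ = closed u (f+e⟂w′ a₊) (trans (β-sym u z₀) (z₀⟂+e (suc M) f<N a₊))
      v⟂S′ : v ⟂ vector S′
      v⟂S′ = closed v (f+e⟂w′ a₋) (trans (β-sym v z₀) (z₀⟂+e (suc M) f<N a₋))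

module _ (em : ∀ {a : Level} → ExcludedMiddle a) (K : Field c ℓ) where
  open Field K hiding (zero)

  -- Nonzero norms make both systems independent, hence bases; in their coordinates the two forms
  -- are the same diagonal sum.
  isometry : ∀ {m ℓm m′ ℓm′} (V : LeftModule (Field.ring K) m ℓm) (W : LeftModule (Field.ring K) m′ ℓm′)
    (f : SymmetricBilinear K V) (g : SymmetricBilinear K W) {n} →
    Basis {K = K} V n → Basis {K = K} W n → {a : Vector Carrier n} → (∀ i → ¬ a i ≈ 0#) →
    Orthogonal.System em K V f a → Orthogonal.System em K W g a →
    let open LeftModuleMorphisms (LeftModule.rawLeftModule V) (LeftModule.rawLeftModule W) in
    Σ[ φ ∈ (LeftModule.Carrierᴹ V → LeftModule.Carrierᴹ W) ] (IsLeftModuleIsomorphism φ ×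
      (∀ x → SymmetricBilinear.β g (φ x) (φ x) ≈ SymmetricBilinear.β f x x))
  isometry V W f g {n} bV bW a≉0 S T = φ , isomorphism , λ x → trans (O′.β-diagonal T (coord x))
      (trans (sym (O.β-diagonal S (coord x)))
             (SymmetricBilinear.β-cong f (V.≈ᴹ-sym (spanning x)) (V.≈ᴹ-sym (spanning x))))
    where
    module V = LeftModule V
    module W = LeftModule W
    module O = Orthogonal em K V f
    module O′ = Orthogonal em K W g
    module LV = LinearCombination K V
    open LinearCombination K W
    t = O′.vector T
    indV = O.system-independent S a≉0
    indW = O′.system-independent T a≉0
    basisV = VectorSpace.Finite.independent⇒basis em K V bV {u = O.vector S} indV
    basisW = VectorSpace.Finite.independent⇒basis em K W bW {u = t} indW
    open Basis basisV using (coord; spanning)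
    open Basis basisW using () renaming (coord to coord′; spanning to spanning′)
    φ : V.Carrierᴹ → W.Carrierᴹ
    φ x = comb (coord x) t
    φ-cong : ∀ {x y} → x V.≈ᴹ y → φ x W.≈ᴹ φ y
    φ-cong e = comb-congˡ t (coord-cong basisV e)
    φ-+ : ∀ x y → φ (x V.+ᴹ y) W.≈ᴹ φ x W.+ᴹ φ y
    φ-+ x y = W.≈ᴹ-trans (comb-congˡ t (coord-+ basisV x y)) (comb-+ (coord x) (coord y) t)
    φ-* : ∀ k x → φ (k V.*ₗ x) W.≈ᴹ k W.*ₗ φ x
    φ-* k x = W.≈ᴹ-trans (comb-congˡ t (coord-* basisV k x)) (comb-* k (coord x) t)
    φ-0 : φ V.0ᴹ W.≈ᴹ W.0ᴹ
    φ-0 = W.≈ᴹ-trans (φ-cong (V.≈ᴹ-sym (V.*ₗ-zeroˡ V.0ᴹ))) (W.≈ᴹ-trans (φ-* 0# V.0ᴹ) (W.*ₗ-zeroˡ _))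
    φ-neg : ∀ x → φ (V.-ᴹ x) W.≈ᴹ W.-ᴹ φ x
    φ-neg x = inverseˡ-unique _ _ (W.≈ᴹ-trans (W.≈ᴹ-sym (φ-+ (V.-ᴹ x) x))
        (W.≈ᴹ-trans (φ-cong (V.-ᴹ‿inverseˡ x)) φ-0))
      where open GroupProperties (LeftModule.+ᴹ-group W) using (inverseˡ-unique)
    preimage : W.Carrierᴹ → V.Carrierᴹ
    preimage y = LV.comb (coord′ y) (O.vector S)
    φ-preimage : ∀ y → φ (preimage y) W.≈ᴹ y
    φ-preimage y = W.≈ᴹ-trans (comb-congˡ t
        (LV.comb-injective indV _ _ (V.≈ᴹ-sym (spanning (preimage y)))))
      (W.≈ᴹ-sym (spanning′ y))
    φ-injective : ∀ {x y} → φ x W.≈ᴹ φ y → x V.≈ᴹ y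
    φ-injective {x} {y} e = V.≈ᴹ-trans (spanning x)
      (V.≈ᴹ-trans (LV.comb-congˡ (O.vector S) (comb-injective indW _ _ e)) (V.≈ᴹ-sym (spanning y)))
    isomorphism = record
      { isLeftModuleMonomorphism = record
        { isLeftModuleHomomorphism = record
          { +ᴹ-isGroupHomomorphism = record
            { isMonoidHomomorphism = record
              { isMagmaHomomorphism = record
                { isRelHomomorphism = record { cong = φ-cong } ; homo = φ-+ }
              ; ε-homo = φ-0 }
            ; ⁻¹-homo = φ-neg }
          ; *ₗ-homo = φ-* }
        ; injective = φ-injective }
      ; surjective = λ y → preimage y , λ e → W.≈ᴹ-trans (φ-cong e) (φ-preimage y) }

-- Binary forms and curves over a PAC field

module Quadrics (em : ∀ {a : Level} → ExcludedMiddle a) (K : Field c ℓ) (pac : PAC K)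
                (2≉0 : Characteristic≢2 K) where
  open Field K hiding (zero)
  open Polynomial commutativeRing
  open PACField em K pac
  open IntegerSolver commutativeRing using (solve; _:=_; _:+_; _:*_; _:-_; :-_; con)

  private integral = field-integral em K

  -- For g = t + k X² one has 2 g - X g′ = 2 t, so a common root of g and g′ would give 2 t = 0.
  parabola-simple : ∀ t k → ¬ t ≈ 0# → Simple (t ∷ 0# ∷ k ∷ [])
  parabola-simple t k t≉0 L r root derivative-root = ι-≉0 2t≉0 (begin
    L.ι ((1# + 1#) * t)
      ≈⟨ L.⟦⟧-cong (solve 1 (λ t → (con (+ 1) :+ con (+ 1)) :* t := t :+ t) refl t) ⟩
    L.ι (t + t)               ≈⟨ L.+-homo t t ⟩
    L.ι t L.+ L.ι t
      ≈⟨ Lₛ.solve 4 (λ t k r z → t Lₛ.:+ t Lₛ.:=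
           (t Lₛ.:+ r Lₛ.:* (Lₛ.con (+ 0) Lₛ.:+ r Lₛ.:* (k Lₛ.:+ r Lₛ.:* Lₛ.con (+ 0)))) Lₛ.:+
           (t Lₛ.:+ r Lₛ.:* (Lₛ.con (+ 0) Lₛ.:+ r Lₛ.:* (k Lₛ.:+ r Lₛ.:* Lₛ.con (+ 0)))) Lₛ.:-
           r Lₛ.:* (Lₛ.con (+ 0) Lₛ.:+ r Lₛ.:* (k Lₛ.:+ k Lₛ.:+ r Lₛ.:* Lₛ.con (+ 0))))
           L.refl (L.ι t) (L.ι k) r L.0# ⟩
    g₀ L.+ g₀ L.- r L.* g₁
      ≈⟨ L.+-cong (L.+-cong g₀≈0 g₀≈0) (L.-‿cong (L.*-congˡ g₁≈0)) ⟩
    L.0# L.+ L.0# L.- r L.* L.0#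
      ≈⟨ Lₛ.solve 1 (λ r → Lₛ.con (+ 0) Lₛ.:+ Lₛ.con (+ 0) Lₛ.:- r Lₛ.:* Lₛ.con (+ 0) Lₛ.:= Lₛ.con (+ 0))
          L.refl r ⟩
    L.0# ∎)
    where
    module L = Extension L
    open BaseChange em L using (ι-≉0)
    module Lₛ = IntegerSolver L.commutativeRing
    open SetoidReasoning L.setoid
    2t≉0 : ¬ (1# + 1#) * t ≈ 0#
    2t≉0 e = t≉0 (integral-≉0 commutativeRing integral 2≉0 e)
    g₀ = L.ι t L.+ r L.* (L.0# L.+ r L.* (L.ι k L.+ r L.* L.0#))
    g₁ = L.0# L.+ r L.* (L.ι k L.+ L.ι k L.+ r L.* L.0#)
    g₀≈0 : g₀ L.≈ L.0#
    g₀≈0 = L.trans (L.+-congˡ (L.*-congˡ (L.+-congʳ (L.sym L.0#-homo)))) root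
    g₁≈0 : g₁ L.≈ L.0#
    g₁≈0 = L.trans (L.sym (L.+-cong (L.trans (L.⟦⟧-cong (+-identityˡ 0#)) L.0#-homo)
      (L.*-congˡ (L.+-cong
        (L.trans (L.⟦⟧-cong (+-congˡ (+-identityʳ k))) (L.+-homo k k))
        (L.*-congˡ (L.trans (L.+-cong L.0#-homo (L.zeroʳ r)) (L.+-identityˡ _)))))))
      derivative-root

  represent : ∀ a b t → ¬ a ≈ 0# → ¬ b ≈ 0# → ¬ t ≈ 0# → ∃[ x ] ∃[ y ] a * (x * x) + b * (y * y) ≈ t
  represent a b t a≉0 b≉0 t≉0 = y , x , (begin
      a * (y * y) + b * (x * x)    ≈⟨ +-congʳ (*-congˡ y²≈) ⟩
      a * (t * a⁻¹ + x * (0# + x * (- b * a⁻¹ + x * 0#))) + b * (x * x)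
        ≈⟨ solve 5 (λ a i t b x → a :* (t :* i :+ x :* (con (+ 0) :+ x :* (:- b :* i :+ x :* con (+ 0))))
            :+ b :* (x :* x)
             := (a :* i) :* (t :- b :* (x :* x)) :+ b :* (x :* x)) refl a a⁻¹ t b x ⟩
      (a * a⁻¹) * (t - b * (x * x)) + b * (x * x)  ≈⟨ +-congʳ (*-congʳ aa⁻¹≈1) ⟩
      1# * (t - b * (x * x)) + b * (x * x)
        ≈⟨ solve 3 (λ t b x → con (+ 1) :* (t :- b :* (x :* x)) :+ b :* (x :* x) := t) refl t b x ⟩
      t ∎)
    where
    open SetoidReasoning setoid
    a⁻¹ = proj₁ (inverse a a≉0)
    aa⁻¹≈1 = proj₂ (inverse a a≉0)
    product-≉0 = integral-*-≉0 commutativeRing integral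
    a⁻¹≉0 : ¬ a⁻¹ ≈ 0#
    a⁻¹≉0 e = 1≉0 (trans (sym aa⁻¹≈1) (trans (*-congˡ e) (zeroʳ a)))
    -b≉0 : ¬ - b ≈ 0#
    -b≉0 e = b≉0 (trans (solve 1 (λ b → b := :- (:- b)) refl b)
      (trans (-‿cong e) (solve 0 (:- con (+ 0) := con (+ 0)) refl)))
    -- The index 1 witnesses nonconstancy by the coefficient - b / a of x².
    point = curve-point (t * a⁻¹ ∷ 0# ∷ - b * a⁻¹ ∷ []) (1 , product-≉0 -b≉0 a⁻¹≉0)
      (parabola-simple (t * a⁻¹) (- b * a⁻¹) (product-≉0 t≉0 a⁻¹≉0))
    x = proj₁ point
    y = proj₁ (proj₂ point)
    y²≈ = proj₂ (proj₂ point)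

  scaled-simple : ∀ e p → ¬ e ≈ 0# → SeparablePolynomial p → Simple (e · p)
  scaled-simple e p e≉0 separable L r root derivative-root =
    separable⇒simple L separable r
      (integral-≉0 L.commutativeRing integralᴸ (ι-≉0 e≉0) (L.trans (L.sym (ev-· e p)) root))
      (integral-≉0 L.commutativeRing integralᴸ (ι-≉0 e≉0)
        (L.trans (L.sym (ev-· e (derivative p)))
            (L.trans (L.sym (ev-cong (derivative-· p))) derivative-root)))
    where
    module L = Extension L
    open BaseChange em L using (ι-≉0)
    open Evaluation {R = commutativeRing} L.commutativeRing L.ι-hom r
    integralᴸ = field-integral em L.top
    module P = CommutativeRing polynomialRing
    derivative-· : ∀ p → derivative (e · p) ≋ e · derivative p
    derivative-· []      = P.refl
    derivative-· (a ∷ p) = P.trans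
      (⊕-cong {e · p} P.refl (P.trans (shift-cong (derivative-· p)) (P.sym (shift-· e (derivative p)))))
      (P.sym (·-distribˡ e p (shift (derivative p))))

-- Scaled trace forms with prescribed diagonal

module TraceForm (em : ∀ {a : Level} → ExcludedMiddle a) (K : Field c ℓ) (pac : PAC K)
  (2≉0 : Characteristic≢2 K) (F : Extension K)
  {N : ℕ} (basis : Basis {K = K} (Extension.vectorSpace F) (suc N))
  (g : SimpleExtension.Generator em K F (suc N)) where
  private
    module K = Field K
    module F = Extension F
    module K[X] = Polynomial K.commutativeRing
    module K[X]ᴿ = CommutativeRing K[X].polynomialRing
    module Kₛ = IntegerSolver K.commutativeRing
    module Fₛ = IntegerSolver F.commutativeRing
    integral = field-integral em K
  open SimpleExtension em K F
  open Generator g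
  open Coefficients K.commutativeRing
  open PowerBasis em K F basis g
  open Exp F.semiring using (_^_; ^-homo-*)
  open At θ hiding (horner; coeff-horner)
  open PACField em K pac
  open Quadrics em K pac 2≉0

  module Quotient (x : K.Carrier) where
    open LinearFactor K.commutativeRing x using (horner; coeff-horner; X-r; divide-drop)
      renaming (ev-cong to evˣ-cong; ev-C to evˣ-C)

    quotient : K[X].Poly
    quotient = horner (drop 1 p)

    coeff-suffix : ∀ i j → K[X].coeff (drop i (drop 1 p)) j K.≈ K[X].coeff p (suc (i ℕ.+ j))
    coeff-suffix i j = K.trans (K.reflexive (coeff-drop K.commutativeRing i (drop 1 p) j))
      (K.reflexive (coeff-drop K.commutativeRing 1 p (i ℕ.+ j)))

    quotient-lead : K[X].coeff quotient N K.≈ K.1#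
    quotient-lead = K.trans (coeff-horner (drop 1 p) N) (K.trans (evˣ-cong suffix) (evˣ-C K.1#))
      where
      suffix : drop N (drop 1 p) K[X].≋ K.1# ∷ []
      suffix = K[X].mk≋ λ
        { zero → K.trans (coeff-suffix N 0)
            (K.trans (K.reflexive (cong (λ i → K[X].coeff p (suc i)) (ℕ.+-identityʳ N))) lead)
        ; (suc j) → K.trans (coeff-suffix N (suc j)) (above _ (s≤s (ℕ.m<m+n N (s≤s z≤n)))) }

    quotient-vanishes : VanishesFrom (suc N) quotient
    quotient-vanishes i N<i = K.trans (coeff-horner (drop 1 p) i)
        (evˣ-cong {drop i (drop 1 p)} {[]} (K[X].mk≋ λ j →
      K.trans (coeff-suffix i j) (above _ (s≤s (ℕ.≤-trans N<i (ℕ.m≤m+n i j))))))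

    θ-x : F.Carrier
    θ-x = θ F.- F.ι x

    -- Evaluation of p = p(x) + (X - x) quotient at the root θ. It presents 1 / (θ - x) as a
    -- polynomial in θ of degree at most N whenever p(x) is not 0.
    θ-x*quotient : θ-x F.* ⟦ quotient ⟧ F.≈ F.- F.ι (K[X].eval x p)
    θ-x*quotient = begin
      θ-x F.* ⟦ quotient ⟧
        ≈⟨ F.*-congʳ (Fₛ.solve 2 (λ t x → t Fₛ.:- x Fₛ.:= Fₛ.:- x Fₛ.:+ t Fₛ.:*
            (Fₛ.con (+ 1) Fₛ.:+ t Fₛ.:* Fₛ.con (+ 0))) F.refl θ (F.ι x)) ⟩
      (F.- F.ι x F.+ θ F.* (F.1# F.+ θ F.* F.0#)) F.* ⟦ quotient ⟧
        ≈⟨ F.*-congʳ (F.+-cong (F.-‿homo x) (F.*-congˡ (F.+-congʳ F.1#-homo))) ⟨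
      ⟦ X-r ⟧ F.* ⟦ quotient ⟧                        ≈⟨ ev-⊛ X-r quotient ⟨
      ⟦ X-r K[X].⊛ quotient ⟧
        ≈⟨ Fₛ.solve 2 (λ a b → b Fₛ.:= (a Fₛ.:+ b) Fₛ.:- a) F.refl (F.ι (K[X].eval x p)) _ ⟩
      F.ι (K[X].eval x p) F.+ ⟦ X-r K[X].⊛ quotient ⟧ F.- F.ι (K[X].eval x p)
        ≈⟨ F.+-congʳ (F.+-congʳ (ev-C (K[X].eval x p))) ⟨
      ⟦ K[X].eval x p ∷ [] ⟧ F.+ ⟦ X-r K[X].⊛ quotient ⟧ F.- F.ι (K[X].eval x p)
        ≈⟨ F.+-congʳ (F.trans (F.sym (ev-⊕ (K[X].eval x p ∷ []) (X-r K[X].⊛ quotient)))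
             (F.trans (F.sym (ev-cong (divide-drop p))) root)) ⟩
      F.0# F.- F.ι (K[X].eval x p)                    ≈⟨ F.+-identityˡ _ ⟩
      F.- F.ι (K[X].eval x p)                         ∎
      where open SetoidReasoning F.setoid

  -- A zero of p in K is harmless: it forces p to be linear, and then p takes
  -- every value.
  twist : ∀ e → ¬ e K.≈ K.0# → ∃[ x ] ∃[ y ] (y K.* y K.≈ e K.* K[X].eval x p × ¬ y K.≈ K.0#)
  twist e e≉0 with em {P = ∃[ x ] K[X].eval x p K.≈ K.0#}
  ... | yes (x , p[x]≈0) = linear N ≡.refl
    where
    open SetoidReasoning K.setoid
    e⁻¹ = proj₁ (K.inverse e e≉0)
    linear : ∀ M → N ≡ M → ∃[ x ] ∃[ y ] (y K.* y K.≈ e K.* K[X].eval x p × ¬ y K.≈ K.0#)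
    -- Here p is X + p₀, so moving from the root x by 1 / e gives e p = 1, the square of 1.
    linear zero    ≡.refl = x K.+ e⁻¹ , K.1# , (begin
        K.1# K.* K.1#                       ≈⟨ K.*-identityˡ _ ⟩
        K.1#                                ≈⟨ proj₂ (K.inverse e e≉0) ⟨
        e K.* e⁻¹                           ≈⟨ K.*-congˡ (K.+-identityˡ e⁻¹) ⟨
        e K.* (K.0# K.+ e⁻¹)                ≈⟨ K.*-congˡ (K.+-congʳ p[x]≈0) ⟨
        e K.* (K[X].eval x p K.+ e⁻¹)       ≈⟨ K.*-congˡ (K.+-congʳ (affine x)) ⟩
        e K.* (p₀ K.+ x K.+ e⁻¹)            ≈⟨ K.*-congˡ (K.+-assoc p₀ x e⁻¹) ⟩
        e K.* (p₀ K.+ (x K.+ e⁻¹))          ≈⟨ K.*-congˡ (affine (x K.+ e⁻¹)) ⟨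
        e K.* K[X].eval (x K.+ e⁻¹) p       ∎) , K.1≉0
      where
      p₀ = K[X].coeff p 0
      affine : ∀ x → K[X].eval x p K.≈ p₀ K.+ x
      affine x = K.trans
        (Evaluation.ev-cong {R = K.commutativeRing} K.commutativeRing
            (idHom K.commutativeRing) x {p} {p₀ ∷ K.1# ∷ []}
          (K[X].mk≋ λ { zero → K.refl ; (suc zero) → lead ; (suc (suc i)) → above (suc (suc i))
              (s≤s (s≤s z≤n)) }))
        (Kₛ.solve 2 (λ p x → p Kₛ.:+ x Kₛ.:* (Kₛ.con (+ 1) Kₛ.:+ x Kₛ.:* Kₛ.con (+ 0)) Kₛ.:= p Kₛ.:+ x)
            K.refl p₀ x)
    -- The quotient is monic of degree N, too small to vanish at θ; hence θ = x, against the
    -- independence of 1 and θ.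
    linear (suc M) ≡.refl = contradiction (K[X].at X-x≋[] 1) K.1≉0
      where
      open Quotient x
      θ≈x : θ-x F.≈ F.0#
      θ≈x = integral-≉0 F.commutativeRing (field-integral em F.top)
        (λ q≈0 → K.1≉0 (K.trans (K.sym quotient-lead)
            (K[X].at (annihilator quotient quotient-vanishes q≈0) N)))
        (F.trans (F.*-comm _ _) (F.trans θ-x*quotient
            (F.trans (F.-‿cong (F.trans (F.⟦⟧-cong p[x]≈0) F.0#-homo))
          (Fₛ.solve 0 (Fₛ.:- Fₛ.con (+ 0) Fₛ.:= Fₛ.con (+ 0)) F.refl))))
      X-x≋[] : (K.- x ∷ K.1# ∷ []) K[X].≋ []
      X-x≋[] = annihilator (K.- x ∷ K.1# ∷ []) (λ { (suc zero) (s≤s ()) ; (suc (suc i)) _ → K.refl })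
        (F.trans (F.+-cong (F.-‿homo x) (F.*-congˡ (F.+-congʳ F.1#-homo))) (F.trans
          (Fₛ.solve 2 (λ t x → Fₛ.:- x Fₛ.:+ t Fₛ.:* (Fₛ.con (+ 1) Fₛ.:+ t Fₛ.:* Fₛ.con (+ 0)) Fₛ.:= t
              Fₛ.:- x) F.refl θ (F.ι x))
          θ≈x))
  ... | no no-zero = proj₁ point , proj₁ (proj₂ point) , y²≈ , λ y≈0 → no-zero (proj₁ point ,
      integral-≉0 K.commutativeRing integral e≉0
        (K.trans (K.sym y²≈) (K.trans (K.*-congˡ y≈0) (K.zeroʳ _))))
    where
    point = curve-point (e K[X].· p)
      (N , λ e≈0 → e≉0 (K.trans (K.sym (K.trans (K.*-congˡ lead) (K.*-identityʳ e)))
                          (K.trans (K.sym (K[X].coeff-· e p (suc N))) e≈0)))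
      (scaled-simple e p e≉0 separable)
    y²≈ : proj₁ (proj₂ point) K.* proj₁ (proj₂ point) K.≈ e K.* K[X].eval (proj₁ point) p
    y²≈ = K.trans (proj₂ (proj₂ point))
      (Evaluation.ev-· {R = K.commutativeRing} K.commutativeRing (idHom K.commutativeRing)
          (proj₁ point) e p)

  monomial : ℕ → K[X].Poly
  monomial zero    = K.1# ∷ []
  monomial (suc k) = K[X].shift (monomial k)

  monomial-above : ∀ k → VanishesFrom (suc k) (monomial k)
  monomial-above zero    (suc i) _         = K.refl
  monomial-above (suc k) (suc i) (s≤s k<i) = monomial-above k i k<i

  monomial-lead : ∀ k → K[X].coeff (monomial k) k K.≈ K.1#
  monomial-lead zero    = K.refl
  monomial-lead (suc k) = monomial-lead k

  ev-monomial : ∀ k → ⟦ monomial k ⟧ F.≈ θ ^ k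
  ev-monomial zero    = F.trans (ev-C K.1#) F.1#-homo
  ev-monomial (suc k) = F.trans (ev-shift (monomial k)) (F.*-congˡ (ev-monomial k))

  s-power : ∀ k → k ≤ N → s (θ ^ k) K.≈ K[X].coeff (monomial k) N
  s-power k k≤N = coord∞-unique (monomial k)
    (λ i N<i → monomial-above k i (ℕ.≤-trans (s≤s k≤N) N<i)) (ev-monomial k) N

  s-power-below : ∀ k → k < N → s (θ ^ k) K.≈ K.0#
  s-power-below k k<N = K.trans (s-power k (ℕ.<⇒≤ k<N)) (monomial-above k N k<N)

  s-power-top : s (θ ^ N) K.≈ K.1#
  s-power-top = K.trans (s-power N ℕ.≤-refl) (monomial-lead N)

  -- The form y ↦ s (y² / (θ - x)): the vector 1 has norm - 1 / p(x) and is
  -- orthogonal to the (θ - x) θ^i, whose Gram matrix is s ((θ - x) θ^(i + j)).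
  module Twisted (x : K.Carrier) (p[x]≉0 : ¬ K[X].eval x p K.≈ K.0#) where
    open Quotient x

    p[x]⁻¹ = proj₁ (K.inverse (K[X].eval x p) p[x]≉0)

    -- This is 1 / (θ - x), written as a polynomial in θ so that its top coordinate can be read off.
    γ : F.Carrier
    γ = F.ι (K.- p[x]⁻¹) F.* ⟦ quotient ⟧

    θ-x*γ : θ-x F.* γ F.≈ F.1#
    θ-x*γ = begin
      θ-x F.* (F.ι (K.- p[x]⁻¹) F.* ⟦ quotient ⟧)
        ≈⟨ Fₛ.solve 3 (λ t i q → t Fₛ.:* (i Fₛ.:* q) Fₛ.:= i Fₛ.:* (t Fₛ.:* q)) F.refl θ-x _ _ ⟩
      F.ι (K.- p[x]⁻¹) F.* (θ-x F.* ⟦ quotient ⟧)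
        ≈⟨ F.*-cong (F.-‿homo p[x]⁻¹) θ-x*quotient ⟩
      F.- F.ι p[x]⁻¹ F.* F.- F.ι (K[X].eval x p)
        ≈⟨ Fₛ.solve 2 (λ i p → Fₛ.:- i Fₛ.:* Fₛ.:- p Fₛ.:= p Fₛ.:* i) F.refl _ _ ⟩
      F.ι (K[X].eval x p) F.* F.ι p[x]⁻¹   ≈⟨ F.*-homo _ _ ⟨
      F.ι (K[X].eval x p K.* p[x]⁻¹)       ≈⟨ F.⟦⟧-cong (proj₂ (K.inverse (K[X].eval x p) p[x]≉0)) ⟩
      F.ι K.1#                             ≈⟨ F.1#-homo ⟩
      F.1#                                 ∎
      where open SetoidReasoning F.setoid

    s-γ : s γ K.≈ K.- p[x]⁻¹
    s-γ = K.trans (s-* (K.- p[x]⁻¹) ⟦ quotient ⟧) (K.trans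
      (K.*-congˡ (K.trans (coord∞-unique quotient quotient-vanishes F.refl N) quotient-lead))
          (K.*-identityʳ _))

    form : SymmetricBilinear K F.vectorSpace
    form = record
      { β = λ y z → s (γ F.* (y F.* z))
      ; β-cong = λ e f → s-cong (F.*-congˡ (F.*-cong e f))
      ; β-sym = λ y z → s-cong (F.*-congˡ (F.*-comm y z))
      ; β-+ˡ = λ y z w → K.trans (s-cong (Fₛ.solve 4 (λ g y z w →
          g Fₛ.:* ((y Fₛ.:+ z) Fₛ.:* w) Fₛ.:= g Fₛ.:* (y Fₛ.:* w) Fₛ.:+ g Fₛ.:* (z Fₛ.:* w)) F.refl γ y z
              w)) (s-+ _ _)
      ; β-*ˡ = λ a y z → K.trans (s-cong (Fₛ.solve 4 (λ g a y z →
          g Fₛ.:* (a Fₛ.:* y Fₛ.:* z) Fₛ.:= a Fₛ.:* (g Fₛ.:* (y Fₛ.:* z))) F.refl γ (F.ι a) y z))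
              (s-* a _)
      }

    open SymmetricBilinear form
    open Orthogonal em K F.vectorSpace form
    open Hankel 2≉0
    open Alternating K.commutativeRing

    w : ℕ → F.Carrier
    w i = θ-x F.* θ ^ i

    h : ℕ → K.Carrier
    h k = s (θ-x F.* θ ^ k)

    -- Among the powers θ^k with k ≤ N only θ^N has a nonzero top coordinate, so the value is 0 for
    -- k + 1 < N and 1 for k + 1 = N, as `hankel` demands.
    h-value : ∀ k → h k K.≈ s (θ ^ suc k) K.+ K.- x K.* s (θ ^ k)
    h-value k = K.trans (s-cong (F.trans
      (Fₛ.solve 3 (λ t x r → (t Fₛ.:- x) Fₛ.:* r Fₛ.:= t Fₛ.:* r Fₛ.:+ Fₛ.:- x Fₛ.:* r) F.refl θ (F.ι x)
          (θ ^ k))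
      (F.+-congˡ (F.*-congʳ (F.sym (F.-‿homo x)))))) (K.trans (s-+ _ _) (K.+-congˡ (s-* (K.- x) _)))

    cancel-γ : ∀ z → γ F.* (θ-x F.* z) F.≈ z
    cancel-γ z = F.trans (Fₛ.solve 3 (λ g t z → g Fₛ.:* (t Fₛ.:* z) Fₛ.:= t Fₛ.:* g Fₛ.:* z) F.refl γ θ-x
        z)
      (F.trans (F.*-congʳ θ-x*γ) (F.*-identityˡ z))

    gram : ∀ i j → β (w i) (w j) K.≈ h (i ℕ.+ j)
    gram i j = s-cong (F.trans
      (Fₛ.solve 4 (λ g t a b → g Fₛ.:* (t Fₛ.:* a Fₛ.:* (t Fₛ.:* b)) Fₛ.:= g Fₛ.:*
          (t Fₛ.:* (t Fₛ.:* (a Fₛ.:* b)))) F.refl γ θ-x (θ ^ i) (θ ^ j))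
      (F.trans (cancel-γ _) (F.*-congˡ (F.sym (^-homo-* θ i j)))))

    -- Taking the scalar y as last vector in place of 1 multiplies the last norm by y², the freedom
    -- that `twist` exploits.
    system : ∀ y → System (signs ∷ʳ⟨ N ⟩ (y K.* y K.* K.- p[x]⁻¹))
    system y = proj₁ (hankel N w h (λ i j _ _ → gram i j)
      (λ k k+1<N → K.trans (h-value k) (K.trans
        (K.+-cong (s-power-below (suc k) k+1<N) (K.*-congˡ (s-power-below k (ℕ.<⇒≤ k+1<N))))
        (K.trans (K.+-identityˡ _) (K.zeroʳ _))))
      (λ { k ≡.refl → K.trans (h-value k) (K.trans
        (K.+-cong s-power-top (K.*-congˡ (s-power-below k ℕ.≤-refl)))
        (K.trans (K.+-congˡ (K.zeroʳ _)) (K.+-identityʳ _))) })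
      (F.ι y) _
      (K.trans (s-cong (F.trans (F.*-comm _ _) (F.*-congʳ (F.sym (F.*-homo y y)))))
          (K.trans (s-* (y K.* y) γ) (K.*-congˡ s-γ)))
      (λ i i<N → K.trans (s-cong (F.trans
        (Fₛ.solve 4 (λ g y t r → g Fₛ.:* (y Fₛ.:* (t Fₛ.:* r)) Fₛ.:= y Fₛ.:* (g Fₛ.:* (t Fₛ.:* r)))
            F.refl γ (F.ι y) θ-x (θ ^ i))
        (F.*-congˡ (cancel-γ (θ ^ i)))))
            (K.trans (s-* y (θ ^ i)) (K.trans (K.*-congˡ (s-power-below i i<N)) (K.zeroʳ y)))))

    1/p′ = F.inverse ⟦ K[X].derivative p ⟧ derivative≉0

    -- Dividing by p′(θ) compensates the factor in Euler's formula, so the trace form scaled by α is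
    -- s(γ y²).
    α : F.Carrier
    α = γ F.* proj₁ 1/p′

    α*p′ : α F.* ⟦ K[X].derivative p ⟧ F.≈ γ
    α*p′ = F.trans (F.*-assoc _ _ _)
        (F.trans (F.*-congˡ (F.trans (F.*-comm _ _) (proj₂ 1/p′))) (F.*-identityʳ γ))

    α≉0 : ¬ α F.≈ F.0#
    α≉0 α≈0 = F.1≉0 (F.trans (F.sym θ-x*γ) (F.trans (F.*-congˡ
      (F.trans (F.sym α*p′) (F.trans (F.*-congʳ α≈0) (F.zeroˡ _)))) (F.zeroʳ _)))

    trace-form : ∀ y → QuadraticForm.Q (scaledTraceForm F powerBasis α) y K.≈ β y y
    trace-form y = K.trans (euler (α F.* (y F.* y))) (s-cong (F.trans
      (Fₛ.solve 3 (λ a y d → a Fₛ.:* y Fₛ.:* d Fₛ.:= a Fₛ.:* d Fₛ.:* y) F.refl α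
          (y F.* y) ⟦ K[X].derivative p ⟧)
      (F.*-congʳ α*p′)))

-- From quadratic forms to scaled trace forms and back

module FromQuadraticForm {K : Field c ℓ} (2≉0 : Characteristic≢2 K) {V : LeftModule (Field.ring K) m ℓm}
  (q : QuadraticForm {K = K} V) where
  open Field K hiding (zero)
  open LeftModule V
  open QuadraticForm q
  open IntegerSolver commutativeRing using (solve; _:=_; _:+_; _:*_; _:-_; :-_; con)
  open SetoidReasoning setoid

  half = proj₁ (inverse (1# + 1#) 2≉0)

  2*half : (1# + 1#) * half ≈ 1#
  2*half = proj₂ (inverse (1# + 1#) 2≉0)

  polar-sym : ∀ x y → polar x y ≈ polar y x
  polar-sym x y = trans (+-congʳ (+-congʳ (Q-cong (+ᴹ-comm x y))))
    (solve 3 (λ s x y → s :- x :- y := s :- y :- x) refl (Q (y +ᴹ x)) (Q x) (Q y))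

  polar-cong : ∀ {x x′ y y′} → x ≈ᴹ x′ → y ≈ᴹ y′ → polar x y ≈ polar x′ y′
  polar-cong e f = +-cong (+-cong (Q-cong (+ᴹ-cong e f)) (-‿cong (Q-cong e))) (-‿cong (Q-cong f))

  -- The factor 1/2 makes the norm of x equal to Q x.
  half-polar : SymmetricBilinear K V
  half-polar = record
    { β = λ x y → half * polar x y
    ; β-cong = λ e f → *-congˡ (polar-cong e f)
    ; β-sym = λ x y → *-congˡ (polar-sym x y)
    ; β-+ˡ = λ x y z → trans (*-congˡ (polar-+ x y z)) (distribˡ _ _ _)
    ; β-*ˡ = λ a x y → trans (*-congˡ (polar-* a x y))
        (solve 3 (λ h a p → h :* (a :* p) := a :* (h :* p)) refl half a (polar x y)) }

  half-polar-diagonal : ∀ x → half * polar x x ≈ Q x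
  half-polar-diagonal x = begin
    half * (Q (x +ᴹ x) - Q x - Q x)
      ≈⟨ *-congˡ (+-congʳ (+-congʳ (trans (Q-cong x+x≈2x) (Q-*ₗ (1# + 1#) x)))) ⟩
    half * ((1# + 1#) * (1# + 1#) * Q x - Q x - Q x)
      ≈⟨ solve 2 (λ h q → let 2′ = con (+ 1) :+ con (+ 1) in
           h :* (2′ :* 2′ :* q :- q :- q) := 2′ :* h :* q) refl half (Q x) ⟩
    (1# + 1#) * half * Q x ≈⟨ *-congʳ 2*half ⟩
    1# * Q x               ≈⟨ *-identityˡ _ ⟩
    Q x                    ∎
    where
    x+x≈2x : x +ᴹ x ≈ᴹ (1# + 1#) *ₗ x
    x+x≈2x = ≈ᴹ-sym (≈ᴹ-trans (*ₗ-distribʳ x 1# 1#) (+ᴹ-cong (*ₗ-identityˡ x) (*ₗ-identityˡ x)))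

  half-polar-nonDegenerate : NonDegenerate → ∀ x → (∀ y → half * polar x y ≈ 0#) → x ≈ᴹ 0ᴹ
  half-polar-nonDegenerate nd x e = nd x λ y → begin
    polar x y                       ≈⟨ *-identityˡ _ ⟨
    1# * polar x y                  ≈⟨ *-congʳ 2*half ⟨
    (1# + 1#) * half * polar x y    ≈⟨ *-assoc _ _ _ ⟩
    (1# + 1#) * (half * polar x y)  ≈⟨ *-congˡ (e y) ⟩
    (1# + 1#) * 0#                  ≈⟨ zeroʳ _ ⟩
    0#                              ∎

∷ʳ-all : {A : Set c} (P : A → Set ℓ) (a : ℕ → A) → (∀ i → P (a i)) → ∀ N {d} → P d → ∀ i →
    P ((a ∷ʳ⟨ N ⟩ d) i)
∷ʳ-all P a Pa zero    Pd i       = Pd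
∷ʳ-all P a Pa (suc N) Pd zero    = Pa 0
∷ʳ-all P a Pa (suc N) Pd (suc i) = ∷ʳ-all P (λ i → a (suc i)) (λ i → Pa (suc i)) N Pd i

∷ʳ-cong : (R : CommutativeRing c ℓ) → let open CommutativeRing R in
          (a : ℕ → Carrier) → ∀ N {d d′} → d ≈ d′ → ∀ i → (a ∷ʳ⟨ N ⟩ d) i ≈ (a ∷ʳ⟨ N ⟩ d′) i
∷ʳ-cong R a zero    e i       = e
∷ʳ-cong R a (suc N) e zero    = CommutativeRing.refl R
∷ʳ-cong R a (suc N) e (suc i) = ∷ʳ-cong R (λ i → a (suc i)) N e i

separable-extension⇒scaled-trace-form :
  (∀ {a : Level} → ExcludedMiddle a) →
  ∀ {c ℓ m ℓm : Level} (K : Field c ℓ) → PAC K → (2≉0 : Characteristic≢2 K) →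
  ∀ N (V : LeftModule (Field.ring K) m ℓm) → Basis {K = K} V (suc N) →
  (q : QuadraticForm {K = K} V) → QuadraticForm.NonDegenerate q →
  HasSeparableExtension K (suc N) → IsScaledTraceForm q
separable-extension⇒scaled-trace-form em K pac 2≉0 N V bV q nd (F , basis , sep) =
  -- The trace is taken in the power basis, where Euler's formula expresses it through s.
  F , suc N , powerBasis , α , sep , α≉0 , φ , φ-iso , λ x →
    trans (trace-form (φ x)) (trans (φ-isometric x) (half-polar-diagonal x))
  where
  open Field K hiding (zero)
  open IntegerSolver commutativeRing using (solve; _:=_; _:*_; :-_; con)
  module F = Extension F
  g = SimpleExtension.primitive-element em K F pac basis sep
  open PowerBasis em K F basis g using (powerBasis)
  open TraceForm em K pac 2≉0 F basis g using (twist; module Twisted)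
  open FromQuadraticForm 2≉0 q
  module O = Orthogonal em K V half-polar
  open Alternating commutativeRing
  integral = field-integral em K

  -1≉0 : ¬ - 1# ≈ 0#
  -1≉0 e = 1≉0 (trans (solve 0 (con (+ 1) := :- (:- con (+ 1))) refl)
    (trans (-‿cong e) (solve 0 (:- con (+ 0) := con (+ 0)) refl)))

  signs≉0 : ∀ i → ¬ signs i ≈ 0#
  signs≉0 zero          = 1≉0
  signs≉0 (suc zero)    = -1≉0
  signs≉0 (suc (suc i)) = signs≉0 i

  diagonal = O.Diagonalisation.diagonalise 2≉0 bV (half-polar-nonDegenerate nd)
  reshaped = O.Reshape.reshape (Quadrics.represent em K pac 2≉0) N signs signs≉0
    (proj₁ diagonal) (proj₁ (proj₂ diagonal)) (proj₂ (proj₂ diagonal))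
  d = proj₁ reshaped
  d≉0 = proj₁ (proj₂ reshaped)
  S = proj₁ (proj₂ (proj₂ reshaped))

  -- From y² = - d p(x) the last norm - y² / p(x) becomes d.
  twisted = twist (- d) (λ e → d≉0 (trans (solve 1 (λ d → d := :- (:- d)) refl d)
    (trans (-‿cong e) (solve 0 (:- con (+ 0) := con (+ 0)) refl))))
  x = proj₁ twisted
  y = proj₁ (proj₂ twisted)
  px = Polynomial.eval commutativeRing x (SimpleExtension.Generator.p g)
  y²≈ : y * y ≈ - d * px
  y²≈ = proj₁ (proj₂ (proj₂ twisted))
  px≉0 : ¬ px ≈ 0#
  -- A zero of p at x would give y² = 0, but `twist` returns y ≠ 0.
  px≉0 e = proj₂ (proj₂ (proj₂ twisted))
      (integral-≉0 commutativeRing integral (proj₂ (proj₂ (proj₂ twisted)))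
    (trans y²≈ (trans (*-congˡ e) (zeroʳ _))))

  open Twisted x px≉0

  last-norm : y * y * - p[x]⁻¹ ≈ d
  last-norm = trans (*-congʳ y²≈) (trans
    (solve 3 (λ d p i → :- d :* p :* :- i := d :* (p :* i)) refl d px p[x]⁻¹)
    (trans (*-congˡ (proj₂ (inverse px px≉0))) (*-identityʳ d)))

  module O′ = Orthogonal em K F.vectorSpace form

  T : O′.System (signs ∷ʳ⟨ N ⟩ d)
  T = record { vector = O′.vector T₀ ; orthogonal = O′.orthogonal T₀ ; norm = λ i → trans (O′.norm T₀ i)
      (∷ʳ-cong commutativeRing signs N last-norm i) }
    where T₀ = system y

  iso = isometry em K V F.vectorSpace half-polar form bV basis
      (∷ʳ-all (λ t → ¬ t ≈ 0#) signs signs≉0 N d≉0) S T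
  φ = proj₁ iso
  φ-iso = proj₁ (proj₂ iso)
  φ-isometric = proj₂ (proj₂ iso)

scaled-trace-form⇒separable-extension :
  ∀ {c ℓ m ℓm : Level} (K : Field c ℓ) {n} (V : LeftModule (Field.ring K) m ℓm) → Basis {K = K} V n →
  (q : QuadraticForm {K = K} V) → IsScaledTraceForm q → HasSeparableExtension K n
scaled-trace-form⇒separable-extension K {n} V bV q (F , _ , _ , _ , sep , _ , φ , φ-iso , _) =
  F , basis , sep
  where
  module K = Field K
  module V = LeftModule V
  module F = Extension F
  open Basis bV
  open LeftModuleMorphisms (LeftModule.rawLeftModule V) (LeftModule.rawLeftModule F.vectorSpace)
  open IsLeftModuleIsomorphism φ-iso
  open LinearCombination K V using () renaming (comb to combⱽ)
  open LinearCombination K F.vectorSpace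

  φ-comb : ∀ {k} (a : Vector K.Carrier k) u → φ (combⱽ a u) F.≈ comb a (λ i → φ (u i))
  φ-comb {zero}  a u = 0ᴹ-homo
  φ-comb {suc k} a u = F.trans (+ᴹ-homo _ _)
    (F.+-cong (*ₗ-homo (a zero) (u zero)) (φ-comb (λ i → a (suc i)) (λ i → u (suc i))))

  basis : Basis {K = K} F.vectorSpace n
  -- `IsScaledTraceForm` leaves the degree of F open; the basis carried over from V has n members by
  -- construction.
  basis = record
    { vec = λ i → φ (vec i)
    ; coord = λ y → coord (proj₁ (surjective y))
    ; spanning = λ y → F.trans (F.sym (proj₂ (surjective y) V.≈ᴹ-refl))
        (F.trans (⟦⟧-cong (spanning (proj₁ (surjective y)))) (φ-comb _ vec))
    ; independent = λ a e → independent a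
        (injective (F.trans (φ-comb a vec) (F.trans e (F.sym 0ᴹ-homo))))
    }

theorem3 : (∀ {a : Level} → ExcludedMiddle a) →
    ∀ {c ℓ m ℓm : Level} (K : Field c ℓ) →
    PAC K → Characteristic≢2 K →
    (n : ℕ) → 1 ≤ n →
    (V : LeftModule (Field.ring K) m ℓm) → Basis {K = K} V n →
    (q : QuadraticForm {K = K} V) → QuadraticForm.NonDegenerate q →
    IsScaledTraceForm q ⇔ HasSeparableExtension K n
theorem3 em K pac 2≉0 (suc N) (s≤s _) V bV q nd = mk⇔
  (scaled-trace-form⇒separable-extension K V bV q)
  (separable-extension⇒scaled-trace-form em K pac 2≉0 N V bV q nd)
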